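{- If $T$ is a theory such that ${\rm LZFC}\subseteq T$ and $T\vdash \text{V-P-H}$, then ${\rm ZFC}\subseteq T+VP$ (i.e., $T+VP$ proves every axiom of ZFC).
   Context: Theories are first-order theories in the language of set theory $\{\in\}$; $S\subseteq T$ means that every theorem of $S$ is a theorem of $T$. BST is the theory with axioms: Empty set, Extensionality, Pair, Union, Cartesian Product, "$\omega$ exists", $\Delta_0$-Separation. $Loc({\rm ZFC})$ is the statement $\forall x\exists y(x\in y\wedge Tr(y)\wedge (y,\in)\models{\rm ZFC})$, where $Tr(y)$ means $y$ is transitive; ${\rm LZFC}={\rm BST}+Loc({\rm ZFC})$. V-P-H is the statement: for every infinite set $A$ there is a binary relation $R\subset A\times A$ such that the graph $(A,R)$ is rigid, i.e., the only endomorphism of $(A,R)$ is the identity, where an endomorphism is a map $f:A\to A$ such that $(x,y)\in R\Rightarrow (f(x),f(y))\in R$ for all $x,y\in A$. $VP$ (Vopěnka's Principle) is the scheme consisting of the following statement for each formula $\phi(x)$ of the language $\{\in\}$ (set parameters allowed), where $X_\phi=\{x:\phi(x)\}$: if $X_\phi$ is a proper class of structures of some fixed first-order language, then there are distinct $x,y\in X_\phi$ and an elementary embedding $j:x\rightarrow y$ (possibly trivial, i.e. $x\prec y$). -}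

module Defs where

open import Data.Fin using (Fin; zero; suc; toℕ; lift; opposite; _↑ʳ_)
open import Data.List using (List; []; _∷_; map; foldr)
open import Data.List.Membership.Propositional using (_∈_)
open import Data.Nat using (ℕ; zero; suc; _+_)
open import Data.Vec.Functional as Vector using ()
open import Function using (id; _∘_)
open import Level using (Level; 0ℓ) renaming (suc to lsuc)
open import Relation.Binary.PropositionalEquality using (_≡_)
open import Relation.Unary using (Pred; _∪_; ｛_｝)

private
  variable
    ℓ ℓ₁ ℓ₂ : Level
    m n : ℕ

-- Well-scoped de Bruijn syntax: the free variables of a Formula n are the
-- elements of Fin n.  The remaining connectives are classical abbreviations.

infix  9 _≐_ _∊_
infixr 5 _⇒_
infix  4 ∀′_

data Formula : ℕ → Set where
  ⊥ᶠ  : Formula n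
  _≐_ : Fin n → Fin n → Formula n
  _∊_ : Fin n → Fin n → Formula n
  _⇒_ : Formula n → Formula n → Formula n
  ∀′_ : Formula (suc n) → Formula n

Sentence : Set
Sentence = Formula 0

infix  8 ¬′_
infixr 7 _∧_
infixr 6 _∨_
infix  5 _⇔_
infix  4 ∃′_

¬′_ : Formula n → Formula n
¬′ φ = φ ⇒ ⊥ᶠ

_∧_ _∨_ _⇔_ : Formula n → Formula n → Formula n
φ ∧ ψ = ¬′ (φ ⇒ ¬′ ψ)
φ ∨ ψ = ¬′ φ ⇒ ψ
φ ⇔ ψ = (φ ⇒ ψ) ∧ (ψ ⇒ φ)

∃′_ : Formula (suc n) → Formula n
∃′ φ = ¬′ (∀′ ¬′ φ)

rename : (Fin m → Fin n) → Formula m → Formula n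
rename ρ ⊥ᶠ      = ⊥ᶠ
rename ρ (x ≐ y) = ρ x ≐ ρ y
rename ρ (x ∊ y) = ρ x ∊ ρ y
rename ρ (φ ⇒ ψ) = rename ρ φ ⇒ rename ρ ψ
rename ρ (∀′ φ)  = ∀′ rename (lift 1 ρ) φ

_[_] : Formula (suc n) → Fin n → Formula n
φ [ x ] = rename (x Vector.∷ id) φ

∀* : Formula n → Sentence
∀* {zero}  φ = φ
∀* {suc n} φ = ∀* (∀′ φ)

Theory : (ℓ : Level) → Set (lsuc ℓ)
Theory ℓ = Pred Sentence ℓ

-- Classical natural deduction.  The variables of a derivation are explicit,
-- so the convention that domains are nonempty needs a rule of its own.

infix 3 _∣_⊢_ _⊢_ _⊑_

data _∣_⊢_ (T : Theory ℓ) {n : ℕ} (Γ : List (Formula n)) : Formula n → Set ℓ where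
  axiom    : ∀ {σ} → T σ → T ∣ Γ ⊢ rename (λ ()) σ
  assume   : ∀ {φ} → φ ∈ Γ → T ∣ Γ ⊢ φ
  ⇒-intro  : ∀ {φ ψ} → T ∣ φ ∷ Γ ⊢ ψ → T ∣ Γ ⊢ φ ⇒ ψ
  ⇒-elim   : ∀ {φ ψ} → T ∣ Γ ⊢ φ ⇒ ψ → T ∣ Γ ⊢ φ → T ∣ Γ ⊢ ψ
  raa      : ∀ {φ} → T ∣ ¬′ φ ∷ Γ ⊢ ⊥ᶠ → T ∣ Γ ⊢ φ
  ∀-intro  : ∀ {φ} → T ∣ map (rename suc) Γ ⊢ φ → T ∣ Γ ⊢ ∀′ φ
  ∀-elim   : ∀ {φ} → T ∣ Γ ⊢ ∀′ φ → (x : Fin n) → T ∣ Γ ⊢ φ [ x ]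
  ≐-refl   : ∀ x → T ∣ Γ ⊢ x ≐ x
  ≐-subst  : ∀ {x y} (φ : Formula (suc n)) →
             T ∣ Γ ⊢ x ≐ y → T ∣ Γ ⊢ φ [ x ] → T ∣ Γ ⊢ φ [ y ]
  nonempty : T ∣ Γ ⊢ ∃′ zero ≐ zero

_⊢_ : Theory ℓ → Sentence → Set ℓ
T ⊢ σ = T ∣ [] ⊢ σ

_⊑_ : Theory ℓ₁ → Theory ℓ₂ → Set _
T₁ ⊑ T₂ = ∀ σ → T₁ ⊢ σ → T₂ ⊢ σ

-- A quantifier hands its body the new variable; x ↑ k is the variable x seen
-- from under k further quantifiers.

infixl 10 _↑_

_↑_ : Fin n → (k : ℕ) → Fin (k + n)
x ↑ k = k ↑ʳ x

forAll exists : (Fin (suc n) → Formula (suc n)) → Formula n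
forAll φ = ∀′ φ zero
exists φ = ∃′ φ zero

forAllIn existsIn : Fin n → (Fin (suc n) → Formula (suc n)) → Formula n
forAllIn y φ = ∀′ (zero ∊ suc y ⇒ φ zero)
existsIn y φ = ∃′ (zero ∊ suc y ∧ φ zero)

infix 4 forAll exists forAllIn existsIn

syntax forAll (λ x → φ)     = ∀[ x ] φ
syntax exists (λ x → φ)     = ∃[ x ] φ
syntax forAllIn y (λ x → φ) = ∀[ x ∈ y ] φ
syntax existsIn y (λ x → φ) = ∃[ x ∈ y ] φ

-- Set terms.  They are not part of the object language: x ≐ᵗ t and t ∊ᵗ y
-- abbreviate formulas in which t is eliminated in favour of its definition.

data Term (n : ℕ) : Set where
  v     : Fin n → Term n
  ∅     : Term n
  S     : Term n → Term n             -- t ∪ {t}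
  ｛_⸴_｝ : Term n → Term n → Term n    -- unordered pair

⟨_,_⟩ : Term n → Term n → Term n
⟨ t , u ⟩ = ｛ ｛ t ⸴ t ｝ ⸴ ｛ t ⸴ u ｝ ｝

# : ℕ → Term n
# zero    = ∅
# (suc k) = S (# k)

-- denotes ρ t x says that x is the value of t, whose variables are read
-- through ρ.
denotes : (Fin m → Fin n) → Term m → Fin n → Formula n
denotes ρ (v y)       x = x ≐ ρ y
denotes ρ ∅           x = ∀[ z ] ¬′ (z ∊ x ↑ 1)
denotes ρ (S t)       x = ∃[ y ] denotes (suc ∘ ρ) t y ∧
                            (∀[ z ] z ∊ x ↑ 2 ⇔ z ∊ y ↑ 1 ∨ z ≐ y ↑ 1)
denotes ρ ｛ t ⸴ u ｝ x = ∃[ y ] ∃[ z ]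
                            denotes (λ i → ρ i ↑ 2) t (y ↑ 1) ∧
                            denotes (λ i → ρ i ↑ 2) u z ∧
                            (∀[ w ] w ∊ x ↑ 3 ⇔ w ≐ y ↑ 2 ∨ w ≐ z ↑ 1)

infix 9 _≐ᵗ_ _∊ᵗ_

_≐ᵗ_ : Fin n → Term n → Formula n
x ≐ᵗ t = denotes id t x

_∊ᵗ_ : Term n → Fin n → Formula n
t ∊ᵗ y = ∃[ x ] denotes suc t x ∧ x ∊ y ↑ 1

infix 9 _⊆′_
infix 9 _∶_⟶_

_⊆′_ : Fin n → Fin n → Formula n
x ⊆′ y = ∀[ z ∈ x ] z ∊ y ↑ 1

Transitive : Fin n → Formula n
Transitive y = ∀[ z ∈ y ] z ⊆′ y ↑ 1

Inductive : Fin n → Formula n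
Inductive w = ∅ ∊ᵗ w ∧ (∀[ x ∈ w ] S (v x) ∊ᵗ w ↑ 1)

IsOmega : Fin n → Formula n
IsOmega w = Inductive w ∧ (∀[ z ] Inductive z ⇒ w ↑ 1 ⊆′ z)

IsProduct : Fin n → Fin n → Fin n → Formula n
IsProduct z x y =
  ∀[ p ] p ∊ z ↑ 1 ⇔ (∃[ a ∈ x ↑ 1 ] ∃[ b ∈ y ↑ 2 ] p ↑ 2 ≐ᵗ ⟨ v (a ↑ 1) , v b ⟩)

IsRelation : Fin n → Fin n → Fin n → Formula n
IsRelation r A B =
  ∀[ p ∈ r ] ∃[ a ∈ A ↑ 1 ] ∃[ b ∈ B ↑ 2 ] p ↑ 2 ≐ᵗ ⟨ v (a ↑ 1) , v b ⟩

_∶_⟶_ : Fin n → Fin n → Fin n → Formula n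
f ∶ A ⟶ B =
  IsRelation f A B ∧
  (∀[ a ∈ A ] ∃[ b ] ∀[ c ] ⟨ v (a ↑ 2) , v c ⟩ ∊ᵗ f ↑ 3 ⇔ c ≐ b ↑ 1)

IsBijection : Fin n → Fin n → Fin n → Formula n
IsBijection f A B =
  f ∶ A ⟶ B ∧
  (∀[ b ∈ B ] ∃[ a ] ∀[ c ] ⟨ v c , v (b ↑ 2) ⟩ ∊ᵗ f ↑ 3 ⇔ c ≐ a ↑ 1)

Finite : Fin n → Formula n
Finite A = ∃[ ω ] IsOmega ω ∧
             (∃[ k ∈ ω ] ∃[ f ] IsBijection f (k ↑ 1) (A ↑ 3))

data Δ₀ : Formula n → Set where
  ⊥ᶠ  : Δ₀ {n} ⊥ᶠ
  _≐_ : (x y : Fin n) → Δ₀ (x ≐ y)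
  _∊_ : (x y : Fin n) → Δ₀ (x ∊ y)
  _⇒_ : {φ ψ : Formula n} → Δ₀ φ → Δ₀ ψ → Δ₀ (φ ⇒ ψ)
  ∀∈  : (y : Fin n) {φ : Formula (suc n)} → Δ₀ φ → Δ₀ (∀′ (zero ∊ suc y ⇒ φ))
  ∃∈  : (y : Fin n) {φ : Formula (suc n)} → Δ₀ φ → Δ₀ (∃′ (zero ∊ suc y ∧ φ))

emptySet extensionality pairing union cartesianProduct omegaExists : Sentence
emptySet         = ∃[ x ] ∀[ y ] ¬′ (y ∊ x ↑ 1)
extensionality   = ∀[ x ] ∀[ y ] (∀[ z ] z ∊ x ↑ 2 ⇔ z ∊ y ↑ 1) ⇒ x ↑ 1 ≐ y
pairing          = ∀[ x ] ∀[ y ] ∃[ z ] ∀[ w ] w ∊ z ↑ 1 ⇔ w ≐ x ↑ 3 ∨ w ≐ y ↑ 2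
union            = ∀[ x ] ∃[ y ] ∀[ z ] z ∊ y ↑ 1 ⇔ (∃[ w ∈ x ↑ 2 ] z ↑ 1 ∊ w)
cartesianProduct = ∀[ x ] ∀[ y ] ∃[ z ] IsProduct z (x ↑ 2) (y ↑ 1)
omegaExists      = ∃[ w ] IsOmega w

-- In φ, variable 0 is the element being tested and the others are parameters.
separation : Formula (suc n) → Sentence
separation φ =
  ∀* (∀[ a ] ∃[ b ] ∀[ x ]
        x ∊ b ↑ 1 ⇔ x ∊ a ↑ 2 ∧ rename (x Vector.∷ (3 ↑ʳ_)) φ)

finiteBST : List Sentence
finiteBST = emptySet ∷ extensionality ∷ pairing ∷ union
          ∷ cartesianProduct ∷ omegaExists ∷ []

data BST : Theory 0ℓ where
  finite : ∀ {σ} → σ ∈ finiteBST → BST σ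
  Δ₀-sep : {φ : Formula (suc n)} → Δ₀ φ → BST (separation φ)

foundation powerset infinity choice : Sentence
foundation = ∀[ x ] (∃[ y ] y ∊ x ↑ 1) ⇒
               (∃[ y ∈ x ] ¬′ (∃[ z ∈ x ↑ 1 ] z ∊ y ↑ 1))
powerset   = ∀[ x ] ∃[ y ] ∀[ z ] z ∊ y ↑ 1 ⇔ z ⊆′ x ↑ 2
infinity   = ∃[ w ] Inductive w
choice     = ∀[ A ]
  (∀[ x ∈ A ] ∃[ z ] z ∊ x ↑ 1) ∧
  (∀[ x ∈ A ] ∀[ y ∈ A ↑ 1 ] (∃[ z ] z ∊ x ↑ 2 ∧ z ∊ y ↑ 1) ⇒ x ↑ 1 ≐ y) ⇒
  (∃[ c ] ∀[ x ∈ A ↑ 1 ] ∃[ z ] ∀[ u ] u ∊ x ↑ 2 ∧ u ∊ c ↑ 3 ⇔ u ≐ z ↑ 1)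

-- In φ, variable 0 is the argument, variable 1 the value, and the others are
-- parameters.
replacement : Formula (2 + n) → Sentence
replacement φ =
  ∀* (∀[ a ]
        (∀[ x ∈ a ] ∃[ z ] ∀[ y ]
           rename (x ↑ 2 Vector.∷ y Vector.∷ (4 ↑ʳ_)) φ ⇒ y ≐ z ↑ 1) ⇒
        (∃[ b ] ∀[ y ] y ∊ b ↑ 1 ⇔
           (∃[ x ∈ a ↑ 2 ] rename (x Vector.∷ y ↑ 1 Vector.∷ (4 ↑ʳ_)) φ)))

finiteZFC : List Sentence
finiteZFC = extensionality ∷ foundation ∷ pairing ∷ union ∷ powerset
          ∷ infinity ∷ choice ∷ []

data ZFC : Theory 0ℓ where
  finite : ∀ {σ} → σ ∈ finiteZFC → ZFC σ
  sep    : (φ : Formula (suc n)) → ZFC (separation φ)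
  repl   : (φ : Formula (2 + n)) → ZFC (replacement φ)

-- A language is a pair of functions ρ, γ giving the arities in ω of its
-- relation symbols (the domain of ρ) and of its function symbols (the domain
-- of γ, with constants of arity 0).
IsLanguage : Fin n → Fin n → Formula n
IsLanguage ρ γ = ∃[ ω ] IsOmega ω ∧
  (∃[ A ] ρ ↑ 2 ∶ A ⟶ ω ↑ 1) ∧ (∃[ A ] γ ↑ 2 ∶ A ⟶ ω ↑ 1)

-- A structure is a triple ⟨D,⟨I,J⟩⟩.  With n-tuples taken to be functions
-- u : n → D, the interpretations are stored uncurried: relation symbol r holds
-- of u when ⟨r,u⟩ ∈ I, and function symbol f has value d at u when
-- ⟨⟨f,u⟩,d⟩ ∈ J.
IsStructure : Fin n → Fin n → Fin n → Formula n
IsStructure ρ γ x = ∃[ D ] ∃[ I ] ∃[ J ]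
  x ↑ 3 ≐ᵗ ⟨ v (D ↑ 2) , ⟨ v (I ↑ 1) , v J ⟩ ⟩ ∧
  (∃[ d ] d ∊ D ↑ 3) ∧
  (∀[ p ∈ I ↑ 1 ] ∃[ r ] ∃[ k ] ∃[ u ]
     p ↑ 3 ≐ᵗ ⟨ v (r ↑ 2) , v u ⟩ ∧
     ⟨ v (r ↑ 2) , v (k ↑ 1) ⟩ ∊ᵗ ρ ↑ 7 ∧
     u ∶ k ↑ 1 ⟶ D ↑ 6) ∧
  (∀[ p ∈ J ] ∃[ f ] ∃[ k ] ∃[ u ] ∃[ d ∈ D ↑ 6 ]
     p ↑ 4 ≐ᵗ ⟨ ⟨ v (f ↑ 3) , v (u ↑ 1) ⟩ , v d ⟩ ∧
     ⟨ v (f ↑ 3) , v (k ↑ 2) ⟩ ∊ᵗ γ ↑ 8 ∧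
     u ↑ 1 ∶ k ↑ 2 ⟶ D ↑ 7) ∧
  (∀[ f ] ∀[ k ] ∀[ u ]
     ⟨ v (f ↑ 2) , v (k ↑ 1) ⟩ ∊ᵗ γ ↑ 6 ∧ u ∶ k ↑ 1 ⟶ D ↑ 5 ⇒
     (∃[ d ] ∀[ e ]
        ⟨ ⟨ v (f ↑ 4) , v (u ↑ 2) ⟩ , v e ⟩ ∊ᵗ J ↑ 5 ⇔ e ≐ d ↑ 1))

-- Codes of terms and formulas with named variables v_i, i ∈ ω.
varᶜ : Term n → Term n
varᶜ i = ⟨ # 0 , i ⟩

appᶜ : Term n → Term n → Term n
appᶜ f u = ⟨ # 1 , ⟨ f , u ⟩ ⟩

eqᶜ relᶜ impᶜ allᶜ : Term n → Term n → Term n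
eqᶜ  t u = ⟨ # 0 , ⟨ t , u ⟩ ⟩
relᶜ r u = ⟨ # 1 , ⟨ r , u ⟩ ⟩
impᶜ φ ψ = ⟨ # 3 , ⟨ φ , ψ ⟩ ⟩
allᶜ i φ = ⟨ # 4 , ⟨ i , φ ⟩ ⟩

botᶜ : Term n
botᶜ = ⟨ # 2 , ∅ ⟩

-- T is intended to consist of pairs ⟨k,t⟩ with t a term whose variables are
-- among v_0, …, v_{k-1}.  IsTermTuple T k u n says that u is an n-tuple of
-- such terms.
IsTermTuple : Fin n → Fin n → Fin n → Fin n → Formula n
IsTermTuple T k u n =
  (∃[ A ] u ↑ 1 ∶ n ↑ 1 ⟶ A) ∧
  (∀[ i ] ∀[ t ] ⟨ v (i ↑ 1) , v t ⟩ ∊ᵗ u ↑ 2 ⇒ ⟨ v (k ↑ 2) , v t ⟩ ∊ᵗ T ↑ 2)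

TermClosed : Fin n → Fin n → Fin n → Formula n
TermClosed ω γ T = ∀[ k ∈ ω ]
  (∀[ i ∈ k ] ⟨ v (k ↑ 1) , varᶜ (v i) ⟩ ∊ᵗ T ↑ 2) ∧
  (∀[ f ] ∀[ n ] ∀[ u ]
     ⟨ v (f ↑ 2) , v (n ↑ 1) ⟩ ∊ᵗ γ ↑ 4 ∧
     IsTermTuple (T ↑ 4) (k ↑ 3) u (n ↑ 1) ⇒
     ⟨ v (k ↑ 3) , appᶜ (v (f ↑ 2)) (v u) ⟩ ∊ᵗ T ↑ 4)

IsTerms : Fin n → Fin n → Fin n → Formula n
IsTerms ω γ T =
  TermClosed ω γ T ∧ (∀[ X ] TermClosed (ω ↑ 1) (γ ↑ 1) X ⇒ T ↑ 1 ⊆′ X)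

-- Likewise F consists of pairs ⟨k,φ⟩ with φ a formula all of whose variables,
-- free or bound, are among v_0, …, v_{k-1}.
FormulaClosed : Fin n → Fin n → Fin n → Fin n → Formula n
FormulaClosed ω ρ T F = ∀[ k ∈ ω ]
  (∀[ t ] ∀[ u ]
     ⟨ v (k ↑ 2) , v (t ↑ 1) ⟩ ∊ᵗ T ↑ 3 ∧ ⟨ v (k ↑ 2) , v u ⟩ ∊ᵗ T ↑ 3 ⇒
     ⟨ v (k ↑ 2) , eqᶜ (v (t ↑ 1)) (v u) ⟩ ∊ᵗ F ↑ 3) ∧
  (∀[ r ] ∀[ n ] ∀[ u ]
     ⟨ v (r ↑ 2) , v (n ↑ 1) ⟩ ∊ᵗ ρ ↑ 4 ∧
     IsTermTuple (T ↑ 4) (k ↑ 3) u (n ↑ 1) ⇒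
     ⟨ v (k ↑ 3) , relᶜ (v (r ↑ 2)) (v u) ⟩ ∊ᵗ F ↑ 4) ∧
  ⟨ v k , botᶜ ⟩ ∊ᵗ F ↑ 1 ∧
  (∀[ φ ] ∀[ ψ ]
     ⟨ v (k ↑ 2) , v (φ ↑ 1) ⟩ ∊ᵗ F ↑ 3 ∧ ⟨ v (k ↑ 2) , v ψ ⟩ ∊ᵗ F ↑ 3 ⇒
     ⟨ v (k ↑ 2) , impᶜ (v (φ ↑ 1)) (v ψ) ⟩ ∊ᵗ F ↑ 3) ∧
  (∀[ i ∈ k ] ∀[ φ ]
     ⟨ v (k ↑ 2) , v φ ⟩ ∊ᵗ F ↑ 3 ⇒
     ⟨ v (k ↑ 2) , allᶜ (v (i ↑ 1)) (v φ) ⟩ ∊ᵗ F ↑ 3)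

IsFormulas : Fin n → Fin n → Fin n → Fin n → Formula n
IsFormulas ω ρ T F =
  FormulaClosed ω ρ T F ∧
  (∀[ X ] FormulaClosed (ω ↑ 1) (ρ ↑ 1) (T ↑ 1) X ⇒ F ↑ 1 ⊆′ X)

IsSyntax : Fin n → Fin n → Fin n → Fin n → Fin n → Formula n
IsSyntax ρ γ ω T F = IsOmega ω ∧ IsTerms ω γ T ∧ IsFormulas ω ρ T F

-- Assignments are functions s : k → D with k ∈ ω, so that satisfaction in D is
-- a set whenever the finite sequences from D form one; assignments on all of ω
-- would require the set of all functions ω → D.

-- a is the tuple of the V-values of the term tuple u under s.
IsValueTuple : Fin n → Fin n → Fin n → Fin n → Formula n
IsValueTuple V s u a =
  ∀[ i ] ∀[ t ] ∀[ d ]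
    ⟨ v (i ↑ 2) , v (t ↑ 1) ⟩ ∊ᵗ u ↑ 3 ∧ ⟨ v (i ↑ 2) , v d ⟩ ∊ᵗ a ↑ 3 ⇒
    ⟨ ⟨ v (t ↑ 1) , v (s ↑ 3) ⟩ , v d ⟩ ∊ᵗ V ↑ 3

-- ⟨⟨t,s⟩,d⟩ ∈ V iff d is the value of the term t under s.
IsValuation : Fin n → Fin n → Fin n → Fin n → Fin n → Fin n → Formula n
IsValuation γ ω T D J V = ∀[ k ∈ ω ] ∀[ s ] s ∶ k ↑ 1 ⟶ D ↑ 2 ⇒
  (∀[ i ∈ k ↑ 1 ] ∀[ d ]
     ⟨ ⟨ varᶜ (v (i ↑ 1)) , v (s ↑ 2) ⟩ , v d ⟩ ∊ᵗ V ↑ 4 ⇔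
     ⟨ v (i ↑ 1) , v d ⟩ ∊ᵗ s ↑ 2) ∧
  (∀[ f ] ∀[ n ] ∀[ u ]
     ⟨ v (f ↑ 2) , v (n ↑ 1) ⟩ ∊ᵗ γ ↑ 5 ∧
     IsTermTuple (T ↑ 5) (k ↑ 4) u (n ↑ 1) ⇒
     (∀[ d ]
        ⟨ ⟨ appᶜ (v (f ↑ 3)) (v (u ↑ 1)) , v (s ↑ 4) ⟩ , v d ⟩ ∊ᵗ V ↑ 6 ⇔
        (∃[ a ]
           a ∶ n ↑ 3 ⟶ D ↑ 7 ∧
           IsValueTuple (V ↑ 7) (s ↑ 5) (u ↑ 2) a ∧
           ⟨ ⟨ v (f ↑ 4) , v a ⟩ , v (d ↑ 1) ⟩ ∊ᵗ J ↑ 7)))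

-- s and s′ agree except possibly at i.
Agree : Fin n → Fin n → Fin n → Formula n
Agree s s′ i = ∀[ j ] ∀[ d ] ¬′ (j ↑ 1 ≐ i ↑ 2) ⇒
  (⟨ v (j ↑ 1) , v d ⟩ ∊ᵗ s′ ↑ 2 ⇔ ⟨ v (j ↑ 1) , v d ⟩ ∊ᵗ s ↑ 2)

-- ⟨φ,s⟩ ∈ R iff φ is true under s.
IsTruth : Fin n → Fin n → Fin n → Fin n → Fin n → Fin n → Fin n → Fin n → Formula n
IsTruth ρ ω T F D I V R = ∀[ k ∈ ω ] ∀[ s ] s ∶ k ↑ 1 ⟶ D ↑ 2 ⇒
  (∀[ t ] ∀[ u ]
     ⟨ v (k ↑ 3) , v (t ↑ 1) ⟩ ∊ᵗ T ↑ 4 ∧ ⟨ v (k ↑ 3) , v u ⟩ ∊ᵗ T ↑ 4 ⇒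
     (⟨ eqᶜ (v (t ↑ 1)) (v u) , v (s ↑ 2) ⟩ ∊ᵗ R ↑ 4 ⇔
      (∃[ d ] ⟨ ⟨ v (t ↑ 2) , v (s ↑ 3) ⟩ , v d ⟩ ∊ᵗ V ↑ 5 ∧
              ⟨ ⟨ v (u ↑ 1) , v (s ↑ 3) ⟩ , v d ⟩ ∊ᵗ V ↑ 5))) ∧
  (∀[ r ] ∀[ n ] ∀[ u ]
     ⟨ v (r ↑ 2) , v (n ↑ 1) ⟩ ∊ᵗ ρ ↑ 5 ∧
     IsTermTuple (T ↑ 5) (k ↑ 4) u (n ↑ 1) ⇒
     (⟨ relᶜ (v (r ↑ 2)) (v u) , v (s ↑ 3) ⟩ ∊ᵗ R ↑ 5 ⇔
      (∃[ a ]
         a ∶ n ↑ 2 ⟶ D ↑ 6 ∧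
         IsValueTuple (V ↑ 6) (s ↑ 4) (u ↑ 1) a ∧
         ⟨ v (r ↑ 3) , v a ⟩ ∊ᵗ I ↑ 6))) ∧
  ¬′ (⟨ botᶜ , v s ⟩ ∊ᵗ R ↑ 2) ∧
  (∀[ φ ] ∀[ ψ ]
     ⟨ v (k ↑ 3) , v (φ ↑ 1) ⟩ ∊ᵗ F ↑ 4 ∧ ⟨ v (k ↑ 3) , v ψ ⟩ ∊ᵗ F ↑ 4 ⇒
     (⟨ impᶜ (v (φ ↑ 1)) (v ψ) , v (s ↑ 2) ⟩ ∊ᵗ R ↑ 4 ⇔
      (⟨ v (φ ↑ 1) , v (s ↑ 2) ⟩ ∊ᵗ R ↑ 4 ⇒ ⟨ v ψ , v (s ↑ 2) ⟩ ∊ᵗ R ↑ 4))) ∧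
  (∀[ i ∈ k ↑ 1 ] ∀[ φ ]
     ⟨ v (k ↑ 3) , v φ ⟩ ∊ᵗ F ↑ 4 ⇒
     (⟨ allᶜ (v (i ↑ 1)) (v φ) , v (s ↑ 2) ⟩ ∊ᵗ R ↑ 4 ⇔
      (∀[ s′ ] s′ ∶ k ↑ 4 ⟶ D ↑ 5 ∧ Agree (s ↑ 3) s′ (i ↑ 2) ⇒
               ⟨ v (φ ↑ 1) , v s′ ⟩ ∊ᵗ R ↑ 5)))

-- R is the satisfaction relation of the structure x, whose domain is D.
IsSatisfaction : Fin n → Fin n → Fin n → Fin n → Fin n → Fin n → Fin n → Fin n → Formula n
IsSatisfaction ρ γ ω T F x D R = ∃[ I ] ∃[ J ] ∃[ V ]
  x ↑ 3 ≐ᵗ ⟨ v (D ↑ 3) , ⟨ v (I ↑ 2) , v (J ↑ 1) ⟩ ⟩ ∧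
  IsValuation (γ ↑ 3) (ω ↑ 3) (T ↑ 3) (D ↑ 3) (J ↑ 1) V ∧
  IsTruth (ρ ↑ 3) (ω ↑ 3) (T ↑ 3) (F ↑ 3) (D ↑ 3) (I ↑ 2) V (R ↑ 3)

-- The symbol ∈ is coded by the relation symbol 0, of arity 2.
memᶜ : Term n → Term n → Term n
memᶜ i j = relᶜ (# 0) ｛ ⟨ # 0 , varᶜ i ⟩ ⸴ ⟨ # 1 , varᶜ j ⟩ ｝

notᶜ : Term n → Term n
notᶜ φ = impᶜ φ botᶜ

andᶜ iffᶜ exᶜ : Term n → Term n → Term n
andᶜ φ ψ = notᶜ (impᶜ φ (notᶜ ψ))
iffᶜ φ ψ = andᶜ (impᶜ φ ψ) (impᶜ ψ φ)
exᶜ  i φ = notᶜ (allᶜ i (notᶜ φ))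

-- The named variables are de Bruijn levels: the variable bound under m
-- quantifiers is v_m.
level : Fin m → Term n
level x = # (toℕ (opposite x))

⌜_⌝ : Formula m → Term n
⌜ ⊥ᶠ ⌝         = botᶜ
⌜ x ≐ y ⌝      = eqᶜ (varᶜ (level x)) (varᶜ (level y))
⌜ x ∊ y ⌝      = memᶜ (level x) (level y)
⌜ φ ⇒ ψ ⌝      = impᶜ ⌜ φ ⌝ ⌜ ψ ⌝
⌜_⌝ {m} (∀′ φ) = allᶜ (# m) ⌜ φ ⌝

-- Instances for a formula φ all of whose variables are among v_0, …, v_{k-1},
-- so that v_k, v_{k+1}, v_{k+2} are fresh.  The parameters of φ stay free.
separationᶜ : (k φ : Term n) → Term n
separationᶜ k φ =
  allᶜ a (exᶜ b (allᶜ x (iffᶜ (memᶜ x b) (andᶜ (memᶜ x a) φ))))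
  where
  x = # 0
  a = k
  b = S k

replacementᶜ : (k φ : Term n) → Term n
replacementᶜ k φ =
  allᶜ a (impᶜ
    (allᶜ x (impᶜ (memᶜ x a)
      (exᶜ z (allᶜ y (impᶜ φ (eqᶜ (varᶜ y) (varᶜ z)))))))
    (exᶜ b (allᶜ y (iffᶜ (memᶜ y b) (exᶜ x (andᶜ (memᶜ x a) φ))))))
  where
  x = # 0
  y = # 1
  a = k
  b = S k
  z = S (S k)

IsZFCAxiom : Fin n → Fin n → Fin n → Formula n
IsZFCAxiom ω F σ =
  foldr (λ τ χ → σ ≐ᵗ ⌜ τ ⌝ ∨ χ) ⊥ᶠ finiteZFC ∨
  (∃[ k ∈ ω ] ∃[ φ ]
     # 0 ∊ᵗ k ↑ 1 ∧ ⟨ v (k ↑ 1) , v φ ⟩ ∊ᵗ F ↑ 2 ∧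
     σ ↑ 2 ≐ᵗ separationᶜ (v (k ↑ 1)) (v φ)) ∨
  (∃[ k ∈ ω ] ∃[ φ ]
     # 1 ∊ᵗ k ↑ 1 ∧ ⟨ v (k ↑ 1) , v φ ⟩ ∊ᵗ F ↑ 2 ∧
     σ ↑ 2 ≐ᵗ replacementᶜ (v (k ↑ 1)) (v φ))

IsMembershipStructure : Fin n → Fin n → Formula n
IsMembershipStructure x y = ∃[ I ]
  x ↑ 1 ≐ᵗ ⟨ v (y ↑ 1) , ⟨ v I , ∅ ⟩ ⟩ ∧
  (∀[ p ] p ∊ I ↑ 1 ⇔
     (∃[ a ∈ y ↑ 2 ] ∃[ b ∈ y ↑ 3 ]
        a ↑ 1 ∊ b ∧
        p ↑ 2 ≐ᵗ ⟨ # 0 , ｛ ⟨ # 0 , v (a ↑ 1) ⟩ ⸴ ⟨ # 1 , v b ⟩ ｝ ⟩))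

-- The existence of the set of formulas and of the satisfaction relation is
-- part of the assertion.  A formula with free variables counts as true when it
-- is true under all assignments to its variables.
ModelsZFC : Fin n → Formula n
ModelsZFC y = ∃[ ρ ] ∃[ γ ] ∃[ ω ] ∃[ T ] ∃[ F ] ∃[ x ] ∃[ R ]
  ρ ↑ 6 ≐ᵗ ｛ ⟨ # 0 , # 2 ⟩ ⸴ ⟨ # 0 , # 2 ⟩ ｝ ∧
  γ ↑ 5 ≐ᵗ ∅ ∧
  IsSyntax (ρ ↑ 6) (γ ↑ 5) (ω ↑ 4) (T ↑ 3) (F ↑ 2) ∧
  IsMembershipStructure (x ↑ 1) (y ↑ 7) ∧
  IsSatisfaction (ρ ↑ 6) (γ ↑ 5) (ω ↑ 4) (T ↑ 3) (F ↑ 2) (x ↑ 1) (y ↑ 7) R ∧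
  (∀[ σ ] IsZFCAxiom (ω ↑ 5) (F ↑ 3) σ ⇒
    (∀[ k ∈ ω ↑ 5 ] ∀[ s ]
       ⟨ v (k ↑ 1) , v (σ ↑ 2) ⟩ ∊ᵗ F ↑ 5 ∧ s ∶ k ↑ 1 ⟶ y ↑ 10 ⇒
       ⟨ v (σ ↑ 2) , v s ⟩ ∊ᵗ R ↑ 3))

Loc-ZFC : Sentence
Loc-ZFC = ∀[ x ] ∃[ y ] x ↑ 1 ∊ y ∧ Transitive y ∧ ModelsZFC y

LZFC : Theory 0ℓ
LZFC = BST ∪ ｛ Loc-ZFC ｝

IsEndomorphism : Fin n → Fin n → Fin n → Formula n
IsEndomorphism f A R =
  f ∶ A ⟶ A ∧
  (∀[ x ] ∀[ y ] ∀[ x′ ] ∀[ y′ ]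
     ⟨ v (x ↑ 3) , v (y ↑ 2) ⟩ ∊ᵗ R ↑ 4 ∧
     ⟨ v (x ↑ 3) , v (x′ ↑ 1) ⟩ ∊ᵗ f ↑ 4 ∧
     ⟨ v (y ↑ 2) , v y′ ⟩ ∊ᵗ f ↑ 4 ⇒
     ⟨ v (x′ ↑ 1) , v y′ ⟩ ∊ᵗ R ↑ 4)

V-P-H : Sentence
V-P-H = ∀[ A ] ¬′ Finite A ⇒
  (∃[ R ]
     IsRelation R (A ↑ 1) (A ↑ 1) ∧
     (∀[ f ] IsEndomorphism f (A ↑ 2) (R ↑ 1) ⇒
        (∀[ x ∈ A ↑ 2 ] ⟨ v x , v x ⟩ ∊ᵗ f ↑ 1)))

-- For s′ with the same domain as s, this says s′ = j ∘ s.
IsImage : Fin n → Fin n → Fin n → Formula n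
IsImage j s s′ = ∀[ i ] ∀[ a ] ∀[ b ]
  ⟨ v (i ↑ 2) , v (a ↑ 1) ⟩ ∊ᵗ s ↑ 3 ∧ ⟨ v (a ↑ 1) , v b ⟩ ∊ᵗ j ↑ 3 ⇒
  ⟨ v (i ↑ 2) , v b ⟩ ∊ᵗ s′ ↑ 3

IsElementary : Fin n → Fin n → Fin n → Fin n → Fin n → Formula n
IsElementary ρ γ j x y =
  ∃[ ω ] ∃[ T ] ∃[ F ] ∃[ D ] ∃[ D′ ] ∃[ R ] ∃[ R′ ]
  IsSyntax (ρ ↑ 7) (γ ↑ 7) (ω ↑ 6) (T ↑ 5) (F ↑ 4) ∧
  IsSatisfaction (ρ ↑ 7) (γ ↑ 7) (ω ↑ 6) (T ↑ 5) (F ↑ 4) (x ↑ 7) (D ↑ 3) (R ↑ 1) ∧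
  IsSatisfaction (ρ ↑ 7) (γ ↑ 7) (ω ↑ 6) (T ↑ 5) (F ↑ 4) (y ↑ 7) (D′ ↑ 2) R′ ∧
  j ↑ 7 ∶ D ↑ 3 ⟶ D′ ↑ 2 ∧
  (∀[ k ∈ ω ↑ 6 ] ∀[ φ ] ∀[ s ] ∀[ s′ ]
     ⟨ v (k ↑ 3) , v (φ ↑ 2) ⟩ ∊ᵗ F ↑ 8 ∧
     s ↑ 1 ∶ k ↑ 3 ⟶ D ↑ 7 ∧ s′ ∶ k ↑ 3 ⟶ D′ ↑ 6 ∧
     IsImage (j ↑ 11) (s ↑ 1) s′ ⇒
     (⟨ v (φ ↑ 2) , v (s ↑ 1) ⟩ ∊ᵗ R ↑ 5 ⇔ ⟨ v (φ ↑ 2) , v s′ ⟩ ∊ᵗ R′ ↑ 4))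

-- The instance for X = {x : φ(x)}, where variable 0 of φ is x and the others
-- are parameters.  X is a proper class when no set has exactly its elements.
vopěnka : Formula (suc n) → Sentence
vopěnka φ = ∀* (∀[ ρ ] ∀[ γ ]
  IsLanguage (ρ ↑ 1) γ ∧
  (∀[ x ] rename (x Vector.∷ (3 ↑ʳ_)) φ ⇒ IsStructure (ρ ↑ 2) (γ ↑ 1) x) ∧
  ¬′ (∃[ z ] ∀[ x ] x ∊ z ↑ 1 ⇔ rename (x Vector.∷ (4 ↑ʳ_)) φ) ⇒
  (∃[ x ] ∃[ y ]
     rename (x ↑ 1 Vector.∷ (4 ↑ʳ_)) φ ∧ rename (y Vector.∷ (4 ↑ʳ_)) φ ∧
     ¬′ (x ↑ 1 ≐ y) ∧
     (∃[ j ] IsElementary (ρ ↑ 4) (γ ↑ 3) j (x ↑ 2) (y ↑ 1))))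

data VP : Theory 0ℓ where
  vp : (φ : Formula (suc n)) → VP (vopěnka φ)

-- By a constructive completeness theorem (Krivine), every axiom of ZFC may be
-- verified in the models of T + VP, where falsity is allowed to hold and
-- entails everything.  There are then no derivations to be written in the
-- object calculus.
--
-- For VP take the language with a nullary relation symbol for each element of
-- a set A.  A structure ⟨{y}, ⟨I, ∅⟩⟩ interprets the symbols by a subset of A
-- coded by I, and elementary embeddings preserve it.  So if I determines y,
-- distinct structures have no elementary embeddings between them, and by VP the
-- y that occur form a set.  Coding x by {x} gives Replacement, hence
-- Separation, and coding each subset of A by itself gives Powerset.
--
-- Foundation and Choice for x hold in a transitive model of ZFC that contains
-- x, and are absolute.  To read them off, the truth of the code of a formula in
-- the model is identified with its relativization, by induction on formulas.
module Submission where

open import Defs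
open import Data.Empty using (⊥-elim)
open import Data.Fin using (Fin; zero; suc; toℕ; opposite; _↑ʳ_) renaming (lift to liftᶠ)
open import Data.Fin.Patterns using (0F; 1F; 2F; 3F; 4F; 5F; 6F; 7F)
open import Data.Fin.Properties using (toℕ<n; toℕ-fromℕ; toℕ-inject₁)
open import Data.List using (List; []; _∷_; _++_; map; foldr; allFin; cartesianProductWith)
open import Data.List.Membership.Propositional using (_∈_)
open import Data.List.Membership.Propositional.Properties
  using (∈-map⁺; ∈-map⁻; ∈-++⁺ˡ; ∈-++⁺ʳ; ∈-cartesianProductWith⁺; ∈-allFin)
open import Data.List.Relation.Binary.Subset.Propositional using (_⊆_)
open import Data.List.Relation.Unary.All as All using (All; []; _∷_)
open import Data.List.Relation.Unary.All.Properties using (++⁺; map⁺)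
open import Data.List.Relation.Unary.Any using (here; there)
open import Data.Nat
  using (ℕ; zero; suc; _+_; _⊔_; _≤_; _<_; z≤n; s≤s; _≤?_; _≤′_; ≤′-refl; ≤′-step)
open import Data.Nat.Properties
  using (≤-refl; ≤-trans; ≤-antisym; 1+n≰n; ≰⇒>; n≤1+n; ≤⇒≤′; m≤m⊔n; m≤n⊔m; m≤n⇒m≤1+n;
         m≤m+n; +-suc; +-identityʳ; m⊔n≤o⇒m≤o; m⊔n≤o⇒n≤o; m≤n⇒m<n∨m≡n)
open import Data.Product using (Σ; ∃; _×_; _,_; proj₁; proj₂)
open import Data.Sum using (_⊎_; inj₁; inj₂)
open import Data.Vec.Functional as Vector using (Vector)
open import Function using (_∘_; id)
open import Level using (Level) renaming (suc to lsuc)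
open import Relation.Binary.PropositionalEquality
  using (_≡_; refl; sym; trans; cong; cong₂; subst; _≗_)
open import Relation.Nullary using (yes; no)
open import Relation.Unary using (_∪_; Pred)

-- The models are built without excluded middle. Whether a formula is consistent with a stage cannot
-- be decided, so it is added under the condition that a contradiction with it would already yield
-- the sentence to be proved. The price is that double negation elimination is at hand for
-- statements expressed by formulas, and not for arbitrary `Σ` types.
--
-- Nullary symbols are chosen because their truth is settled by the empty assignment: one atomic
-- clause of satisfaction suffices, and the condition that assignments correspond under the
-- embedding is vacuous. The domain `{y}` supplies the required element of a structure and also
-- records `y` so that a `Δ₀` formula can read it back. This matters because Vopěnka's principle
-- only gives a set of structures, from which `Δ₀`-Separation has to recover the set of the `y`.

private
  variable
    ℓ ℓ₁ ℓ₂ : Level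
    m n o : ℕ

-- Syntax

liftᶠ-∘ : {f : Fin m → Fin n} {g : Fin n → Fin o} {h : Fin m → Fin o} →
          g ∘ f ≗ h → liftᶠ 1 g ∘ liftᶠ 1 f ≗ liftᶠ 1 h
liftᶠ-∘ eq zero    = refl
liftᶠ-∘ eq (suc i) = cong suc (eq i)

-- The hypothesis is pointwise, since renamings that agree everywhere need not be propositionally
-- equal.
rename-∘ : {f : Fin m → Fin n} {g : Fin n → Fin o} {h : Fin m → Fin o} →
           g ∘ f ≗ h → ∀ φ → rename g (rename f φ) ≡ rename h φ
rename-∘ eq ⊥ᶠ      = refl
rename-∘ eq (x ≐ y) = cong₂ _≐_ (eq x) (eq y)
rename-∘ eq (x ∊ y) = cong₂ _∊_ (eq x) (eq y)
rename-∘ eq (φ ⇒ ψ) = cong₂ _⇒_ (rename-∘ eq φ) (rename-∘ eq ψ)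
rename-∘ eq (∀′ φ)  = cong ∀′_ (rename-∘ (liftᶠ-∘ eq) φ)

rename-id : {f : Fin n → Fin n} → f ≗ id → ∀ φ → rename f φ ≡ φ
rename-id eq ⊥ᶠ      = refl
rename-id eq (x ≐ y) = cong₂ _≐_ (eq x) (eq y)
rename-id eq (x ∊ y) = cong₂ _∊_ (eq x) (eq y)
rename-id eq (φ ⇒ ψ) = cong₂ _⇒_ (rename-id eq φ) (rename-id eq ψ)
rename-id {f = f} eq (∀′ φ) = cong ∀′_ (rename-id eq′ φ)
  where
  eq′ : liftᶠ 1 f ≗ id
  eq′ zero    = refl
  eq′ (suc i) = cong suc (eq i)

rename-cong : {f g : Fin m → Fin n} → f ≗ g → ∀ φ → rename f φ ≡ rename g φ
rename-cong {f = f} eq φ =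
  trans (cong (rename f) (sym (rename-id (λ _ → refl) φ))) (rename-∘ eq φ)

rename-square : {p : ℕ} {f : Fin m → Fin n} {g : Fin n → Fin p}
                {f′ : Fin m → Fin o} {g′ : Fin o → Fin p} →
                g ∘ f ≗ g′ ∘ f′ → ∀ φ → rename g (rename f φ) ≡ rename g′ (rename f′ φ)
rename-square eq φ = trans (rename-∘ eq φ) (sym (rename-∘ (λ _ → refl) φ))

rename-[] : (r : Fin m → Fin n) (φ : Formula (suc m)) (x : Fin m) →
            rename r (φ [ x ]) ≡ rename (liftᶠ 1 r) φ [ r x ]
rename-[] r φ x = rename-square (λ { zero → refl ; (suc i) → refl }) φ

-- Renaming, weakening and the replacement of axioms by their derivations, all
-- in one induction.
transport : {T : Theory ℓ₁} {T′ : Theory ℓ₂} {Γ : List (Formula m)} {Δ : List (Formula n)}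
            {φ : Formula m} →
            (∀ {τ} → T τ → ∀ {k} {Θ : List (Formula k)} → T′ ∣ Θ ⊢ rename (λ ()) τ) →
            (r : Fin m → Fin n) → (∀ {ψ} → ψ ∈ Γ → rename r ψ ∈ Δ) →
            T ∣ Γ ⊢ φ → T′ ∣ Δ ⊢ rename r φ
transport ax r s (axiom {σ} t) =
  subst (_ ∣ _ ⊢_) (sym (rename-∘ (λ ()) σ)) (ax t)
transport ax r s (assume i)    = assume (s i)
transport ax r s (⇒-intro d)   =
  ⇒-intro (transport ax r (λ { (here refl) → here refl ; (there i) → there (s i) }) d)
transport ax r s (⇒-elim d e)  = ⇒-elim (transport ax r s d) (transport ax r s e)
transport ax r s (raa d)       =
  raa (transport ax r (λ { (here refl) → here refl ; (there i) → there (s i) }) d)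
transport {Δ = Δ} ax r s (∀-intro d) = ∀-intro (transport ax (liftᶠ 1 r) s′ d)
  where
  s′ : ∀ {ψ} → ψ ∈ map (rename suc) _ → rename (liftᶠ 1 r) ψ ∈ map (rename suc) Δ
  s′ i with θ , j , refl ← ∈-map⁻ (rename suc) i =
    subst (_∈ _) (rename-square (λ _ → refl) θ) (∈-map⁺ (rename suc) (s j))
transport ax r s (∀-elim {φ} d x) =
  subst (_ ∣ _ ⊢_) (sym (rename-[] r φ x)) (∀-elim (transport ax r s d) (r x))
transport ax r s (≐-refl x)    = ≐-refl (r x)
transport ax r s (≐-subst {x} {y} φ d e) =
  subst (_ ∣ _ ⊢_) (sym (rename-[] r φ y))
    (≐-subst (rename (liftᶠ 1 r) φ) (transport ax r s d)
      (subst (_ ∣ _ ⊢_) (rename-[] r φ x) (transport ax r s e)))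
transport ax r s nonempty      = nonempty

module _ {T : Theory ℓ} where

  axiom′ : ∀ {τ} → T τ → ∀ {k} {Θ : List (Formula k)} → T ∣ Θ ⊢ rename (λ ()) τ
  axiom′ t = axiom t

  renameD : {Γ : List (Formula m)} {φ : Formula m} (r : Fin m → Fin n) →
            T ∣ Γ ⊢ φ → T ∣ map (rename r) Γ ⊢ rename r φ
  renameD r = transport axiom′ r (∈-map⁺ (rename r))

  weaken : {Γ Δ : List (Formula n)} {φ : Formula n} → Γ ⊆ Δ → T ∣ Γ ⊢ φ → T ∣ Δ ⊢ φ
  weaken s d = subst (T ∣ _ ⊢_) (rename-id (λ _ → refl) _)
    (transport axiom′ id (λ i → subst (_∈ _) (sym (rename-id (λ _ → refl) _)) (s i)) d)

  weaken-closed : {τ : Sentence} → T ⊢ τ → {Δ : List (Formula n)} → T ∣ Δ ⊢ rename (λ ()) τ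
  weaken-closed d = transport axiom′ (λ ()) (λ ()) d

  -- A dummy variable may be dropped, because the scope has another variable
  -- that it can be replaced with.
  strengthen : {Γ : List (Formula (suc n))} → T ∣ map (rename suc) Γ ⊢ ⊥ᶠ → T ∣ Γ ⊢ ⊥ᶠ
  strengthen d = ∀-elim (∀-intro d) zero

  -- The Henkin construction works in scopes `1 + k`, so a refutation arrives with one free
  -- variable. The rule `nonempty` is what discharges it.
  refute : {τ : Sentence} → T ∣ ¬′ rename (λ ()) τ ∷ [] ⊢ ⊥ᶠ {1} → T ⊢ τ
  refute {τ} d = raa (⇒-elim nonempty (∀-intro (⇒-intro
    (⇒-elim {φ = rename suc τ} (assume (there (here refl)))
      (subst (T ∣ zero ≐ zero ∷ rename suc (¬′ τ) ∷ [] ⊢_) (rename-cong (λ ()) τ)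
        (raa (weaken (λ { (here refl) → here refl }) d)))))))

-- An enumeration of formulas

module _ {ℓ} {A : Set ℓ} where

  nth : A → ℕ → List A → A
  nth x i       []       = x
  nth x zero    (y ∷ ys) = y
  nth x (suc i) (y ∷ ys) = nth x i ys

  ∈⇒nth : ∀ {x y ys} → y ∈ ys → ∃ λ i → nth x i ys ≡ y
  ∈⇒nth (here refl) = 0 , refl
  ∈⇒nth (there p) with i , eq ← ∈⇒nth p = suc i , eq

-- The height bound makes each list finite, so a formula is located by a scope, a bound and a
-- position, all of them numbers.
formulas : ℕ → ∀ n → List (Formula n)
formulas zero    n = []
formulas (suc d) n =
  ⊥ᶠ ∷ cartesianProductWith _≐_ (allFin n) (allFin n)
    ++ cartesianProductWith _∊_ (allFin n) (allFin n)
    ++ cartesianProductWith _⇒_ (formulas d n) (formulas d n)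
    ++ map ∀′_ (formulas d (suc n))

height : Formula n → ℕ
height ⊥ᶠ      = 1
height (x ≐ y) = 1
height (x ∊ y) = 1
height (φ ⇒ ψ) = suc (height φ ⊔ height ψ)
height (∀′ φ)  = suc (height φ)

∈-formulas : ∀ {d} (φ : Formula n) → height φ ≤ d → φ ∈ formulas d n
∈-formulas ⊥ᶠ      (s≤s _) = here refl
∈-formulas {n} (x ≐ y) (s≤s _) =
  there (∈-++⁺ˡ (∈-cartesianProductWith⁺ _≐_ (∈-allFin x) (∈-allFin y)))
∈-formulas {n} (x ∊ y) (s≤s _) =
  there (∈-++⁺ʳ (cartesianProductWith _≐_ (allFin n) (allFin n))
    (∈-++⁺ˡ (∈-cartesianProductWith⁺ _∊_ (∈-allFin x) (∈-allFin y))))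
∈-formulas {n} (φ ⇒ ψ) (s≤s h) =
  there (∈-++⁺ʳ (cartesianProductWith _≐_ (allFin n) (allFin n))
    (∈-++⁺ʳ (cartesianProductWith _∊_ (allFin n) (allFin n))
      (∈-++⁺ˡ (∈-cartesianProductWith⁺ _⇒_ (∈-formulas φ (m⊔n≤o⇒m≤o _ _ h))
                                          (∈-formulas ψ (m⊔n≤o⇒n≤o _ _ h))))))
∈-formulas {n} {suc d} (∀′ φ) (s≤s h) =
  there (∈-++⁺ʳ (cartesianProductWith _≐_ (allFin n) (allFin n))
    (∈-++⁺ʳ (cartesianProductWith _∊_ (allFin n) (allFin n))
      (∈-++⁺ʳ (cartesianProductWith _⇒_ (formulas d n) (formulas d n))
        (∈-map⁺ ∀′_ (∈-formulas φ h)))))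

-- Walks along the antidiagonals of `ℕ × ℕ`; iterated from the origin it is Cantor's enumeration.
next : ℕ × ℕ → ℕ × ℕ
next (a , zero)  = 0 , suc a
next (a , suc b) = suc a , b

unpair : ℕ → ℕ × ℕ
unpair zero    = 0 , 0
unpair (suc k) = next (unpair k)

-- Keeps the scope decoded from `k` within stage `k`, so that no formula is enumerated before its
-- variables exist.
unpair-bound : ∀ k → proj₁ (unpair k) + proj₂ (unpair k) ≤ k
unpair-bound zero = z≤n
unpair-bound (suc k) with unpair k | unpair-bound k
... | a , zero  | h = s≤s (subst (_≤ k) (+-identityʳ a) h)
... | a , suc b | h = m≤n⇒m≤1+n (subst (_≤ k) (+-suc a b) h)

unpair-surjective : ∀ a b → ∃ λ k → unpair k ≡ (a , b)
unpair-surjective a b = walk (a + b) a b refl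
  where
  walk : ∀ s a b → a + b ≡ s → ∃ λ k → unpair k ≡ (a , b)
  -- Backwards along an antidiagonal, and from its start `(0 , suc b)` to the end `(b , 0)` of the
  -- preceding one.
  walk s (suc a) b eq with k , p ← walk s a (suc b) (trans (+-suc a b) eq) = suc k , cong next p
  walk zero zero zero eq = 0 , refl
  walk (suc s) zero (suc b) refl with k , p ← walk s s 0 (+-identityʳ s) = suc k , cong next p

-- Constructive completeness

-- Names are de Bruijn levels: weakening changes the index of a variable but not its name, so a
-- number can serve as a parameter at all later stages.
name : ∀ k → Fin (suc k) → ℕ
name k       zero    = k
name (suc k) (suc x) = name k x

-- The variable with name i ≤ k in scope 1 + k; names above k are sent to the
-- newest variable.
index : ∀ k → ℕ → Fin (suc k)
index zero    i = zero
index (suc k) i with i ≤? k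
... | yes _ = suc (index k i)
... | no  _ = zero

index-suc : ∀ {k i} → i ≤ k → index (suc k) i ≡ suc (index k i)
index-suc {k} {i} le with i ≤? k
... | yes _ = refl
... | no  p = ⊥-elim (p le)

index-new : ∀ k → index (suc k) (suc k) ≡ zero
index-new k with suc k ≤? k
... | yes p = ⊥-elim (1+n≰n p)
... | no  _ = refl

name-index : ∀ k {i} → i ≤ k → name k (index k i) ≡ i
name-index zero z≤n = refl
name-index (suc k) {i} le with i ≤? k
... | yes p = name-index k p
... | no  p = ≤-antisym (≰⇒> p) le

at : ∀ k → Vector ℕ n → Formula n → Formula (suc k)
at k ρ φ = rename (index k ∘ ρ) φ

Below : ℕ → Vector ℕ n → Set
Below k ρ = ∀ i → ρ i ≤ k

bound : Vector ℕ n → ℕ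
bound {zero}  ρ = 0
bound {suc n} ρ = ρ zero ⊔ bound (ρ ∘ suc)

below-bound : (ρ : Vector ℕ n) → Below (bound ρ) ρ
below-bound {suc n} ρ zero    = m≤m⊔n _ _
below-bound {suc n} ρ (suc i) = ≤-trans (below-bound (ρ ∘ suc) i) (m≤n⊔m _ _)

at-suc : ∀ {k} {ρ : Vector ℕ n} → Below k ρ → ∀ φ → at (suc k) ρ φ ≡ rename suc (at k ρ φ)
at-suc le φ = sym (rename-∘ (λ i → sym (index-suc (le i))) φ)

-- `k` decodes to a scope `1 + j`, a height bound `d` and a position `i`; positions past the end of
-- the list give `⊥ᶠ`.
enum : ∀ k → Formula (suc k)
enum k = at k (name j) (nth ⊥ᶠ i (formulas d (suc j)))
  where
  j = proj₁ (unpair k)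
  d = proj₁ (unpair (proj₂ (unpair k)))
  i = proj₂ (unpair (proj₂ (unpair k)))

enum-onto : (φ : Formula n) (ρ : Vector ℕ n) → ∃ λ k → Below k ρ × enum k ≡ at k ρ φ
enum-onto {n} φ ρ = k , (λ i → ≤-trans (below-bound ρ i) j≤k) , eq
  where
  j = bound ρ
  ψ = at j ρ φ
  d = height ψ
  position = ∈⇒nth {x = ⊥ᶠ} (∈-formulas ψ ≤-refl)
  inner = unpair-surjective d (proj₁ position)
  outer = unpair-surjective j (proj₁ inner)
  k = proj₁ outer
  j≤k : j ≤ k
  j≤k = ≤-trans (subst (λ p → j ≤ proj₁ p + proj₂ p) (sym (proj₂ outer)) (m≤m+n _ _)) (unpair-bound k)
  eq : enum k ≡ at k ρ φ
  eq rewrite proj₂ outer | proj₂ inner | proj₂ position =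
    rename-∘ (λ i → cong (index k) (name-index j (below-bound ρ i))) φ

-- A model over Set, in which falsity may hold and then everything does.
record Model (T : Theory ℓ) : Set (lsuc ℓ) where
  infix 3 _⊨_
  infix 4 _∈ᴹ_ _≈ᴹ_
  field
    Carrier   : Set
    _⊨_       : Vector Carrier n → Formula n → Set ℓ
    _∈ᴹ_ _≈ᴹ_ : Carrier → Carrier → Set ℓ
    ⊨-rename  : {r : Fin m → Fin n} {ρ : Vector Carrier n} {ρ′ : Vector Carrier m} →
                ρ ∘ r ≗ ρ′ → ∀ {φ} → (ρ ⊨ rename r φ → ρ′ ⊨ φ) × (ρ′ ⊨ φ → ρ ⊨ rename r φ)
    ⊨-∊       : {ρ : Vector Carrier n} {i j : Fin n} →
                (ρ ⊨ i ∊ j → ρ i ∈ᴹ ρ j) × (ρ i ∈ᴹ ρ j → ρ ⊨ i ∊ j)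
    ⊨-≐       : {ρ : Vector Carrier n} {i j : Fin n} →
                (ρ ⊨ i ≐ j → ρ i ≈ᴹ ρ j) × (ρ i ≈ᴹ ρ j → ρ ⊨ i ≐ j)
    ⊨-⇒       : {ρ : Vector Carrier n} {φ ψ : Formula n} →
                (ρ ⊨ φ ⇒ ψ → ρ ⊨ φ → ρ ⊨ ψ) × ((ρ ⊨ φ → ρ ⊨ ψ) → ρ ⊨ φ ⇒ ψ)
    ⊨-∀       : {ρ : Vector Carrier n} {φ : Formula (suc n)} →
                ρ ⊨ ∀′ φ → ∀ x → x Vector.∷ ρ ⊨ φ
    -- The witness is a counterexample to `∀′ φ` if there is one. This is what makes both
    -- quantifiers agree with those of Agda.
    ⊨-henkin  : (ρ : Vector Carrier n) (φ : Formula (suc n)) →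
                ∃ λ x → (x Vector.∷ ρ ⊨ φ → ρ ⊨ ∀′ φ)
    ⊨-raa     : {ρ : Vector Carrier n} {φ : Formula n} → ρ ⊨ ¬′ ¬′ φ → ρ ⊨ φ
    ≈ᴹ-refl   : ∀ x → x ≈ᴹ x
    ≈ᴹ-subst  : ∀ {x y} {ρ : Vector Carrier n} {φ : Formula (suc n)} →
                x ≈ᴹ y → x Vector.∷ ρ ⊨ φ → y Vector.∷ ρ ⊨ φ
    ⊨-theorem : {τ : Sentence} {ρ : Vector Carrier 0} → T ⊢ τ → ρ ⊨ τ

module Henkin (T : Theory ℓ) (σ : Sentence) where

  -- The variable added by the next stage takes the place of the bound one, so `χ` itself is the
  -- instance at a generic counterexample. Other shapes get a tautology, so that every stage adds
  -- one variable and one such axiom.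
  henkin : Formula (suc n) → Formula (2 + n)
  henkin (∀′ χ) = χ ⇒ rename suc (∀′ χ)
  henkin _      = ⊥ᶠ ⇒ ⊥ᶠ

  -- If the witness axiom is refutable, its premise `χ` is provable at a fresh variable.
  -- Generalization then proves `∀′ χ`, and with it the axiom.
  henkin-conservative : ∀ {Γ} (φ : Formula (suc n)) →
    T ∣ henkin φ ∷ map (rename suc) Γ ⊢ ⊥ᶠ → T ∣ Γ ⊢ ⊥ᶠ
  henkin-conservative {Γ = Γ} (∀′ χ) d = strengthen (⇒-elim refuted (⇒-intro (weaken there all)))
    where
    refuted : T ∣ map (rename suc) Γ ⊢ ¬′ henkin (∀′ χ)
    refuted = ⇒-intro d
    instance-holds : T ∣ map (rename suc) Γ ⊢ χ
    instance-holds = raa (⇒-elim (weaken there refuted)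
      (⇒-intro (raa (⇒-elim (assume (there (there (here refl)))) (assume (there (here refl)))))))
    all : T ∣ map (rename suc) Γ ⊢ rename suc (∀′ χ)
    all = renameD suc (∀-intro instance-holds)
  henkin-conservative ⊥ᶠ      d = strengthen (⇒-elim (⇒-intro d) (⇒-intro (assume (here refl))))
  henkin-conservative (_ ≐ _) d = strengthen (⇒-elim (⇒-intro d) (⇒-intro (assume (here refl))))
  henkin-conservative (_ ∊ _) d = strengthen (⇒-elim (⇒-intro d) (⇒-intro (assume (here refl))))
  henkin-conservative (_ ⇒ _) d = strengthen (⇒-elim (⇒-intro d) (⇒-intro (assume (here refl))))

  infix 3 _⊩_ _⨾_⊩_

  record _⨾_⊩_ (X : Pred (Formula n) ℓ) (Θ : List (Formula n)) (φ : Formula n) : Set ℓ where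
    constructor derivation
    field
      {premises} : List (Formula n)
      valid      : All X premises
      proof      : T ∣ Θ ++ premises ⊢ φ

  _⊩_ : Pred (Formula n) ℓ → Formula n → Set ℓ
  X ⊩ φ = X ⨾ [] ⊩ φ

  data Initial : Pred (Formula 1) ℓ where
    initial : Initial (¬′ rename (λ ()) σ)

  -- The argument of `new` replaces the classical test whether `φ` is consistent with `X`;
  -- inconsistency here means that `T ⊢ σ` follows.
  data Extend (X : Pred (Formula (suc n)) ℓ) (φ : Formula (suc n)) : Pred (Formula (2 + n)) ℓ where
    old     : ∀ {ψ} → X ψ → Extend X φ (rename suc ψ)
    witness : Extend X φ (henkin φ)
    new     : (X ⨾ φ ∷ [] ⊩ ⊥ᶠ → T ⊢ σ) → Extend X φ (rename suc φ)

  stage : ∀ k → Pred (Formula (suc k)) ℓ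
  stage zero    = Initial
  stage (suc k) = Extend (stage k) (enum k)

  insert₁ : ∀ {A : Set} {a b c : A} {xs} → c ∈ a ∷ xs → c ∈ a ∷ b ∷ xs
  insert₁ (here e)  = here e
  insert₁ (there i) = there (there i)

  insert₂ : ∀ {A : Set} {a b c d : A} {xs} → d ∈ a ∷ b ∷ xs → d ∈ a ∷ b ∷ c ∷ xs
  insert₂ (here e)  = here e
  insert₂ (there i) = there (insert₁ i)

  -- Whether φ was used is decided by looking through the premises; if it was,
  -- they come with the condition under which φ was added.
  sort : {X : Pred (Formula (suc n)) ℓ} {φ : Formula (suc n)} {Γ : List (Formula (2 + n))} →
         All (Extend X φ) Γ → ∃ λ Δ → All X Δ ×
         (Γ ⊆ henkin φ ∷ map (rename suc) Δ ⊎
          Γ ⊆ henkin φ ∷ map (rename suc) (φ ∷ Δ) × (X ⨾ φ ∷ [] ⊩ ⊥ᶠ → T ⊢ σ))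
  sort [] = [] , [] , inj₁ (λ ())
  sort (p ∷ ps) with sort ps
  sort (old {ψ} x ∷ ps) | Δ , xs , inj₁ s = ψ ∷ Δ , x ∷ xs , inj₁
    λ { (here refl) → there (here refl) ; (there i) → insert₁ (s i) }
  sort (old {ψ} x ∷ ps) | Δ , xs , inj₂ (s , c) = ψ ∷ Δ , x ∷ xs , inj₂
    ((λ { (here refl) → there (there (here refl)) ; (there i) → insert₂ (s i) }) , c)
  sort (witness ∷ ps) | Δ , xs , inj₁ s =
    Δ , xs , inj₁ λ { (here refl) → here refl ; (there i) → s i }
  sort (witness ∷ ps) | Δ , xs , inj₂ (s , c) =
    Δ , xs , inj₂ ((λ { (here refl) → here refl ; (there i) → s i }) , c)
  sort (new c ∷ ps) | Δ , xs , inj₁ s = Δ , xs , inj₂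
    ((λ { (here refl) → there (here refl) ; (there i) → insert₁ (s i) }) , c)
  sort (new c ∷ ps) | Δ , xs , inj₂ (s , _) = Δ , xs , inj₂
    ((λ { (here refl) → there (here refl) ; (there i) → s i }) , c)

  -- Induction on the stage: conservativity removes the witness axiom, and the contradiction then
  -- either belongs to the stage before or meets the condition under which `enum k` was added, which
  -- gives `T ⊢ σ` at once.
  consistent : ∀ k → stage k ⊩ ⊥ᶠ → T ⊢ σ
  consistent zero (derivation xs d) = refute (weaken (λ i → here (only xs i)) d)
    where
    only : ∀ {Γ ψ} → All Initial Γ → ψ ∈ Γ → ψ ≡ ¬′ rename (λ ()) σ
    only (initial ∷ _) (here refl) = refl
    only (_ ∷ xs)      (there i)   = only xs i
  consistent (suc k) (derivation xs d) with sort xs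
  ... | Δ , ys , inj₁ s       = consistent k (derivation ys (henkin-conservative (enum k) (weaken s d)))
  ... | Δ , ys , inj₂ (s , c) = c (derivation ys (henkin-conservative (enum k) (weaken s d)))

  ⊩-suc : ∀ {k φ} → stage k ⊩ φ → stage (suc k) ⊩ rename suc φ
  ⊩-suc (derivation xs d) = derivation (map⁺ (All.map old xs)) (renameD suc d)

  ⊩-theorem : ∀ {k φ} → T ∣ [] ⊢ φ → stage k ⊩ φ
  ⊩-theorem = derivation []

  ⊩-apply : ∀ {k φ ψ} → stage k ⊩ φ ⇒ ψ → stage k ⊩ φ → stage k ⊩ ψ
  ⊩-apply (derivation {Γ} xs d) (derivation ys e) =
    derivation (++⁺ xs ys) (⇒-elim (weaken (∈-++⁺ˡ) d) (weaken (∈-++⁺ʳ Γ) e))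

  infix 3 _⊨_

  -- Derivability from the union of the stages; the level is any stage whose scope contains all
  -- parameters.
  record _⊨_ (ρ : Vector ℕ n) (φ : Formula n) : Set ℓ where
    constructor holds
    field
      {level-of} : ℕ
      below      : Below level-of ρ
      forced     : stage level-of ⊩ at level-of ρ φ

  raise : ∀ {ρ : Vector ℕ n} {φ j k} → j ≤′ k → Below j ρ → stage j ⊩ at j ρ φ →
          Below k ρ × (stage k ⊩ at k ρ φ)
  raise ≤′-refl b d = b , d
  raise {φ = φ} (≤′-step le) b d with b′ , d′ ← raise {φ = φ} le b d =
    (λ i → m≤n⇒m≤1+n (b′ i)) , subst (stage _ ⊩_) (sym (at-suc b′ φ)) (⊩-suc d′)

  -- Two environments may be in scope from different stages on, so the derivation is first raised to
  -- a stage that has room for both.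
  reindex : {ρ : Vector ℕ m} {ρ′ : Vector ℕ n} {φ : Formula m} {φ′ : Formula n} →
            (∀ k → Below k ρ → Below k ρ′ → stage k ⊩ at k ρ φ → stage k ⊩ at k ρ′ φ′) →
            ρ ⊨ φ → ρ′ ⊨ φ′
  reindex {ρ′ = ρ′} {φ} f (holds {j} b d)
    with b′ , d′ ← raise {φ = φ} (≤⇒≤′ (m≤m⊔n j (bound ρ′))) b d =
    holds below′ (f _ b′ below′ d′)
    where
    below′ : Below (j ⊔ bound ρ′) ρ′
    below′ i = ≤-trans (below-bound ρ′ i) (m≤n⊔m _ _)

  apply : {ρ : Vector ℕ n} {φ ψ : Formula n} → ρ ⊨ φ ⇒ ψ → ρ ⊨ φ → ρ ⊨ ψ
  apply {φ = φ} {ψ} (holds {j} b d) (holds {k} c e)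
    with b′ , d′ ← raise {φ = φ ⇒ ψ} (≤⇒≤′ (m≤m⊔n j k)) b d
       | _  , e′ ← raise {φ = φ} (≤⇒≤′ (m≤n⊔m j k)) c e = holds b′ (⊩-apply d′ e′)

  consequence : {ρ : Vector ℕ n} {φ ψ : Formula n} →
                (∀ k → T ∣ at k ρ φ ∷ [] ⊢ at k ρ ψ) → ρ ⊨ φ → ρ ⊨ ψ
  consequence f (holds {k} b d) = holds b (⊩-apply (⊩-theorem (⇒-intro (f k))) d)

  -- `φ` is the formula of some stage `k`, and the hypothesis is exactly the condition that `new`
  -- asks for there.
  maximal : {ρ : Vector ℕ n} {φ : Formula n} →
            (∀ k → Below k ρ → stage k ⨾ at k ρ φ ∷ [] ⊩ ⊥ᶠ → T ⊢ σ) → ρ ⊨ φ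
  maximal {ρ = ρ} {φ} f with k , b , eq ← enum-onto φ ρ =
    holds {level-of = suc k} (λ i → m≤n⇒m≤1+n (b i)) (derivation (added ∷ []) (assume (here refl)))
    where
    added : stage (suc k) (at (suc k) ρ φ)
    added = subst (stage (suc k)) (trans (cong (rename suc) eq) (sym (at-suc b φ)))
      (new λ d → f k b (subst (λ ψ → stage k ⨾ ψ ∷ [] ⊩ ⊥ᶠ) eq d))

  -- By maximality it is enough to treat a contradiction from `φ ⇒ ψ`. It makes `φ` and `¬′ ψ`
  -- derivable, so `f` makes `ψ` true as well, and the resulting falsity at some level gives
  -- `T ⊢ σ`.
  implication : {ρ : Vector ℕ n} {φ ψ : Formula n} → (ρ ⊨ φ → ρ ⊨ ψ) → ρ ⊨ φ ⇒ ψ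
  implication {φ = φ} {ψ} f = maximal λ k b (derivation xs d) →
    let refuted = ⇒-intro d
        hφ = holds b (derivation xs (raa (⇒-elim (weaken there refuted)
               (⇒-intro (raa (⇒-elim (assume (there (there (here refl)))) (assume (there (here refl)))))))))
        h¬ψ = holds {φ = ψ ⇒ ⊥ᶠ} b (derivation xs (⇒-intro (⇒-elim (weaken there refuted)
                (⇒-intro (assume (there (here refl)))))))
        holds {l} _ e = apply h¬ψ (f hφ)
    in consistent l e

  model : Model T
  model = record
    { Carrier   = ℕ
    ; _⊨_       = _⊨_
    ; _∈ᴹ_      = λ x y → x Vector.∷ y Vector.∷ Vector.[] ⊨ zero ∊ suc zero
    ; _≈ᴹ_      = λ x y → x Vector.∷ y Vector.∷ Vector.[] ⊨ zero ≐ suc zero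
    ; ⊨-rename  = λ {_} {_} {r} {ρ} {ρ′} eq {φ} →
        reindex (λ k _ _ → subst (stage k ⊩_) (rename-∘ (λ i → cong (index k) (eq i)) φ)) ,
        reindex (λ k _ _ → subst (stage k ⊩_) (sym (rename-∘ (λ i → cong (index k) (eq i)) φ)))
    ; ⊨-∊       = reindex (λ k _ _ d → d) , reindex (λ k _ _ d → d)
    ; ⊨-≐       = reindex (λ k _ _ d → d) , reindex (λ k _ _ d → d)
    ; ⊨-⇒       = apply , implication
    ; ⊨-∀       = λ {_} {ρ} {φ} h x → reindex (λ k b b′ → λ d →
        subst (stage k ⊩_) (rename-∘ (λ { zero → refl ; (suc i) → refl }) φ)
          (⊩-apply (⊩-theorem (⇒-intro (∀-elim (assume (here refl)) (index k x)))) d)) h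
    ; ⊨-henkin  = henkin-witness
    ; ⊨-raa     = consequence λ k → raa (⇒-elim (assume (there (here refl))) (assume (here refl)))
    ; ≈ᴹ-refl   = λ x → holds (below-bound _) (⊩-theorem (≐-refl (index _ x)))
    ; ≈ᴹ-subst  = substitute
    ; ⊨-theorem = λ d → holds (λ ()) (⊩-theorem {k = 0}
        (subst (T ∣ [] ⊢_) (rename-cong (λ ()) _) (weaken-closed d)))
    }
    where
    henkin-witness : (ρ : Vector ℕ n) (φ : Formula (suc n)) →
                     ∃ λ x → (x Vector.∷ ρ ⊨ φ → ρ ⊨ ∀′ φ)
    -- Stage `k` treats `∀′ φ`, so the variable that the next stage adds, whose name is `suc k`, is
    -- its witness.
    henkin-witness ρ φ with k , b , eq ← enum-onto (∀′ φ) ρ = suc k , λ h →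
      reindex (λ k _ _ → subst (stage k ⊩_) (rename-∘ (λ _ → refl) (∀′ φ))) (apply (axiom-holds k b eq) h)
      where
      axiom-holds : ∀ k → Below k ρ → enum k ≡ at k ρ (∀′ φ) →
                    suc k Vector.∷ ρ ⊨ φ ⇒ rename suc (∀′ φ)
      axiom-holds k b eq =
        holds {level-of = suc k} (λ { zero → ≤-refl ; (suc i) → m≤n⇒m≤1+n (b i) })
          (subst (stage (suc k) ⊩_) shape (derivation (witness ∷ []) (assume (here refl))))
        where
        shape : henkin (enum k) ≡ at (suc k) (suc k Vector.∷ ρ) (φ ⇒ rename suc (∀′ φ))
        shape = trans (cong henkin eq) (cong₂ _⇒_
          (rename-cong (λ { zero → sym (index-new k) ; (suc i) → sym (index-suc (b i)) }) φ)
          (rename-square (λ i → sym (index-suc (b i))) (∀′ φ)))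

    substitute : ∀ {x y} {ρ : Vector ℕ n} {φ : Formula (suc n)} →
                 x Vector.∷ y Vector.∷ Vector.[] ⊨ zero ≐ suc zero →
                 x Vector.∷ ρ ⊨ φ → y Vector.∷ ρ ⊨ φ
    substitute {n} {x} {y} {ρ} {φ} e h = reindex {φ = right}
      (λ k _ _ → subst (stage k ⊩_) (rename-∘ (λ { zero → refl ; (suc i) → refl }) φ))
      (apply (consequence {φ = zero ≐ suc zero} leibniz (reindex (λ k _ _ d → d) e))
        (reindex (λ k _ _ → subst (stage k ⊩_) (sym (rename-∘ (λ { zero → refl ; (suc i) → refl }) φ))) h))
      where
      ρ′ : Vector ℕ (2 + n)
      ρ′ = x Vector.∷ y Vector.∷ ρ
      left right : Formula (2 + n)
      left  = rename (zero Vector.∷ (λ i → suc (suc i))) φ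
      right = rename (suc zero Vector.∷ (λ i → suc (suc i))) φ
      leibniz : ∀ k → T ∣ at k ρ′ (zero ≐ suc zero) ∷ [] ⊢ at k ρ′ (left ⇒ right)
      leibniz k = ⇒-intro (subst (T ∣ Γ ⊢_) (rename-square (λ { zero → refl ; (suc i) → refl }) φ)
        (≐-subst (rename (liftᶠ 1 (index k ∘ ρ)) φ) (assume (there (here refl)))
          (subst (T ∣ Γ ⊢_) (rename-square (λ { zero → refl ; (suc i) → refl }) φ)
            (assume {φ = at k ρ′ left} (here refl)))))
        where
        Γ : List (Formula (suc k))
        Γ = at k ρ′ left ∷ at k ρ′ (zero ≐ suc zero) ∷ []

-- The Henkin model for `T` and `¬′ σ` makes falsity true as soon as `σ` is true in it, and
-- `consistent` turns true falsity into a derivation.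
completeness : {T : Theory ℓ} {σ : Sentence} →
               (∀ (𝔐 : Model T) → Model._⊨_ 𝔐 Vector.[] σ) → T ⊢ σ
completeness {T = T} {σ} valid = consistent _ (_⊨_.forced (apply refuted (valid model)))
  where
  open Henkin T σ
  refuted : Vector.[] ⊨ ¬′ σ
  refuted = holds {level-of = 0} (λ ()) (derivation (axiom₀ ∷ []) (assume (here refl)))
    where
    axiom₀ : Initial (at 0 Vector.[] (¬′ σ))
    axiom₀ = subst Initial (cong ¬′_ (rename-cong (λ ()) σ)) initial

-- Set-valued semantics

module Semantics {T : Theory ℓ} (𝔐 : Model T) where

  open Model 𝔐 public
  open Vector using () renaming (_∷_ to infixr 5 _∷ᵉ_; [] to []ᵉ) public

  Env : ℕ → Set
  Env = Vector Carrier

  ⊥̇ : Set ℓ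
  ⊥̇ = []ᵉ ⊨ ⊥ᶠ

  ⊥-⊨ : {ρ : Env n} → (ρ ⊨ ⊥ᶠ → ⊥̇) × (⊥̇ → ρ ⊨ ⊥ᶠ)
  ⊥-⊨ = ⊨-rename {r = λ ()} (λ ())

  -- Conjunctions and existential quantifiers (also bounded ones that have been
  -- relativized) are recognized in their encodings; the order of splitting
  -- makes ⟦_⟧ compute around schematic subformulas.
  ⟦_⟧         : Formula n → Env n → Set ℓ
  Implication : Formula n → Formula n → Env n → Set ℓ
  Negation    : Formula n → Env n → Set ℓ

  ⟦ ⊥ᶠ ⟧     ρ = ⊥̇
  ⟦ i ≐ j ⟧  ρ = ρ i ≈ᴹ ρ j
  ⟦ i ∊ j ⟧  ρ = ρ i ∈ᴹ ρ j
  ⟦ φ ⇒ ψ ⟧  ρ = Implication φ ψ ρ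
  ⟦ ∀′ φ ⟧   ρ = ∀ x → ⟦ φ ⟧ (x ∷ᵉ ρ)

  Implication φ ⊥ᶠ ρ = Negation φ ρ
  Implication φ ψ  ρ = ⟦ φ ⟧ ρ → ⟦ ψ ⟧ ρ

  Negation (φ ⇒ (ψ ⇒ ⊥ᶠ))      ρ = ⟦ φ ⟧ ρ × ⟦ ψ ⟧ ρ
  Negation (∀′ (φ ⇒ ⊥ᶠ))       ρ = Σ Carrier λ x → ⟦ φ ⟧ (x ∷ᵉ ρ)
  Negation (∀′ (φ ⇒ (ψ ⇒ ⊥ᶠ))) ρ = Σ Carrier λ x → ⟦ φ ⟧ (x ∷ᵉ ρ) × ⟦ ψ ⟧ (x ∷ᵉ ρ)
  Negation φ                   ρ = ⟦ φ ⟧ ρ → ⊥̇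

  infix 1 _↔_

  _↔_ : ∀ {ℓ₁ ℓ₂} → Set ℓ₁ → Set ℓ₂ → Set (ℓ₁ Level.⊔ ℓ₂)
  A ↔ B = (A → B) × (B → A)

  explode : {ρ : Env n} {φ : Formula n} → ⊥̇ → ρ ⊨ φ
  explode b = ⊨-raa (proj₂ ⊨-⇒ λ _ → proj₂ ⊥-⊨ b)

  ⊨-¬ : {ρ : Env n} {φ : Formula n} → ρ ⊨ ¬′ φ ↔ (ρ ⊨ φ → ⊥̇)
  ⊨-¬ = (λ h x → proj₁ ⊥-⊨ (proj₁ ⊨-⇒ h x)) , λ k → proj₂ ⊨-⇒ λ x → proj₂ ⊥-⊨ (k x)

  contradictory : {ρ : Env n} {φ : Formula n} → ((ρ ⊨ φ → ⊥̇) → ⊥̇) → ρ ⊨ φ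
  contradictory k = ⊨-raa (proj₂ ⊨-¬ λ h → k (proj₁ ⊨-¬ h))

  ⊨-∧ : {ρ : Env n} {φ ψ : Formula n} → ρ ⊨ φ ∧ ψ ↔ (ρ ⊨ φ × ρ ⊨ ψ)
  ⊨-∧ = (λ h → contradictory (λ k → proj₁ ⊨-¬ h (proj₂ ⊨-⇒ λ x → explode (k x))) ,
               contradictory (λ k → proj₁ ⊨-¬ h (proj₂ ⊨-⇒ λ _ → proj₂ ⊨-¬ k))) ,
        λ (x , y) → proj₂ ⊨-¬ λ h → proj₁ ⊨-¬ (proj₁ ⊨-⇒ h x) y

  ⊨-∀′ : {ρ : Env n} {φ : Formula (suc n)} → ρ ⊨ ∀′ φ ↔ (∀ x → x ∷ᵉ ρ ⊨ φ)
  ⊨-∀′ {ρ = ρ} {φ} = ⊨-∀ , λ h → proj₂ (⊨-henkin ρ φ) (h _)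

  ⊨-∃ : {ρ : Env n} {φ : Formula (suc n)} → ρ ⊨ ∃′ φ ↔ (Σ Carrier λ x → x ∷ᵉ ρ ⊨ φ)
  ⊨-∃ = (λ h → let x , w = ⊨-henkin _ _ in
               x , contradictory λ k → proj₁ ⊨-¬ h (w (proj₂ ⊨-¬ k))) ,
        λ (x , q) → proj₂ ⊨-¬ λ h → proj₁ ⊨-¬ (⊨-∀ h x) q

  ⊨-∃∈ : {ρ : Env n} {φ ψ : Formula (suc n)} →
         ρ ⊨ ¬′ (∀′ (φ ⇒ ¬′ ψ)) ↔ (Σ Carrier λ x → (x ∷ᵉ ρ ⊨ φ) × (x ∷ᵉ ρ ⊨ ψ))
  ⊨-∃∈ = (λ h → let x , w = ⊨-henkin _ _ in
                x , (contradictory λ k → proj₁ ⊨-¬ h (w (proj₂ ⊨-⇒ λ p → explode (k p)))) ,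
                    (contradictory λ k → proj₁ ⊨-¬ h (w (proj₂ ⊨-⇒ λ _ → proj₂ ⊨-¬ k)))) ,
         λ (x , p , q) → proj₂ ⊨-¬ λ h → proj₁ ⊨-¬ (proj₁ ⊨-⇒ (⊨-∀ h x) p) q

  →-↔ : {ρ : Env n} {φ ψ : Formula n} → ρ ⊨ φ ↔ ⟦ φ ⟧ ρ → ρ ⊨ ψ ↔ ⟦ ψ ⟧ ρ → ρ ⊨ φ ⇒ ψ ↔ (⟦ φ ⟧ ρ → ⟦ ψ ⟧ ρ)
  →-↔ (f , g) (h , k) =
    (λ i x → h (proj₁ ⊨-⇒ i (g x))) , λ i → proj₂ ⊨-⇒ λ x → k (i (f x))

  ¬-↔ : {ρ : Env n} {φ : Formula n} → ρ ⊨ φ ↔ ⟦ φ ⟧ ρ → ρ ⊨ ¬′ φ ↔ (⟦ φ ⟧ ρ → ⊥̇)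
  ¬-↔ (f , g) = (λ i x → proj₁ ⊨-¬ i (g x)) , λ i → proj₂ ⊨-¬ λ x → i (f x)

  truth   : (φ : Formula n) {ρ : Env n} → ρ ⊨ φ ↔ ⟦ φ ⟧ ρ
  truth-⇒ : (φ ψ : Formula n) {ρ : Env n} → ρ ⊨ φ ⇒ ψ ↔ Implication φ ψ ρ
  truth-¬ : (φ : Formula n) {ρ : Env n} → ρ ⊨ ¬′ φ ↔ Negation φ ρ

  truth ⊥ᶠ      = ⊥-⊨
  truth (i ≐ j) = ⊨-≐
  truth (i ∊ j) = ⊨-∊
  truth (φ ⇒ ψ) = truth-⇒ φ ψ
  truth (∀′ φ)  =
    (λ h x → proj₁ (truth φ) (⊨-∀ h x)) , λ h → proj₂ ⊨-∀′ λ x → proj₂ (truth φ) (h x)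

  truth-⇒ φ ⊥ᶠ        = truth-¬ φ
  truth-⇒ φ ψ@(_ ≐ _) = →-↔ (truth φ) (truth ψ)
  truth-⇒ φ ψ@(_ ∊ _) = →-↔ (truth φ) (truth ψ)
  truth-⇒ φ ψ@(_ ⇒ _) = →-↔ (truth φ) (truth ψ)
  truth-⇒ φ ψ@(∀′ _)  = →-↔ (truth φ) (truth ψ)

  truth-¬ (φ ⇒ (ψ ⇒ ⊥ᶠ)) =
    (λ h → let p , q = proj₁ ⊨-∧ h in proj₁ (truth φ) p , proj₁ (truth ψ) q) ,
    λ (p , q) → proj₂ ⊨-∧ (proj₂ (truth φ) p , proj₂ (truth ψ) q)
  truth-¬ (∀′ (φ ⇒ ⊥ᶠ)) =
    (λ h → let x , p = proj₁ ⊨-∃ h in x , proj₁ (truth φ) p) ,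
    λ (x , p) → proj₂ ⊨-∃ (x , proj₂ (truth φ) p)
  truth-¬ (∀′ (φ ⇒ (ψ ⇒ ⊥ᶠ))) =
    (λ h → let x , p , q = proj₁ ⊨-∃∈ h in x , proj₁ (truth φ) p , proj₁ (truth ψ) q) ,
    λ (x , p , q) → proj₂ ⊨-∃∈ (x , proj₂ (truth φ) p , proj₂ (truth ψ) q)
  -- The remaining shapes are spelled out because `Negation` reduces to its last clause only after
  -- the earlier patterns are excluded.
  truth-¬ φ@⊥ᶠ                       = ¬-↔ (truth φ)
  truth-¬ φ@(_ ≐ _)                  = ¬-↔ (truth φ)
  truth-¬ φ@(_ ∊ _)                  = ¬-↔ (truth φ)
  truth-¬ φ@(_ ⇒ ⊥ᶠ)                 = ¬-↔ (truth φ)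
  truth-¬ φ@(_ ⇒ (_ ≐ _))            = ¬-↔ (truth φ)
  truth-¬ φ@(_ ⇒ (_ ∊ _))            = ¬-↔ (truth φ)
  truth-¬ φ@(_ ⇒ (∀′ _))             = ¬-↔ (truth φ)
  truth-¬ φ@(_ ⇒ (_ ⇒ (_ ≐ _)))      = ¬-↔ (truth φ)
  truth-¬ φ@(_ ⇒ (_ ⇒ (_ ∊ _)))      = ¬-↔ (truth φ)
  truth-¬ φ@(_ ⇒ (_ ⇒ (_ ⇒ _)))      = ¬-↔ (truth φ)
  truth-¬ φ@(_ ⇒ (_ ⇒ (∀′ _)))       = ¬-↔ (truth φ)
  truth-¬ φ@(∀′ ⊥ᶠ)                  = ¬-↔ (truth φ)
  truth-¬ φ@(∀′ (_ ≐ _))             = ¬-↔ (truth φ)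
  truth-¬ φ@(∀′ (_ ∊ _))             = ¬-↔ (truth φ)
  truth-¬ φ@(∀′ (∀′ _))              = ¬-↔ (truth φ)
  truth-¬ φ@(∀′ (_ ⇒ (_ ≐ _)))       = ¬-↔ (truth φ)
  truth-¬ φ@(∀′ (_ ⇒ (_ ∊ _)))       = ¬-↔ (truth φ)
  truth-¬ φ@(∀′ (_ ⇒ (∀′ _)))        = ¬-↔ (truth φ)
  truth-¬ φ@(∀′ (_ ⇒ (_ ⇒ (_ ≐ _)))) = ¬-↔ (truth φ)
  truth-¬ φ@(∀′ (_ ⇒ (_ ⇒ (_ ∊ _)))) = ¬-↔ (truth φ)
  truth-¬ φ@(∀′ (_ ⇒ (_ ⇒ (_ ⇒ _)))) = ¬-↔ (truth φ)
  truth-¬ φ@(∀′ (_ ⇒ (_ ⇒ (∀′ _))))  = ¬-↔ (truth φ)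

  -- For a schematic `ψ` the function `Implication` is stuck; this recovers the plain implication.
  ⟦⟧-⇒ : (φ ψ : Formula n) {ρ : Env n} → ⟦ φ ⇒ ψ ⟧ ρ ↔ (⟦ φ ⟧ ρ → ⟦ ψ ⟧ ρ)
  ⟦⟧-⇒ φ ψ = (λ h → proj₁ (→-↔ (truth φ) (truth ψ)) (proj₂ (truth (φ ⇒ ψ)) h)) ,
             λ h → proj₁ (truth (φ ⇒ ψ)) (proj₂ (→-↔ (truth φ) (truth ψ)) h)

  -- Goes through `_⊨_`, which does not depend on the shapes that `⟦_⟧` recognizes.
  ⟦⟧-rename : {r : Fin m → Fin n} {ρ : Env n} {ρ′ : Env m} → ρ ∘ r ≗ ρ′ →
              ∀ φ → ⟦ rename r φ ⟧ ρ ↔ ⟦ φ ⟧ ρ′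
  ⟦⟧-rename {r = r} eq φ =
    (λ h → proj₁ (truth φ) (proj₁ (⊨-rename eq) (proj₂ (truth (rename r φ)) h))) ,
    λ h → proj₁ (truth (rename r φ)) (proj₂ (⊨-rename eq) (proj₂ (truth φ) h))

  ⟦⟧-∀* : (φ : Formula n) → ⟦ ∀* φ ⟧ []ᵉ ↔ (∀ ρ → ⟦ φ ⟧ ρ)
  ⟦⟧-∀* φ = (λ h ρ → proj₁ (truth φ) (proj₁ (to φ) (proj₂ (truth (∀* φ)) h) ρ)) ,
            λ h → proj₁ (truth (∀* φ)) (proj₂ (to φ) λ ρ → proj₂ (truth φ) (h ρ))
    where
    cong-env : {ρ ρ′ : Env n} → ρ ≗ ρ′ → ∀ {φ} → ρ ⊨ φ → ρ′ ⊨ φ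
    cong-env {ρ = ρ} eq h = proj₁ (⊨-rename {r = id} eq) (proj₂ (⊨-rename {ρ = ρ} (λ _ → refl)) h)
    to : (φ : Formula n) → []ᵉ ⊨ ∀* φ ↔ (∀ ρ → ρ ⊨ φ)
    to {zero}  φ = (λ h ρ → cong-env (λ ()) h) , λ h → h []ᵉ
    to {suc n} φ =
      (λ h ρ → cong-env (λ { zero → refl ; (suc _) → refl })
                 (⊨-∀ (proj₁ (to (∀′ φ)) h (ρ ∘ suc)) (ρ zero))) ,
      λ h → proj₂ (to (∀′ φ)) λ ρ → proj₂ ⊨-∀′ λ x → h (x ∷ᵉ ρ)

  ∀*-intro : {φ : Formula n} → (∀ ρ → ⟦ φ ⟧ ρ) → ⟦ ∀* φ ⟧ []ᵉ
  ∀*-intro {φ = φ} = proj₂ (⟦⟧-∀* φ)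

  theorem : {τ : Sentence} → T ⊢ τ → ⟦ τ ⟧ []ᵉ
  theorem {τ} d = proj₁ (truth τ) (⊨-theorem d)

  ≈-sym : ∀ {x y} → x ≈ᴹ y → y ≈ᴹ x
  ≈-sym {x} {y} e = proj₁ ⊨-≐ (≈ᴹ-subst {ρ = x ∷ᵉ []ᵉ} {φ = zero ≐ suc zero} e (proj₂ ⊨-≐ (≈ᴹ-refl x)))

  ≈-trans : ∀ {x y z} → x ≈ᴹ y → y ≈ᴹ z → x ≈ᴹ z
  ≈-trans {x} {y} {z} e f =
    proj₁ ⊨-≐ (≈ᴹ-subst {ρ = z ∷ᵉ []ᵉ} {φ = zero ≐ suc zero} (≈-sym e) (proj₂ ⊨-≐ f))

  ∈-respˡ : ∀ {x y z} → x ≈ᴹ y → x ∈ᴹ z → y ∈ᴹ z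
  ∈-respˡ {z = z} e h = proj₁ ⊨-∊ (≈ᴹ-subst {ρ = z ∷ᵉ []ᵉ} {φ = zero ∊ suc zero} e (proj₂ ⊨-∊ h))

  ∈-respʳ : ∀ {x y z} → y ≈ᴹ z → x ∈ᴹ y → x ∈ᴹ z
  ∈-respʳ {x} e h = proj₁ ⊨-∊ (≈ᴹ-subst {ρ = x ∷ᵉ []ᵉ} {φ = suc zero ∊ zero} e (proj₂ ⊨-∊ h))

  ⟦⟧-resp : (φ : Formula n) {ρ ρ′ : Env n} → (∀ i → ρ i ≈ᴹ ρ′ i) → ⟦ φ ⟧ ρ → ⟦ φ ⟧ ρ′
  ⟦⟧-resp φ eq h = proj₁ (truth φ) (resp φ eq (proj₂ (truth φ) h))
    where
    resp : (φ : Formula n) {ρ ρ′ : Env n} → (∀ i → ρ i ≈ᴹ ρ′ i) → ρ ⊨ φ → ρ′ ⊨ φ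
    resp ⊥ᶠ      eq h = explode (proj₁ ⊥-⊨ h)
    resp (i ≐ j) eq h = proj₂ ⊨-≐ (≈-trans (≈-sym (eq i)) (≈-trans (proj₁ ⊨-≐ h) (eq j)))
    resp (i ∊ j) eq h = proj₂ ⊨-∊ (∈-respˡ (eq i) (∈-respʳ (eq j) (proj₁ ⊨-∊ h)))
    resp (φ ⇒ ψ) eq h = proj₂ ⊨-⇒ λ x → resp ψ eq (proj₁ ⊨-⇒ h (resp φ (λ i → ≈-sym (eq i)) x))
    resp (∀′ φ)  eq h = proj₂ ⊨-∀′ λ x →
      resp φ (λ { zero → ≈ᴹ-refl x ; (suc i) → eq i }) (⊨-∀ h x)

  -- Double negation elimination relative to `⊥̇`. There is no instance for `Σ`: an existential
  -- statement becomes stable by being expressed as a formula, through `Stable-⟦⟧`, since Henkin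
  -- witnesses exist for formulas.
  record Stable {a} (A : Set a) : Set (ℓ Level.⊔ a) where
    constructor mkStable
    field
      dne : ((A → ⊥̇) → ⊥̇) → A
  open Stable {{...}} public

  Stable-⟦⟧ : (φ : Formula n) (ρ : Env n) → Stable (⟦ φ ⟧ ρ)
  Stable-⟦⟧ φ ρ = mkStable λ k → proj₁ (truth φ)
    (contradictory λ h → k λ x → h (proj₂ (truth φ) x))

  instance
    Stable-⊥ : Stable ⊥̇
    Stable-⊥ = mkStable λ k → k id

    Stable-∈ : ∀ {x y} → Stable (x ∈ᴹ y)
    Stable-∈ {x} {y} = Stable-⟦⟧ (zero ∊ suc zero) (x ∷ᵉ y ∷ᵉ []ᵉ)

    Stable-≈ : ∀ {x y} → Stable (x ≈ᴹ y)
    Stable-≈ {x} {y} = Stable-⟦⟧ (zero ≐ suc zero) (x ∷ᵉ y ∷ᵉ []ᵉ)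

    Stable-Π : ∀ {a b} {A : Set a} {B : A → Set b} {{s : ∀ {x} → Stable (B x)}} → Stable ((x : A) → B x)
    Stable-Π {{s}} = mkStable λ k x → Stable.dne s λ h → k λ f → h (f x)

    Stable-× : ∀ {a b} {A : Set a} {B : Set b} {{s : Stable A}} {{t : Stable B}} → Stable (A × B)
    Stable-× = mkStable λ k → dne (λ h → k λ (x , _) → h x) , dne (λ h → k λ (_ , y) → h y)

  exfalso : ∀ {a} {A : Set a} {{s : Stable A}} → ⊥̇ → A
  exfalso b = dne λ _ → b

  -- Disjunction abbreviates `¬′ φ ⇒ ψ`, so a case distinction is possible only towards stable
  -- goals.
  ∨-elim : ∀ {a b c} {A : Set a} {B : Set b} {C : Set c} {{s : Stable C}} →
           ((A → ⊥̇) → B) → (A → C) → (B → C) → C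
  ∨-elim d f g = dne λ k → k (g (d λ x → k (f x)))

  by-cases : ∀ {a c} (A : Set a) {C : Set c} {{s : Stable C}} → (A → C) → ((A → ⊥̇) → C) → C
  by-cases A f g = ∨-elim {A = A} id f g

-- Set theory in a model of BST

module SetTheory {T : Theory ℓ} (𝔐 : Model T) (bst : ∀ {τ} → BST τ → T ⊢ τ) where

  open Semantics 𝔐 public

  private
    axiomᴹ : ∀ {τ} → τ ∈ finiteBST → ⟦ τ ⟧ []ᵉ
    axiomᴹ i = theorem (bst (finite i))

  ∅ᴹ : Carrier
  ∅ᴹ = proj₁ (axiomᴹ (here refl))

  ∉∅ : ∀ {x} → x ∈ᴹ ∅ᴹ → ⊥̇
  ∉∅ = proj₂ (axiomᴹ (here refl)) _

  ext : ∀ {x y} → (∀ z → (z ∈ᴹ x ↔ z ∈ᴹ y)) → x ≈ᴹ y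
  ext = axiomᴹ (there (here refl)) _ _

  pairᴹ : Carrier → Carrier → Carrier
  pairᴹ x y = proj₁ (axiomᴹ (there (there (here refl))) x y)

  ∈-pair : ∀ {x y w} → w ∈ᴹ pairᴹ x y ↔ ((w ≈ᴹ x → ⊥̇) → w ≈ᴹ y)
  ∈-pair = proj₂ (axiomᴹ (there (there (here refl))) _ _) _

  ⋃ᴹ : Carrier → Carrier
  ⋃ᴹ x = proj₁ (axiomᴹ (there (there (there (here refl)))) x)

  ∈-⋃ : ∀ {x z} → z ∈ᴹ ⋃ᴹ x ↔ (Σ Carrier λ w → (w ∈ᴹ x) × (z ∈ᴹ w))
  ∈-⋃ = proj₂ (axiomᴹ (there (there (there (here refl)))) _) _

  pairˡ : ∀ {x y} → x ∈ᴹ pairᴹ x y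
  pairˡ = proj₂ ∈-pair λ k → exfalso (k (≈ᴹ-refl _))

  pairʳ : ∀ {x y} → y ∈ᴹ pairᴹ x y
  pairʳ = proj₂ ∈-pair λ _ → ≈ᴹ-refl _

  pair-elim : ∀ {x y w c} {C : Set c} {{s : Stable C}} →
              w ∈ᴹ pairᴹ x y → (w ≈ᴹ x → C) → (w ≈ᴹ y → C) → C
  pair-elim h = ∨-elim (proj₁ ∈-pair h)

  singleton-elim : ∀ {x w} → w ∈ᴹ pairᴹ x x → w ≈ᴹ x
  singleton-elim h = pair-elim h id id

  -- Operations such as `pairᴹ` are projected from the witnesses of axioms, so their invariance
  -- under `≈ᴹ` rests on extensionality.
  pair-cong : ∀ {a b c d} → a ≈ᴹ c → b ≈ᴹ d → pairᴹ a b ≈ᴹ pairᴹ c d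
  pair-cong e f = ext λ z →
    (λ h → pair-elim h (λ p → ∈-respˡ (≈-sym (≈-trans p e)) pairˡ)
                       (λ p → ∈-respˡ (≈-sym (≈-trans p f)) pairʳ)) ,
    (λ h → pair-elim h (λ p → ∈-respˡ (≈-trans e (≈-sym p)) pairˡ)
                       (λ p → ∈-respˡ (≈-trans f (≈-sym p)) pairʳ))

  ⟪_,_⟫ : Carrier → Carrier → Carrier
  ⟪ x , y ⟫ = pairᴹ (pairᴹ x x) (pairᴹ x y)

  ⟪⟫-cong : ∀ {a b c d} → a ≈ᴹ c → b ≈ᴹ d → ⟪ a , b ⟫ ≈ᴹ ⟪ c , d ⟫
  ⟪⟫-cong e f = pair-cong (pair-cong e e) (pair-cong e f)

  ⟪⟫-injective : ∀ {a b c d} → ⟪ a , b ⟫ ≈ᴹ ⟪ c , d ⟫ → (a ≈ᴹ c) × (b ≈ᴹ d)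
  ⟪⟫-injective {a} {b} {c} {d} e = a≈c , b≈d
    where
    a≈c : a ≈ᴹ c
    a≈c = ≈-sym (pair-elim (∈-respʳ e pairˡ)
      (λ p → singleton-elim (∈-respʳ (≈-sym p) pairˡ))
      (λ p → singleton-elim (∈-respʳ (≈-sym p) pairˡ)))
    -- The degenerate case: if `b` is `c`, and hence `a`, the first pair collapses to a singleton
    -- and forces `d` to be the same element.
    d≈a⇒ : b ≈ᴹ c → d ≈ᴹ b
    d≈a⇒ p = pair-elim (∈-respʳ (≈-sym e) pairʳ)
      (λ q → ≈-trans (singleton-elim (∈-respʳ q pairʳ)) (≈-trans a≈c (≈-sym p)))
      (λ q → pair-elim (∈-respʳ q pairʳ) (λ r → ≈-trans r (≈-trans a≈c (≈-sym p))) id)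
    b≈d : b ≈ᴹ d
    b≈d = pair-elim (∈-respʳ e pairʳ)
      (λ p → ≈-sym (d≈a⇒ (singleton-elim (∈-respʳ p pairʳ))))
      (λ p → pair-elim (∈-respʳ p pairʳ) (λ q → ≈-sym (d≈a⇒ q)) id)

  sucᴹ : Carrier → Carrier
  sucᴹ x = ⋃ᴹ (pairᴹ x (pairᴹ x x))

  ∈-suc : ∀ {x z} → z ∈ᴹ sucᴹ x ↔ ((z ∈ᴹ x → ⊥̇) → z ≈ᴹ x)
  ∈-suc = (λ h k → let w , p , q = proj₁ ∈-⋃ h in
             pair-elim p (λ e → exfalso (k (∈-respʳ e q))) (λ e → singleton-elim (∈-respʳ e q))) ,
          λ h → dne λ k → k (proj₂ ∈-⋃ (_ , pairʳ , ∈-respˡ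
            (≈-sym (h λ p → k (proj₂ ∈-⋃ (_ , pairˡ , p)))) pairˡ))

  val : Term n → Env n → Carrier
  val (v i)       ρ = ρ i
  val ∅           ρ = ∅ᴹ
  val (S t)       ρ = sucᴹ (val t ρ)
  val ｛ t ⸴ u ｝ ρ = pairᴹ (val t ρ) (val u ρ)

  denotes-↔ : (r : Fin m → Fin n) (t : Term m) (x : Fin n) (ρ : Env n) →
              ⟦ denotes r t x ⟧ ρ ↔ ρ x ≈ᴹ val t (ρ ∘ r)
  denotes-↔ r (v i) x ρ = id , id
  denotes-↔ r ∅     x ρ =
    (λ h → ext λ z → (λ p → exfalso (h z p)) , λ p → exfalso (∉∅ p)) ,
    λ e z p → ∉∅ (∈-respʳ e p)
  denotes-↔ r (S t) x ρ =
    (λ (y , d , h) → let e = proj₁ (denotes-↔ (suc ∘ r) t zero (y ∷ᵉ ρ)) d in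
      ext λ z →
        (λ p → proj₂ ∈-suc λ k → ≈-trans (proj₁ (h z) p λ q → k (∈-respʳ e q)) e) ,
        λ p → proj₂ (h z) λ k → ≈-trans (proj₁ ∈-suc p λ q → k (∈-respʳ (≈-sym e) q)) (≈-sym e)) ,
    λ e → val t (ρ ∘ r) , proj₂ (denotes-↔ (suc ∘ r) t zero (_ ∷ᵉ ρ)) (≈ᴹ-refl _) , λ z →
      (λ p → proj₁ ∈-suc (∈-respʳ e p)) , λ p → ∈-respʳ (≈-sym e) (proj₂ ∈-suc p)
  denotes-↔ r ｛ t ⸴ u ｝ x ρ =
    (λ (y , z , d , d′ , h) →
      let e = proj₁ (denotes-↔ (λ i → r i ↑ 2) t 1F (z ∷ᵉ y ∷ᵉ ρ)) d
          f = proj₁ (denotes-↔ (λ i → r i ↑ 2) u 0F (z ∷ᵉ y ∷ᵉ ρ)) d′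
      in ≈-trans (ext λ w → (λ p → proj₂ ∈-pair (proj₁ (h w) p)) , λ p → proj₂ (h w) (proj₁ ∈-pair p))
                 (pair-cong e f)) ,
    λ e → val t (ρ ∘ r) , val u (ρ ∘ r) ,
      proj₂ (denotes-↔ (λ i → r i ↑ 2) t 1F (_ ∷ᵉ _ ∷ᵉ ρ)) (≈ᴹ-refl _) ,
      proj₂ (denotes-↔ (λ i → r i ↑ 2) u 0F (_ ∷ᵉ _ ∷ᵉ ρ)) (≈ᴹ-refl _) ,
      λ w → (λ p → proj₁ ∈-pair (∈-respʳ e p)) , λ p → ∈-respʳ (≈-sym e) (proj₂ ∈-pair p)

  ≐ᵗ-↔ : (x : Fin n) (t : Term n) (ρ : Env n) → ⟦ x ≐ᵗ t ⟧ ρ ↔ ρ x ≈ᴹ val t ρ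
  ≐ᵗ-↔ x t ρ = denotes-↔ id t x ρ

  ∊ᵗ-↔ : (t : Term n) (y : Fin n) (ρ : Env n) → ⟦ t ∊ᵗ y ⟧ ρ ↔ val t ρ ∈ᴹ ρ y
  ∊ᵗ-↔ t y ρ =
    (λ (x , d , p) → ∈-respˡ (proj₁ (denotes-↔ suc t zero (x ∷ᵉ ρ)) d) p) ,
    λ p → val t ρ , proj₂ (denotes-↔ suc t zero (_ ∷ᵉ ρ)) (≈ᴹ-refl _) , p

  -- `⟦_⟧` looks variables up in the environment, so the same type arises wherever the three
  -- variables stand in a larger scope, and this small version applies there by computation.
  is-pair : ∀ {p a b} → ⟦ 0F ≐ᵗ ⟨ v 1F , v 2F ⟩ ⟧ (p ∷ᵉ a ∷ᵉ b ∷ᵉ []ᵉ) ↔ p ≈ᴹ ⟪ a , b ⟫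
  is-pair {p} {a} {b} = ≐ᵗ-↔ 0F ⟨ v 1F , v 2F ⟩ (p ∷ᵉ a ∷ᵉ b ∷ᵉ []ᵉ)

  pair-in : ∀ {f a b} → ⟦ ⟨ v 1F , v 2F ⟩ ∊ᵗ 0F ⟧ (f ∷ᵉ a ∷ᵉ b ∷ᵉ []ᵉ) ↔ ⟪ a , b ⟫ ∈ᴹ f
  pair-in {f} {a} {b} = ∊ᵗ-↔ ⟨ v 1F , v 2F ⟩ 0F (f ∷ᵉ a ∷ᵉ b ∷ᵉ []ᵉ)

  separate₀ : {φ : Formula (suc n)} → Δ₀ φ → (ρ : Env n) (a : Carrier) →
              Σ Carrier λ b → ∀ x → (x ∈ᴹ b ↔ (x ∈ᴹ a) × ⟦ φ ⟧ (x ∷ᵉ ρ))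
  separate₀ {φ = φ} d ρ a with b , h ← proj₁ (⟦⟧-∀* _) (theorem (bst (Δ₀-sep d))) ρ a = b , λ x →
    let shift = ⟦⟧-rename {ρ = x ∷ᵉ b ∷ᵉ a ∷ᵉ ρ} {ρ′ = x ∷ᵉ ρ} (λ { zero → refl ; (suc _) → refl }) φ in
    (λ p → proj₁ (proj₁ (h x) p) , proj₁ shift (proj₂ (proj₁ (h x) p))) ,
    λ (p , q) → proj₂ (h x) (p , proj₂ shift q)

  infixr 6 _×ᴹ_

  _×ᴹ_ : Carrier → Carrier → Carrier
  x ×ᴹ y = proj₁ (axiomᴹ (there (there (there (there (here refl))))) x y)

  ∈-×ᴹ : ∀ {x y p} → p ∈ᴹ x ×ᴹ y ↔
         (Σ Carrier λ a → (a ∈ᴹ x) × Σ Carrier λ b → (b ∈ᴹ y) × (p ≈ᴹ ⟪ a , b ⟫))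
  ∈-×ᴹ {x} {y} = let h = proj₂ (axiomᴹ (there (there (there (there (here refl))))) x y) _ in
    (λ p → let a , i , b , j , e = proj₁ h p in a , i , b , j , proj₁ is-pair e) ,
    λ (a , i , b , j , e) → proj₂ h (a , i , b , j , proj₂ is-pair e)

  ωᴹ : Carrier
  ωᴹ = proj₁ (axiomᴹ (there (there (there (there (there (here refl)))))))

  ωᴹ-isOmega : ⟦ IsOmega 0F ⟧ (ωᴹ ∷ᵉ []ᵉ)
  ωᴹ-isOmega = proj₂ (axiomᴹ (there (there (there (there (there (here refl)))))))

  ∅∈ω : ∀ {w} → ⟦ IsOmega 0F ⟧ (w ∷ᵉ []ᵉ) → ∅ᴹ ∈ᴹ w
  ∅∈ω {w} h = proj₁ (∊ᵗ-↔ ∅ 0F (w ∷ᵉ []ᵉ)) (proj₁ (proj₁ h))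

  suc∈ω : ∀ {w} → ⟦ IsOmega 0F ⟧ (w ∷ᵉ []ᵉ) → ∀ {x} → x ∈ᴹ w → sucᴹ x ∈ᴹ w
  suc∈ω {w} h {x} p = proj₁ (∊ᵗ-↔ (S (v 0F)) 1F (x ∷ᵉ w ∷ᵉ []ᵉ)) (proj₂ (proj₁ h) x p)

  Fun : Carrier → Carrier → Carrier → Set ℓ
  Fun f A B =
    (∀ p → p ∈ᴹ f → Σ Carrier λ a → (a ∈ᴹ A) × Σ Carrier λ b → (b ∈ᴹ B) × (p ≈ᴹ ⟪ a , b ⟫)) ×
    (∀ a → a ∈ᴹ A → Σ Carrier λ b → ∀ c → (⟪ a , c ⟫ ∈ᴹ f ↔ c ≈ᴹ b))

  fun-↔ : ∀ {f A B} → ⟦ 0F ∶ 1F ⟶ 2F ⟧ (f ∷ᵉ A ∷ᵉ B ∷ᵉ []ᵉ) ↔ Fun f A B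
  fun-↔ =
    (λ (h , k) → (λ p i → let a , j , b , l , e = h p i in a , j , b , l , proj₁ is-pair e) ,
                 λ a i → let b , l = k a i in b , λ c →
                   (λ p → proj₁ (l c) (proj₂ pair-in p)) , λ e → proj₁ pair-in (proj₂ (l c) e)) ,
    λ (h , k) → (λ p i → let a , j , b , l , e = h p i in a , j , b , l , proj₂ is-pair e) ,
                λ a i → let b , l = k a i in b , λ c →
                  (λ p → proj₁ (l c) (proj₁ pair-in p)) , λ e → proj₂ pair-in (proj₂ (l c) e)

  fun-∅ : ∀ {B} → Fun ∅ᴹ ∅ᴹ B
  -- The `∅ᴹ` are dummies: a `Σ` type has no stability instance, so a witness must be given before
  -- `exfalso`.
  fun-∅ = (λ p i → ∅ᴹ , exfalso (∉∅ i) , ∅ᴹ , exfalso (∉∅ i) , exfalso (∉∅ i)) ,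
          λ a i → ∅ᴹ , λ c → exfalso (∉∅ i)

-- Vopěnka’s principle

module Vopěnka {T : Theory ℓ} (𝔐 : Model T) (bst : ∀ {τ} → BST τ → T ⊢ τ)
               (vop : ∀ {τ} → VP τ → T ⊢ τ) where

  open SetTheory 𝔐 bst

  -- Records, so that the large formulas are not unfolded when types are compared.
  record Language (L G : Carrier) : Set ℓ where
    constructor language
    field unfold : ⟦ IsLanguage 0F 1F ⟧ (L ∷ᵉ G ∷ᵉ []ᵉ)

  record Structure (L G x : Carrier) : Set ℓ where
    constructor structure
    field unfold : ⟦ IsStructure 0F 1F 2F ⟧ (L ∷ᵉ G ∷ᵉ x ∷ᵉ []ᵉ)

  record Elementary (L G j x y : Carrier) : Set ℓ where
    constructor elementary
    field unfold : ⟦ IsElementary 0F 1F 2F 3F 4F ⟧ (L ∷ᵉ G ∷ᵉ j ∷ᵉ x ∷ᵉ y ∷ᵉ []ᵉ)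

  vopěnkaᴹ : (φ : Formula (suc n)) (ρ : Env n) (L G : Carrier) →
    Language L G → (∀ x → ⟦ φ ⟧ (x ∷ᵉ ρ) → Structure L G x) →
    ((Σ Carrier λ z → ∀ x → (x ∈ᴹ z ↔ ⟦ φ ⟧ (x ∷ᵉ ρ))) → ⊥̇) →
    Σ Carrier λ x → Σ Carrier λ y → ⟦ φ ⟧ (x ∷ᵉ ρ) × ⟦ φ ⟧ (y ∷ᵉ ρ) × (x ≈ᴹ y → ⊥̇) ×
    Σ Carrier λ j → Elementary L G j x y
  vopěnkaᴹ φ ρ L G (language l) struct proper =
    let x , y , p , q , x≉y , j , e =
         proj₁ (⟦⟧-∀* _) (theorem (vop (vp φ))) ρ L G
           (l , (λ x p → Structure.unfold (struct x (proj₁ (⟦⟧-rename (λ { zero → refl ; (suc _) → refl }) φ) p))) ,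
            λ (z , h) → proper (z , λ x →
              let shift = ⟦⟧-rename {ρ = x ∷ᵉ z ∷ᵉ G ∷ᵉ L ∷ᵉ ρ} {ρ′ = x ∷ᵉ ρ}
                            (λ { zero → refl ; (suc _) → refl }) φ
                  φ′ = rename (0F Vector.∷ (4 ↑ʳ_)) φ
              in (λ i → proj₁ shift (proj₁ (⟦⟧-⇒ (0F ∊ 1F) φ′) (proj₁ (h x)) i)) ,
                 λ i → proj₂ (h x) (proj₂ shift i)))
    in x , y , proj₁ (⟦⟧-rename (λ { zero → refl ; (suc _) → refl }) φ) p ,
      proj₁ (⟦⟧-rename (λ { zero → refl ; (suc _) → refl }) φ) q , x≉y , j , elementary e

  relation-code : Carrier → Carrier
  relation-code r = val (relᶜ (v 0F) ∅) (r ∷ᵉ []ᵉ)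

  no-terms : ∀ {Tm k} → ⟦ IsTermTuple 0F 1F 2F 2F ⟧ (Tm ∷ᵉ k ∷ᵉ ∅ᴹ ∷ᵉ []ᵉ)
  no-terms = (∅ᴹ , proj₂ fun-↔ fun-∅) , λ i t p → proj₂ pair-in (exfalso (∉∅ (proj₁ pair-in p)))

  fun-from-∅ : ∀ {f B} → Fun f ∅ᴹ B → f ≈ᴹ ∅ᴹ
  fun-from-∅ (h , _) = ext λ z → (λ p → exfalso (∉∅ (proj₁ (proj₂ (h z p))))) , λ p → exfalso (∉∅ p)

  -- The clause for relation symbols at `k = 0` speaks of some argument tuple from the empty set to
  -- `D`, and the only such tuple is `∅ᴹ`.
  nullary-truth : ∀ {L G ω Tm F x D R I J y r} → ⟦ IsOmega 0F ⟧ (ω ∷ᵉ []ᵉ) →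
    ⟦ IsSatisfaction 0F 1F 2F 3F 4F 5F 6F 7F ⟧
      (L ∷ᵉ G ∷ᵉ ω ∷ᵉ Tm ∷ᵉ F ∷ᵉ x ∷ᵉ D ∷ᵉ R ∷ᵉ []ᵉ) →
    x ≈ᴹ ⟪ y , ⟪ I , J ⟫ ⟫ → ⟪ r , ∅ᴹ ⟫ ∈ᴹ L →
    ⟪ relation-code r , ∅ᴹ ⟫ ∈ᴹ R ↔ ⟪ r , ∅ᴹ ⟫ ∈ᴹ I
  nullary-truth {x = x} {D} {R} {I} {r = r} isω
                (I′ , J′ , V , e , _ , truth) e′ symbol =
    (λ p → let a , f , _ , q = proj₁ atomic (proj₂ code p) in
           ∈-respʳ I′≈I (∈-respˡ (⟪⟫-cong (≈ᴹ-refl _) (fun-from-∅ (proj₁ fun-↔ f))) (proj₁ pair-in q))) ,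
    λ p → proj₁ code (proj₂ atomic
      (∅ᴹ , proj₂ fun-↔ fun-∅ , (λ i t d (q , _) → proj₂ (value t d) (exfalso (∉∅ (proj₁ pair-in q)))) ,
       proj₂ pair-in (∈-respʳ (≈-sym I′≈I) p)))
    where
    I′≈I : I′ ≈ᴹ I
    I′≈I = proj₁ (⟪⟫-injective (proj₂ (⟪⟫-injective (≈-trans
      (≈-sym (proj₁ (≐ᵗ-↔ 0F ⟨ v 1F , ⟨ v 2F , v 3F ⟩ ⟩ (x ∷ᵉ D ∷ᵉ I′ ∷ᵉ J′ ∷ᵉ []ᵉ)) e)) e′))))
    code = ∊ᵗ-↔ ⟨ relᶜ (v 0F) (v 1F) , v 2F ⟩ 3F (r ∷ᵉ ∅ᴹ ∷ᵉ ∅ᴹ ∷ᵉ R ∷ᵉ []ᵉ)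
    value = λ t d → ∊ᵗ-↔ ⟨ ⟨ v 0F , v 1F ⟩ , v 2F ⟩ 3F (t ∷ᵉ ∅ᴹ ∷ᵉ d ∷ᵉ V ∷ᵉ []ᵉ)
    atomic = proj₁ (proj₂ (truth ∅ᴹ (∅∈ω isω) ∅ᴹ (proj₂ fun-↔ fun-∅)))
               r ∅ᴹ ∅ᴹ (proj₂ pair-in symbol , no-terms)

  -- Elementarity is applied to the atomic formula of `r` and the empty assignments, where the
  -- condition on images under `j` is vacuous.
  elementary-nullary : ∀ {L G j x x′ y y′ I I′ J J′ r} →
    Elementary L G j x x′ →
    x ≈ᴹ ⟪ y , ⟪ I , J ⟫ ⟫ → x′ ≈ᴹ ⟪ y′ , ⟪ I′ , J′ ⟫ ⟫ → ⟪ r , ∅ᴹ ⟫ ∈ᴹ L →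
    ⟪ r , ∅ᴹ ⟫ ∈ᴹ I ↔ ⟪ r , ∅ᴹ ⟫ ∈ᴹ I′
  elementary-nullary {r = r}
    (elementary (ω , Tm , F , D , D′ , R , R′ , (isω , _ , closed , _) , sat , sat′ , _ , elem)) e e′ symbol =
    (λ p → proj₁ there′ (proj₁ pair-in (proj₁ same (proj₂ pair-in (proj₂ here′ p))))) ,
    λ p → proj₁ here′ (proj₁ pair-in (proj₂ same (proj₂ pair-in (proj₂ there′ p))))
    where
    here′  = nullary-truth isω sat e symbol
    there′ = nullary-truth isω sat′ e′ symbol
    same = elem ∅ᴹ (∅∈ω isω) (relation-code r) ∅ᴹ ∅ᴹ
      ( proj₂ pair-in (proj₁ (∊ᵗ-↔ ⟨ v 0F , relᶜ (v 1F) (v 2F) ⟩ 3F (∅ᴹ ∷ᵉ r ∷ᵉ ∅ᴹ ∷ᵉ F ∷ᵉ []ᵉ))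
          (proj₁ (proj₂ (closed ∅ᴹ (∅∈ω isω))) r ∅ᴹ ∅ᴹ (proj₂ pair-in symbol , no-terms)))
      , proj₂ fun-↔ fun-∅ , proj₂ fun-↔ fun-∅
      , λ i a b (p , _) → proj₂ pair-in (exfalso (∉∅ (proj₁ pair-in p))))

module Classes {T : Theory ℓ} (𝔐 : Model T) (bst : ∀ {τ} → BST τ → T ⊢ τ)
               (vop : ∀ {τ} → VP τ → T ⊢ τ) where

  open Vopěnka 𝔐 bst vop
  open SetTheory 𝔐 bst

  -- The pair `⟪ r , ∅ᴹ ⟫` has two roles: in a language it gives `r` the arity 0, in an
  -- interpretation it makes `r` hold of the empty tuple. So the interpretations of this language
  -- are exactly its subsets.
  symbols : Carrier → Carrier
  symbols A = A ×ᴹ pairᴹ ∅ᴹ ∅ᴹ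

  singleton-structure : Carrier → Carrier → Carrier
  singleton-structure y I = ⟪ pairᴹ y y , ⟪ I , ∅ᴹ ⟫ ⟫

  symbols-fun : ∀ {A w} → ∅ᴹ ∈ᴹ w → Fun (symbols A) A w
  symbols-fun i =
    (λ p h → let a , j , b , k , e = proj₁ ∈-×ᴹ h in
      a , j , ∅ᴹ , i , ≈-trans e (⟪⟫-cong (≈ᴹ-refl a) (singleton-elim k))) ,
    λ a j → ∅ᴹ , λ c →
      (λ h → let _ , _ , _ , k , e = proj₁ ∈-×ᴹ h in
        ≈-trans (proj₂ (⟪⟫-injective e)) (singleton-elim k)) ,
      λ e → proj₂ ∈-×ᴹ (a , j , ∅ᴹ , pairˡ , ⟪⟫-cong (≈ᴹ-refl a) e)

  is-language : ∀ A → Language (symbols A) ∅ᴹ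
  is-language A = language (ωᴹ , ωᴹ-isOmega ,
    (A , proj₂ fun-↔ (symbols-fun (∅∈ω ωᴹ-isOmega))) , ∅ᴹ , proj₂ fun-↔ fun-∅)

  is-structure : ∀ {A I x y} → (∀ p → p ∈ᴹ I → p ∈ᴹ symbols A) → x ≈ᴹ singleton-structure y I →
                 Structure (symbols A) ∅ᴹ x
  is-structure {A} {I} {x} {y} sub e = structure (D , I , ∅ᴹ ,
    proj₂ (≐ᵗ-↔ 0F ⟨ v 1F , ⟨ v 2F , v 3F ⟩ ⟩ (x ∷ᵉ D ∷ᵉ I ∷ᵉ ∅ᴹ ∷ᵉ []ᵉ)) e ,
    (y , pairˡ) ,
    (λ p i → let a , j , b , k , e = proj₁ ∈-×ᴹ (sub p i)
                 e′ = ≈-trans e (⟪⟫-cong (≈ᴹ-refl a) (singleton-elim k)) in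
      a , ∅ᴹ , ∅ᴹ , proj₂ is-pair e′ , proj₂ pair-in (∈-respˡ e′ (sub p i)) , proj₂ fun-↔ fun-∅) ,
    (λ p i → ∅ᴹ , ∅ᴹ , ∅ᴹ , ∅ᴹ , exfalso (∉∅ i) ,
      proj₂ (≐ᵗ-↔ 0F ⟨ ⟨ v 1F , v 1F ⟩ , v 1F ⟩ (p ∷ᵉ ∅ᴹ ∷ᵉ []ᵉ)) (exfalso (∉∅ i)) ,
      proj₂ pair-in (exfalso (∉∅ i)) , proj₂ fun-↔ fun-∅) ,
    λ f k u (h , _) → ∅ᴹ , λ e → (λ _ → exfalso (∉∅ (proj₁ pair-in h))) ,
      λ _ → proj₂ (∊ᵗ-↔ ⟨ ⟨ v 0F , v 1F ⟩ , v 2F ⟩ 3F (f ∷ᵉ u ∷ᵉ e ∷ᵉ ∅ᴹ ∷ᵉ []ᵉ)) (exfalso (∉∅ (proj₁ pair-in h))))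
    where
    D = pairᴹ y y

  conj : {φ ψ : Formula n} → Δ₀ φ → Δ₀ ψ → Δ₀ (φ ∧ ψ)
  conj d e = (d ⇒ (e ⇒ ⊥ᶠ)) ⇒ ⊥ᶠ

  -- Were the class of structures ⟨{y}, ⟨I, ∅⟩⟩ proper, VP would embed one of
  -- them elementarily into a different one.  Since the embedding preserves the
  -- truth of every nullary symbol, I, and with it y, would be the same for both.
  collect : (ψ : Formula (2 + n)) (ρ : Env n) (A : Carrier) →
    (∀ {I y} → ⟦ ψ ⟧ (I ∷ᵉ y ∷ᵉ ρ) → ∀ p → p ∈ᴹ I → p ∈ᴹ symbols A) →
    (∀ {I I′ y y′} → ⟦ ψ ⟧ (I ∷ᵉ y ∷ᵉ ρ) → ⟦ ψ ⟧ (I′ ∷ᵉ y′ ∷ᵉ ρ) → I ≈ᴹ I′ → y ≈ᴹ y′) →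
    Σ Carrier λ b → ∀ y → (y ∈ᴹ b ↔ Σ Carrier λ I → ⟦ ψ ⟧ (I ∷ᵉ y ∷ᵉ ρ))
  -- Vopěnka's principle is used by contradiction, so the existential goal is rewritten as the truth
  -- of a formula, which is stable.
  collect {n} ψ ρ A sub functional = proj₁ goal-↔ (Stable.dne (Stable-⟦⟧ goal ρ) λ k →
    contradiction (vopěnkaᴹ Φ ρ (symbols A) ∅ᴹ (is-language A) (λ x p → structures (proj₁ (Φ-↔ x) p))
      λ (z , h) → k (proj₂ goal-↔ (extract z λ x →
        (λ i → proj₁ (Φ-↔ x) (proj₁ (h x) i)) , λ q → proj₂ (h x) (proj₂ (Φ-↔ x) q)))))
    where
    transfer : ∀ {I I′} → (∀ r → ⟪ r , ∅ᴹ ⟫ ∈ᴹ symbols A → ⟪ r , ∅ᴹ ⟫ ∈ᴹ I → ⟪ r , ∅ᴹ ⟫ ∈ᴹ I′) →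
               (∀ p → p ∈ᴹ I → p ∈ᴹ symbols A) → ∀ p → p ∈ᴹ I → p ∈ᴹ I′
    transfer f sub p i =
      let a , _ , _ , k , e = proj₁ ∈-×ᴹ (sub p i)
          e′ = ≈-trans e (⟪⟫-cong (≈ᴹ-refl a) (singleton-elim k))
      in ∈-respˡ (≈-sym e′) (f a (∈-respˡ e′ (sub p i)) (∈-respˡ e′ i))

    Φ : Formula (suc n)
    Φ = ∃[ I ] ∃[ y ] rename (I ↑ 1 Vector.∷ y Vector.∷ (3 ↑ʳ_)) ψ ∧
          2F ≐ᵗ ⟨ ｛ v y ⸴ v y ｝ , ⟨ v (I ↑ 1) , ∅ ⟩ ⟩

    Member : Carrier → Set ℓ
    Member x = Σ Carrier λ I → Σ Carrier λ y → ⟦ ψ ⟧ (I ∷ᵉ y ∷ᵉ ρ) × (x ≈ᴹ singleton-structure y I)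

    Φ-↔ : ∀ x → ⟦ Φ ⟧ (x ∷ᵉ ρ) ↔ Member x
    Φ-↔ x =
      (λ (I , y , p , e) → I , y , proj₁ (shift I y) p , proj₁ (eq-↔ I y) e) ,
      λ (I , y , p , e) → I , y , proj₂ (shift I y) p , proj₂ (eq-↔ I y) e
      where
      shift = λ I y → ⟦⟧-rename {ρ = y ∷ᵉ I ∷ᵉ x ∷ᵉ ρ} {ρ′ = I ∷ᵉ y ∷ᵉ ρ}
                (λ { zero → refl ; 1F → refl ; (suc (suc _)) → refl }) ψ
      eq-↔ = λ I y → ≐ᵗ-↔ 2F ⟨ ｛ v 0F ⸴ v 0F ｝ , ⟨ v 1F , ∅ ⟩ ⟩ (y ∷ᵉ I ∷ᵉ x ∷ᵉ []ᵉ)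

    structures : ∀ {x} → Member x → Structure (symbols A) ∅ᴹ x
    structures (I , y , q , e) = is-structure (sub q) e

    rigid : ∀ {j x x′} → Member x → Member x′ → Elementary (symbols A) ∅ᴹ j x x′ → x ≈ᴹ x′
    rigid (I , y , q , eq) (I′ , y′ , q′ , eq′) e =
      ≈-trans eq (≈-trans (⟪⟫-cong (pair-cong y≈y′ y≈y′) (⟪⟫-cong I≈I′ (≈ᴹ-refl _))) (≈-sym eq′))
      where
      I≈I′ : I ≈ᴹ I′
      I≈I′ = ext λ t →
        transfer (λ r s → proj₁ (elementary-nullary e eq eq′ s)) (sub q) t ,
        transfer (λ r s → proj₂ (elementary-nullary e eq eq′ s)) (sub q′) t
      y≈y′ : y ≈ᴹ y′
      y≈y′ = functional q q′ I≈I′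

    contradiction :
      (Σ Carrier λ x → Σ Carrier λ y → ⟦ Φ ⟧ (x ∷ᵉ ρ) × ⟦ Φ ⟧ (y ∷ᵉ ρ) × (x ≈ᴹ y → ⊥̇) ×
       Σ Carrier λ j → Elementary (symbols A) ∅ᴹ j x y) → ⊥̇
    contradiction (x , y , p , q , x≉y , j , e) = x≉y (rigid (proj₁ (Φ-↔ x) p) (proj₁ (Φ-↔ y) q) e)

    goal : Formula n
    goal = ∃[ b ] ∀[ y ] y ∊ b ↑ 1 ⇔ (∃[ I ] rename (I Vector.∷ y ↑ 1 Vector.∷ (3 ↑ʳ_)) ψ)

    goal-↔ : ⟦ goal ⟧ ρ ↔ Σ Carrier λ b → ∀ y → (y ∈ᴹ b ↔ Σ Carrier λ I → ⟦ ψ ⟧ (I ∷ᵉ y ∷ᵉ ρ))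
    goal-↔ =
      (λ (b , h) → b , λ y →
        (λ i → let I , p = proj₁ (h y) i in I , proj₁ (shift b y I) p) ,
        λ (I , p) → proj₂ (h y) (I , proj₂ (shift b y I) p)) ,
      λ (b , h) → b , λ y →
        (λ i → let I , p = proj₁ (h y) i in I , proj₂ (shift b y I) p) ,
        λ (I , p) → proj₂ (h y) (I , proj₁ (shift b y I) p)
      where
      shift = λ b y I → ⟦⟧-rename {ρ = I ∷ᵉ y ∷ᵉ b ∷ᵉ ρ} {ρ′ = I ∷ᵉ y ∷ᵉ ρ}
                (λ { zero → refl ; 1F → refl ; (suc (suc _)) → refl }) ψ

    -- The domain D = {y} is the common element of the elements of
    -- s = {{D, D}, {D, ⟨I, ∅⟩}}.
    extract : ∀ z → (∀ x → (x ∈ᴹ z ↔ Member x)) →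
              Σ Carrier λ b → ∀ y → (y ∈ᴹ b ↔ Σ Carrier λ I → ⟦ ψ ⟧ (I ∷ᵉ y ∷ᵉ ρ))
    extract z h = proj₁ set , λ y →
      (λ i → recover (proj₁ (proj₂ set y) i)) ,
      λ (I , p) →
        let s∈z = proj₂ (h (singleton-structure y I)) (I , y , p , ≈ᴹ-refl _)
            D∈U = proj₂ ∈-⋃ (_ , proj₂ ∈-⋃ (_ , s∈z , pairˡ) , pairˡ)
        in proj₂ (proj₂ set y) (proj₂ ∈-⋃ (_ , D∈U , pairˡ) , pairᴹ y y , D∈U , _ , s∈z ,
             (λ c i → pair-elim i (λ e → ∈-respʳ (≈-sym e) pairˡ) (λ e → ∈-respʳ (≈-sym e) pairˡ)) , pairˡ)
      where
      χ : Formula 3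
      χ = ∃[ D ∈ 1F ] ∃[ s ∈ 3F ] (∀[ c ∈ s ] D ↑ 2 ∊ c) ∧ 2F ∊ D ↑ 1
      -- With Kuratowski pairs, `D` lies two unions below `z` and `y` three. The parameter
      -- `⋃ᴹ (⋃ᴹ z)` bounds the quantifier over `D` and so keeps the formula `Δ₀`.
      set = separate₀ {φ = χ} (∃∈ 1F (∃∈ 3F (conj (∀∈ 0F (2F ∊ 0F)) (2F ∊ 1F))))
              (⋃ᴹ (⋃ᴹ z) ∷ᵉ z ∷ᵉ []ᵉ) (⋃ᴹ (⋃ᴹ (⋃ᴹ z)))
      recover : ∀ {y} → (y ∈ᴹ ⋃ᴹ (⋃ᴹ (⋃ᴹ z))) × ⟦ χ ⟧ (y ∷ᵉ ⋃ᴹ (⋃ᴹ z) ∷ᵉ z ∷ᵉ []ᵉ) →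
                Σ Carrier λ I → ⟦ ψ ⟧ (I ∷ᵉ y ∷ᵉ ρ)
      recover {y} (_ , D , _ , s , s∈z , common , y∈D) = from (proj₁ (h s) s∈z)
        where
        from : Member s → Σ Carrier λ I → ⟦ ψ ⟧ (I ∷ᵉ y ∷ᵉ ρ)
        from (I , y′ , p , e) =
          I , ⟦⟧-resp ψ (λ { zero → ≈ᴹ-refl _ ; 1F → y′≈y ; (suc (suc i)) → ≈ᴹ-refl _ }) p
          where
          y′≈y : y′ ≈ᴹ y
          y′≈y = ≈-sym (singleton-elim (∈-respʳ (singleton-elim
                   (common _ (∈-respʳ (≈-sym e) pairˡ))) y∈D))

-- Replacement, Separation and Powerset

module Comprehension {T : Theory ℓ} (𝔐 : Model T) (bst : ∀ {τ} → BST τ → T ⊢ τ)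
                     (vop : ∀ {τ} → VP τ → T ⊢ τ) where

  open Classes 𝔐 bst vop
  open SetTheory 𝔐 bst

  -- `I` makes only the symbol of `x` true, so it determines `x`, and `unique` then determines `y`.
  replaceᴹ : (φ : Formula (2 + n)) (ρ : Env n) (a : Carrier) →
    (∀ x → x ∈ᴹ a → Σ Carrier λ z → ∀ y → ⟦ φ ⟧ (x ∷ᵉ y ∷ᵉ ρ) → y ≈ᴹ z) →
    Σ Carrier λ b → ∀ y → (y ∈ᴹ b ↔ Σ Carrier λ x → (x ∈ᴹ a) × ⟦ φ ⟧ (x ∷ᵉ y ∷ᵉ ρ))
  replaceᴹ {n} φ ρ a unique = proj₁ image , λ y →
    (λ i → forward (proj₁ (proj₂ image y) i)) ,
    λ (x , i , p) → proj₂ (proj₂ image y) (_ , proj₂ (ψ-↔ _ y) (x , i , ≈ᴹ-refl _ , p))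
    where
    ψ : Formula (3 + n)
    ψ = ∃[ x ∈ 2F ] 1F ≐ᵗ ｛ ⟨ v x , ∅ ⟩ ⸴ ⟨ v x , ∅ ⟩ ｝ ∧
          rename (x Vector.∷ 2F Vector.∷ (4 ↑ʳ_)) φ

    Witness : Carrier → Carrier → Set ℓ
    Witness I y = Σ Carrier λ x → (x ∈ᴹ a) × (I ≈ᴹ pairᴹ ⟪ x , ∅ᴹ ⟫ ⟪ x , ∅ᴹ ⟫) × ⟦ φ ⟧ (x ∷ᵉ y ∷ᵉ ρ)

    ψ-↔ : ∀ I y → ⟦ ψ ⟧ (I ∷ᵉ y ∷ᵉ a ∷ᵉ ρ) ↔ Witness I y
    ψ-↔ I y =
      (λ (x , i , e , p) → x , i , proj₁ (eq-↔ x) e , proj₁ (shift x) p) ,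
      λ (x , i , e , p) → x , i , proj₂ (eq-↔ x) e , proj₂ (shift x) p
      where
      eq-↔ = λ x → ≐ᵗ-↔ 1F ｛ ⟨ v 0F , ∅ ⟩ ⸴ ⟨ v 0F , ∅ ⟩ ｝ (x ∷ᵉ I ∷ᵉ []ᵉ)
      shift = λ x → ⟦⟧-rename {ρ = x ∷ᵉ I ∷ᵉ y ∷ᵉ a ∷ᵉ ρ} {ρ′ = x ∷ᵉ y ∷ᵉ ρ}
                (λ { zero → refl ; 1F → refl ; (suc (suc _)) → refl }) φ

    sub : ∀ {I y} → Witness I y → ∀ p → p ∈ᴹ I → p ∈ᴹ symbols a
    sub (x , i , e , _) p j =
      proj₂ ∈-×ᴹ (x , i , ∅ᴹ , pairˡ , singleton-elim (∈-respʳ e j))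

    functional : ∀ {I I′ y y′} → ⟦ ψ ⟧ (I ∷ᵉ y ∷ᵉ a ∷ᵉ ρ) → ⟦ ψ ⟧ (I′ ∷ᵉ y′ ∷ᵉ a ∷ᵉ ρ) → I ≈ᴹ I′ → y ≈ᴹ y′
    functional p q = from (proj₁ (ψ-↔ _ _) p) (proj₁ (ψ-↔ _ _) q)
      where
      from : ∀ {I I′ y y′} → Witness I y → Witness I′ y′ → I ≈ᴹ I′ → y ≈ᴹ y′
      from (x , i , e , p) (x′ , i′ , e′ , p′) I≈I′ =
        ≈-trans (proj₂ (unique x i) _ p) (≈-sym (proj₂ (unique x i) _
          (⟦⟧-resp φ (λ { zero → x′≈x ; (suc _) → ≈ᴹ-refl _ }) p′)))
        where
        x′≈x : x′ ≈ᴹ x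
        x′≈x = proj₁ (⟪⟫-injective (singleton-elim
          (∈-respʳ (≈-trans (≈-sym e′) (≈-trans (≈-sym I≈I′) e)) pairˡ)))

    image = collect ψ (a ∷ᵉ ρ) a (λ p → sub (proj₁ (ψ-↔ _ _) p)) functional

    forward : ∀ {y} → (Σ Carrier λ I → ⟦ ψ ⟧ (I ∷ᵉ y ∷ᵉ a ∷ᵉ ρ)) →
              Σ Carrier λ x → (x ∈ᴹ a) × ⟦ φ ⟧ (x ∷ᵉ y ∷ᵉ ρ)
    forward {y} (I , p) = let x , i , _ , q = proj₁ (ψ-↔ I y) p in x , i , q

  -- Replacement along the partial identity function that is defined where `φ` holds.
  separateᴹ : (φ : Formula (suc n)) (ρ : Env n) (a : Carrier) →
              Σ Carrier λ b → ∀ x → (x ∈ᴹ b ↔ (x ∈ᴹ a) × ⟦ φ ⟧ (x ∷ᵉ ρ))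
  separateᴹ {n} φ ρ a = proj₁ image , λ y →
    (λ i → forward (proj₁ (proj₂ image y) i)) ,
    λ (i , p) → proj₂ (proj₂ image y) (y , i , proj₂ (φ′-↔ y y) (≈ᴹ-refl y , p))
    where
    φ′ : Formula (2 + n)
    φ′ = 0F ≐ 1F ∧ rename (0F Vector.∷ (2 ↑ʳ_)) φ

    φ′-↔ : ∀ x y → ⟦ φ′ ⟧ (x ∷ᵉ y ∷ᵉ ρ) ↔ ((x ≈ᴹ y) × ⟦ φ ⟧ (x ∷ᵉ ρ))
    φ′-↔ x y = (λ (e , p) → e , proj₁ shift p) , λ (e , p) → e , proj₂ shift p
      where
      shift = ⟦⟧-rename {ρ = x ∷ᵉ y ∷ᵉ ρ} {ρ′ = x ∷ᵉ ρ} (λ { zero → refl ; (suc _) → refl }) φ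

    image = replaceᴹ φ′ ρ a λ x _ → x , λ y p → ≈-sym (proj₁ (proj₁ (φ′-↔ x y) p))

    forward : ∀ {y} → (Σ Carrier λ x → (x ∈ᴹ a) × ⟦ φ′ ⟧ (x ∷ᵉ y ∷ᵉ ρ)) → (y ∈ᴹ a) × ⟦ φ ⟧ (y ∷ᵉ ρ)
    forward {y} (x , i , p) = let e , q = proj₁ (φ′-↔ x y) p in
      ∈-respˡ e i , ⟦⟧-resp φ (λ { zero → e ; (suc _) → ≈ᴹ-refl _ }) q

  -- There is no circularity: `collect` needs every single code to be a subset of `symbols a`, but
  -- no set of all codes. The code of `z` is `symbols z`.
  powersetᴹ : ∀ a → Σ Carrier λ b → ∀ z → (z ∈ᴹ b ↔ (∀ w → w ∈ᴹ z → w ∈ᴹ a))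
  powersetᴹ a = proj₁ subsets , λ z →
    (λ i → forward (proj₁ (proj₂ subsets z) i)) ,
    λ sub → proj₂ (proj₂ subsets z) (symbols z , proj₂ (ψ-↔ _ z)
      ( (λ p i → let x , j , rest = proj₁ ∈-×ᴹ i in proj₂ ∈-×ᴹ (x , sub x j , rest))
      , sub
      , λ w _ → (λ i → proj₂ ∈-×ᴹ (w , i , ∅ᴹ , pairˡ , ≈ᴹ-refl _)) ,
                λ i → let x , j , _ , _ , e = proj₁ ∈-×ᴹ i in
                      ∈-respˡ (≈-sym (proj₁ (⟪⟫-injective e))) j))
    where
    ψ : Formula 4
    ψ = 0F ⊆′ 3F ∧ 1F ⊆′ 2F ∧ (∀[ w ∈ 2F ] w ∊ 2F ⇔ ⟨ v w , ∅ ⟩ ∊ᵗ 1F)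

    ρ : Env 2
    ρ = a ∷ᵉ symbols a ∷ᵉ []ᵉ

    Codes : Carrier → Carrier → Set ℓ
    Codes I y = (∀ p → p ∈ᴹ I → p ∈ᴹ symbols a) × (∀ w → w ∈ᴹ y → w ∈ᴹ a) ×
                (∀ w → w ∈ᴹ a → (w ∈ᴹ y ↔ ⟪ w , ∅ᴹ ⟫ ∈ᴹ I))

    ψ-↔ : ∀ I y → ⟦ ψ ⟧ (I ∷ᵉ y ∷ᵉ ρ) ↔ Codes I y
    ψ-↔ I y =
      (λ (p , q , r) → p , q , λ w i →
        (λ j → proj₁ (code w) (proj₁ (r w i) j)) , λ j → proj₂ (r w i) (proj₂ (code w) j)) ,
      λ (p , q , r) → p , q , λ w i →
        (λ j → proj₂ (code w) (proj₁ (r w i) j)) , λ j → proj₂ (r w i) (proj₁ (code w) j)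
      where
      code = λ w → ∊ᵗ-↔ ⟨ v 0F , ∅ ⟩ 1F (w ∷ᵉ I ∷ᵉ []ᵉ)

    functional : ∀ {I I′ y y′} → ⟦ ψ ⟧ (I ∷ᵉ y ∷ᵉ ρ) → ⟦ ψ ⟧ (I′ ∷ᵉ y′ ∷ᵉ ρ) → I ≈ᴹ I′ → y ≈ᴹ y′
    functional p q = from (proj₁ (ψ-↔ _ _) p) (proj₁ (ψ-↔ _ _) q)
      where
      from : ∀ {I I′ y y′} → Codes I y → Codes I′ y′ → I ≈ᴹ I′ → y ≈ᴹ y′
      from (_ , q , r) (_ , q′ , r′) e = ext λ w →
        (λ i → proj₂ (r′ w (q w i)) (∈-respʳ e (proj₁ (r w (q w i)) i))) ,
        λ i → proj₂ (r w (q′ w i)) (∈-respʳ (≈-sym e) (proj₁ (r′ w (q′ w i)) i))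

    subsets = collect ψ ρ a (λ p → proj₁ (proj₁ (ψ-↔ _ _) p)) functional

    forward : ∀ {y} → (Σ Carrier λ I → ⟦ ψ ⟧ (I ∷ᵉ y ∷ᵉ ρ)) → ∀ w → w ∈ᴹ y → w ∈ᴹ a
    forward {y} (I , p) = proj₁ (proj₂ (proj₁ (ψ-↔ I y) p))

  replacement-holds : (φ : Formula (2 + n)) → ⟦ replacement φ ⟧ []ᵉ
  replacement-holds {n} φ = ∀*-intro holds
    where
    argument : Fin (2 + n) → Fin (4 + n)
    argument = 2F Vector.∷ 0F Vector.∷ (4 ↑ʳ_)
    value : Fin (2 + n) → Fin (4 + n)
    value = 0F Vector.∷ 1F Vector.∷ (4 ↑ʳ_)
    shift₁ = λ ρ a x y z → ⟦⟧-rename {r = argument} {ρ = y ∷ᵉ z ∷ᵉ x ∷ᵉ a ∷ᵉ ρ} {ρ′ = x ∷ᵉ y ∷ᵉ ρ}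
      (λ { zero → refl ; 1F → refl ; (suc (suc _)) → refl }) φ
    shift₂ = λ ρ a b x y → ⟦⟧-rename {r = value} {ρ = x ∷ᵉ y ∷ᵉ b ∷ᵉ a ∷ᵉ ρ} {ρ′ = x ∷ᵉ y ∷ᵉ ρ}
      (λ { zero → refl ; 1F → refl ; (suc (suc _)) → refl }) φ
    holds : ∀ ρ a →
      (∀ x → x ∈ᴹ a → Σ Carrier λ z → ∀ y → ⟦ rename argument φ ⟧ (y ∷ᵉ z ∷ᵉ x ∷ᵉ a ∷ᵉ ρ) → y ≈ᴹ z) →
      Σ Carrier λ b → ∀ y → (y ∈ᴹ b ↔
        Σ Carrier λ x → (x ∈ᴹ a) × ⟦ rename value φ ⟧ (x ∷ᵉ y ∷ᵉ b ∷ᵉ a ∷ᵉ ρ))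
    holds ρ a unique =
      let b , h = replaceᴹ φ ρ a λ x i → let z , u = unique x i in
                    z , λ y p → u y (proj₂ (shift₁ ρ a x y z) p)
      in b , λ y →
        (λ i → let x , j , p = proj₁ (h y) i in x , j , proj₂ (shift₂ ρ a b x y) p) ,
        λ (x , j , p) → proj₂ (h y) (x , j , proj₁ (shift₂ ρ a b x y) p)

  separation-holds : (φ : Formula (suc n)) → ⟦ separation φ ⟧ []ᵉ
  separation-holds {n} φ = ∀*-intro holds
    where
    element : Fin (suc n) → Fin (3 + n)
    element = 0F Vector.∷ (3 ↑ʳ_)
    shift = λ ρ a b x → ⟦⟧-rename {r = element} {ρ = x ∷ᵉ b ∷ᵉ a ∷ᵉ ρ} {ρ′ = x ∷ᵉ ρ}
      (λ { zero → refl ; (suc _) → refl }) φ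
    holds : ∀ ρ a → Σ Carrier λ b → ∀ x →
            (x ∈ᴹ b ↔ (x ∈ᴹ a) × ⟦ rename element φ ⟧ (x ∷ᵉ b ∷ᵉ a ∷ᵉ ρ))
    holds ρ a = let b , h = separateᴹ φ ρ a in b , λ x →
      (λ i → let j , p = proj₁ (h x) i in j , proj₂ (shift ρ a b x) p) ,
      λ (j , p) → proj₂ (h x) (j , proj₁ (shift ρ a b x) p)

-- Transitive models of ZFC

module Functions {T : Theory ℓ} (𝔐 : Model T) (bst : ∀ {τ} → BST τ → T ⊢ τ) where

  open SetTheory 𝔐 bst

  num : ℕ → Carrier
  num k = val (# k) []ᵉ

  num-transitive : ∀ k {x z} → x ∈ᴹ num k → z ∈ᴹ x → z ∈ᴹ num k
  num-transitive zero    p q = exfalso (∉∅ p)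
  num-transitive (suc k) p q = proj₂ ∈-suc λ z∉k → exfalso (∨-elim (proj₁ ∈-suc p)
    (λ x∈k → z∉k (num-transitive k x∈k q)) λ x≈k → z∉k (∈-respʳ x≈k q))

  n∈suc : ∀ {x} → x ∈ᴹ sucᴹ x
  n∈suc = proj₂ ∈-suc λ _ → ≈ᴹ-refl _

  -- Foundation is not yet available, so this is an induction on the external number, by
  -- transitivity of `num k`.
  num-irreflexive : ∀ k → num k ∈ᴹ num k → ⊥̇
  num-irreflexive zero    p = ∉∅ p
  num-irreflexive (suc k) p = num-irreflexive k (∨-elim (proj₁ ∈-suc p)
    (λ q → num-transitive k q n∈suc) λ e → ∈-respʳ e n∈suc)

  num-< : ∀ {i k} → i < k → num i ∈ᴹ num k
  num-< {i} {suc k} (s≤s i≤k) with m≤n⇒m<n∨m≡n i≤k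
  ... | inj₁ i<k  = proj₂ ∈-suc λ k → exfalso (k (num-< i<k))
  ... | inj₂ refl = n∈suc

  num-distinct : ∀ {i k} → i < k → num i ≈ᴹ num k → ⊥̇
  num-distinct {k = k} i<k e = num-irreflexive k (∈-respˡ e (num-< i<k))

  num∈ω : ∀ {w} → ⟦ IsOmega 0F ⟧ (w ∷ᵉ []ᵉ) → ∀ k → num k ∈ᴹ w
  num∈ω isω zero    = ∅∈ω isω
  num∈ω isω (suc k) = suc∈ω isω (num∈ω isω k)

  Value : Carrier → Carrier → Set ℓ
  Value f a = Σ Carrier λ b → ∀ c → (⟪ a , c ⟫ ∈ᴹ f ↔ c ≈ᴹ b)

  -- Needed to define values by cases; as a `Σ` type, `Value` gets its stability from the formula
  -- `φ`.
  Stable-Value : ∀ {f a} → Stable (Value f a)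
  Stable-Value {f} {a} = mkStable λ k →
    to (Stable.dne (Stable-⟦⟧ φ (f ∷ᵉ a ∷ᵉ []ᵉ)) λ h → k λ x → h (from x))
    where
    φ : Formula 2
    φ = ∃[ b ] ∀[ c ] ⟨ v 3F , v c ⟩ ∊ᵗ 2F ⇔ c ≐ b ↑ 1
    to : ⟦ φ ⟧ (f ∷ᵉ a ∷ᵉ []ᵉ) → Value f a
    to (b , h) = b , λ c → (λ p → proj₁ (h c) (proj₂ pair-in p)) , λ e → proj₁ pair-in (proj₂ (h c) e)
    from : Value f a → ⟦ φ ⟧ (f ∷ᵉ a ∷ᵉ []ᵉ)
    from (b , h) = b , λ c → (λ p → proj₁ (h c) (proj₁ pair-in p)) , λ e → proj₂ pair-in (proj₂ (h c) e)

  Value-respˡ : ∀ {f a a′} → a ≈ᴹ a′ → Value f a → Value f a′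
  Value-respˡ e (b , h) = b , λ c →
    (λ p → proj₁ (h c) (∈-respˡ (⟪⟫-cong (≈-sym e) (≈ᴹ-refl c)) p)) ,
    λ p → ∈-respˡ (⟪⟫-cong e (≈ᴹ-refl c)) (proj₂ (h c) p)

  fun : ∀ {f A B} → (∀ p → p ∈ᴹ f → p ∈ᴹ A ×ᴹ B) → (∀ a → a ∈ᴹ A → Value f a) → Fun f A B
  fun h k = (λ p i → proj₁ ∈-×ᴹ (h p i)) , k

  pair-∈-×ᴹ : ∀ {a b A B} → a ∈ᴹ A → b ∈ᴹ B → ⟪ a , b ⟫ ∈ᴹ A ×ᴹ B
  pair-∈-×ᴹ i j = proj₂ ∈-×ᴹ (_ , i , _ , j , ≈ᴹ-refl _)

  ×ᴹ-pair-∈ : ∀ {a b A B} → ⟪ a , b ⟫ ∈ᴹ A ×ᴹ B → (a ∈ᴹ A) × (b ∈ᴹ B)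
  ×ᴹ-pair-∈ p = let _ , i , _ , j , e = proj₁ ∈-×ᴹ p
                    e₁ , e₂ = ⟪⟫-injective e
                in ∈-respˡ (≈-sym e₁) i , ∈-respˡ (≈-sym e₂) j

  module _ {f A B} (isFun : Fun f A B) where

    fun-⊆ : ∀ p → p ∈ᴹ f → p ∈ᴹ A ×ᴹ B
    fun-⊆ p i = proj₂ ∈-×ᴹ (proj₁ isFun p i)

    fun-type : ∀ {a b} → ⟪ a , b ⟫ ∈ᴹ f → (a ∈ᴹ A) × (b ∈ᴹ B)
    fun-type i = ×ᴹ-pair-∈ (fun-⊆ _ i)

    fun-value : ∀ {a} → a ∈ᴹ A → Σ Carrier λ b → ⟪ a , b ⟫ ∈ᴹ f
    fun-value {a} i = let b , h = proj₂ isFun a i in b , proj₂ (h b) (≈ᴹ-refl b)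

    fun-unique : ∀ {a b c} → ⟪ a , b ⟫ ∈ᴹ f → ⟪ a , c ⟫ ∈ᴹ f → b ≈ᴹ c
    fun-unique {a} i j = let b , h = proj₂ isFun a (proj₁ (fun-type i)) in
      ≈-trans (proj₁ (h _) i) (≈-sym (proj₁ (h _) j))

  constant : ∀ {A B b} → b ∈ᴹ B → Fun (A ×ᴹ pairᴹ b b) A B
  constant {A} {B} {b} b∈B = fun
    (λ p i → let a , j , c , k , e = proj₁ ∈-×ᴹ i in
      proj₂ ∈-×ᴹ (a , j , c , ∈-respˡ (≈-sym (singleton-elim k)) b∈B , e))
    λ a i → b , λ c → (λ p → singleton-elim (proj₂ (×ᴹ-pair-∈ p))) ,
                      λ e → pair-∈-×ᴹ i (∈-respˡ (≈-sym e) pairˡ)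

  -- The 2-tuple as a function on `num 2`, which is how `memᶜ` and the interpretation of `∈` store
  -- their arguments.
  couple : Carrier → Carrier → Carrier
  couple p q = pairᴹ ⟪ num 0 , p ⟫ ⟪ num 1 , q ⟫

  couple-elim : ∀ {i x p q} {C : Set ℓ} {{s : Stable C}} → ⟪ i , x ⟫ ∈ᴹ couple p q →
                (i ≈ᴹ num 0 → x ≈ᴹ p → C) → (i ≈ᴹ num 1 → x ≈ᴹ q → C) → C
  couple-elim h f g = pair-elim h
    (λ e → let e₁ , e₂ = ⟪⟫-injective e in f e₁ e₂) λ e → let e₁ , e₂ = ⟪⟫-injective e in g e₁ e₂

  0≉1 : num 0 ≈ᴹ num 1 → ⊥̇
  0≉1 = num-distinct {0} {1} (s≤s z≤n)

  couple-fun : ∀ {p q B} → p ∈ᴹ B → q ∈ᴹ B → Fun (couple p q) (num 2) B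
  couple-fun {p} {q} {B} p∈B q∈B = fun
    (λ t i → pair-elim i
      (λ e → ∈-respˡ (≈-sym e) (pair-∈-×ᴹ (num-< {0} {2} (s≤s z≤n)) p∈B))
      (λ e → ∈-respˡ (≈-sym e) (pair-∈-×ᴹ (num-< {1} {2} (s≤s (s≤s z≤n))) q∈B)))
    λ a i → ∨-elim {{Stable-Value}} (proj₁ ∈-suc i)
      (λ j → Value-respˡ (≈-sym (proj₁ ∈-suc j λ k → exfalso (∉∅ k))) value₀)
      (λ e → Value-respˡ (≈-sym e) value₁)
    where
    value₀ : Value (couple p q) (num 0)
    value₀ = p , λ c →
      (λ h → couple-elim h (λ _ e → e) λ e _ → exfalso (0≉1 e)) ,
      λ e → ∈-respˡ (⟪⟫-cong (≈ᴹ-refl _) (≈-sym e)) pairˡ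
    value₁ : Value (couple p q) (num 1)
    value₁ = q , λ c →
      (λ h → couple-elim h (λ e _ → exfalso (0≉1 (≈-sym e))) λ _ e → e) ,
      λ e → ∈-respˡ (⟪⟫-cong (≈ᴹ-refl _) (≈-sym e)) pairʳ

  -- The assignment `s` with its value at `i` changed to `x`. The old value is removed as a member
  -- of the set `column`, so that the separating formula is just a negated membership.
  module Update (s i x Y : Carrier) where

    private
      column : Carrier
      column = pairᴹ i i ×ᴹ Y
      rest = separate₀ {φ = ¬′ (0F ∊ 1F)} ((0F ∊ 1F) ⇒ ⊥ᶠ) (column ∷ᵉ []ᵉ) s

    update : Carrier
    update = ⋃ᴹ (pairᴹ (proj₁ rest) (pairᴹ ⟪ i , x ⟫ ⟪ i , x ⟫))

    private
      update-elim : ∀ {p} {C : Set ℓ} {{st : Stable C}} → p ∈ᴹ update →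
                    (p ∈ᴹ s → (p ∈ᴹ column → ⊥̇) → C) → (p ≈ᴹ ⟪ i , x ⟫ → C) → C
      update-elim {p} h f g = let w , j , k = proj₁ ∈-⋃ h in pair-elim j
        (λ e → let l , m = proj₁ (proj₂ rest p) (∈-respʳ e k) in f l m)
        λ e → g (singleton-elim (∈-respʳ e k))

      update-keep : ∀ {p} → p ∈ᴹ s → (p ∈ᴹ column → ⊥̇) → p ∈ᴹ update
      update-keep j k = proj₂ ∈-⋃ (_ , pairˡ , proj₂ (proj₂ rest _) (j , k))

      update-here : ⟪ i , x ⟫ ∈ᴹ update
      update-here = proj₂ ∈-⋃ (_ , pairʳ , pairˡ)

    module _ {k} (isFun : Fun s k Y) (i∈k : i ∈ᴹ k) (x∈Y : x ∈ᴹ Y) where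

      update-at : ∀ c → (⟪ i , c ⟫ ∈ᴹ update ↔ c ≈ᴹ x)
      update-at c =
        (λ h → update-elim h
          (λ j k → exfalso (k (pair-∈-×ᴹ pairˡ (proj₂ (fun-type isFun j)))))
          λ e → proj₂ (⟪⟫-injective e)) ,
        λ e → ∈-respˡ (⟪⟫-cong (≈ᴹ-refl i) (≈-sym e)) update-here

      update-off : ∀ {j} → (j ≈ᴹ i → ⊥̇) → ∀ c → (⟪ j , c ⟫ ∈ᴹ update ↔ ⟪ j , c ⟫ ∈ᴹ s)
      update-off j≉i c =
        (λ h → update-elim h (λ l _ → l) λ e → exfalso (j≉i (proj₁ (⟪⟫-injective e)))) ,
        λ l → update-keep l λ m → j≉i (singleton-elim (proj₁ (×ᴹ-pair-∈ m)))

      update-fun : Fun update k Y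
      update-fun = fun
        (λ p h → update-elim h (λ j _ → fun-⊆ isFun p j) λ e → ∈-respˡ (≈-sym e) (pair-∈-×ᴹ i∈k x∈Y))
        λ a a∈k → by-cases (a ≈ᴹ i) {{Stable-Value}}
          (λ e → Value-respˡ (≈-sym e) (x , update-at))
          λ a≉i → let b , h = proj₂ isFun a a∈k in b , λ c →
            (λ l → proj₁ (h c) (proj₁ (update-off a≉i c) l)) ,
            λ e → proj₂ (update-off a≉i c) (proj₂ (h c) e)

-- Coded formulas and their truth in a set

module SmallModels {T : Theory ℓ} (𝔐 : Model T) (bst : ∀ {τ} → BST τ → T ⊢ τ) where

  open SetTheory 𝔐 bst
  open Functions 𝔐 bst

  varᴹ : Carrier → Carrier
  varᴹ i = ⟪ num 0 , i ⟫

  eqᴹ memᴹ impᴹ allᴹ : Carrier → Carrier → Carrier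
  eqᴹ i j  = ⟪ num 0 , ⟪ varᴹ i , varᴹ j ⟫ ⟫
  memᴹ i j = ⟪ num 1 , ⟪ num 0 , couple (varᴹ i) (varᴹ j) ⟫ ⟫
  impᴹ φ ψ = ⟪ num 3 , ⟪ φ , ψ ⟫ ⟫
  allᴹ i φ = ⟪ num 4 , ⟪ i , φ ⟫ ⟫

  botᴹ : Carrier
  botᴹ = ⟪ num 2 , ∅ᴹ ⟫

  code : Formula n → Carrier
  code φ = val ⌜ φ ⌝ []ᵉ

  -- Closure and truth clauses for the single symbol `∈`, with the coded terms already evaluated:
  -- the form in which an external induction on formulas can use them.
  record SmallModel (Y : Carrier) : Set ℓ where
    field
      {ω F R} : Carrier
      isω : ⟦ IsOmega 0F ⟧ (ω ∷ᵉ []ᵉ)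
      eq-formula  : ∀ {k i j} → k ∈ᴹ ω → i ∈ᴹ k → j ∈ᴹ k → ⟪ k , eqᴹ i j ⟫ ∈ᴹ F
      mem-formula : ∀ {k i j} → k ∈ᴹ ω → i ∈ᴹ k → j ∈ᴹ k → ⟪ k , memᴹ i j ⟫ ∈ᴹ F
      bot-formula : ∀ {k} → k ∈ᴹ ω → ⟪ k , botᴹ ⟫ ∈ᴹ F
      imp-formula : ∀ {k φ ψ} → k ∈ᴹ ω → ⟪ k , φ ⟫ ∈ᴹ F → ⟪ k , ψ ⟫ ∈ᴹ F → ⟪ k , impᴹ φ ψ ⟫ ∈ᴹ F
      all-formula : ∀ {k i φ} → k ∈ᴹ ω → i ∈ᴹ k → ⟪ k , φ ⟫ ∈ᴹ F → ⟪ k , allᴹ i φ ⟫ ∈ᴹ F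
      eq-true  : ∀ {k s i j} → k ∈ᴹ ω → Fun s k Y → i ∈ᴹ k → j ∈ᴹ k →
                 ⟪ eqᴹ i j , s ⟫ ∈ᴹ R ↔ (Σ Carrier λ d → (⟪ i , d ⟫ ∈ᴹ s) × (⟪ j , d ⟫ ∈ᴹ s))
      mem-true : ∀ {k s i j} → k ∈ᴹ ω → Fun s k Y → i ∈ᴹ k → j ∈ᴹ k →
                 ⟪ memᴹ i j , s ⟫ ∈ᴹ R ↔
                 (Σ Carrier λ a → Σ Carrier λ b → (⟪ i , a ⟫ ∈ᴹ s) × (⟪ j , b ⟫ ∈ᴹ s) × (a ∈ᴹ b))
      bot-true : ∀ {k s} → k ∈ᴹ ω → Fun s k Y → ⟪ botᴹ , s ⟫ ∈ᴹ R → ⊥̇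
      imp-true : ∀ {k s φ ψ} → k ∈ᴹ ω → Fun s k Y → ⟪ k , φ ⟫ ∈ᴹ F → ⟪ k , ψ ⟫ ∈ᴹ F →
                 ⟪ impᴹ φ ψ , s ⟫ ∈ᴹ R ↔ (⟪ φ , s ⟫ ∈ᴹ R → ⟪ ψ , s ⟫ ∈ᴹ R)
      all-true : ∀ {k s i φ} → k ∈ᴹ ω → Fun s k Y → i ∈ᴹ k → ⟪ k , φ ⟫ ∈ᴹ F →
                 ⟪ allᴹ i φ , s ⟫ ∈ᴹ R ↔
                 (∀ s′ → Fun s′ k Y →
                  (∀ j d → (j ≈ᴹ i → ⊥̇) → (⟪ j , d ⟫ ∈ᴹ s′ ↔ ⟪ j , d ⟫ ∈ᴹ s)) → ⟪ φ , s′ ⟫ ∈ᴹ R)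
      axiom-true : ∀ {τ k s} → τ ∈ finiteZFC → k ∈ᴹ ω → ⟪ k , code τ ⟫ ∈ᴹ F → Fun s k Y →
                   ⟪ code τ , s ⟫ ∈ᴹ R

  val-# : ∀ k (ρ : Env n) → val (# k) ρ ≡ num k
  val-# zero    ρ = refl
  val-# (suc k) ρ = cong sucᴹ (val-# k ρ)

  val-⌜⌝ : (φ : Formula m) (ρ : Env n) → val ⌜ φ ⌝ ρ ≡ code φ
  val-⌜⌝ ⊥ᶠ      ρ = refl
  val-⌜⌝ (i ≐ j) ρ = cong₂ eqᴹ (val-# (toℕ (opposite i)) ρ) (val-# (toℕ (opposite j)) ρ)
  val-⌜⌝ (i ∊ j) ρ = cong₂ memᴹ (val-# (toℕ (opposite i)) ρ) (val-# (toℕ (opposite j)) ρ)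
  val-⌜⌝ (φ ⇒ ψ) ρ = cong₂ impᴹ (val-⌜⌝ φ ρ) (val-⌜⌝ ψ ρ)
  val-⌜⌝ {m} (∀′ φ) ρ = cong₂ allᴹ (val-# m ρ) (val-⌜⌝ φ ρ)

  ∨-introˡ : {ρ : Env n} {χ φ ψ : Formula n} → χ ≡ φ ∨ ψ → ⟦ φ ⟧ ρ → ⟦ χ ⟧ ρ
  ∨-introˡ {ρ = ρ} {φ = φ} {ψ} refl p = proj₂ (⟦⟧-⇒ (¬′ φ) ψ) λ h →
    exfalso {{Stable-⟦⟧ ψ ρ}} (proj₁ (⟦⟧-⇒ φ ⊥ᶠ) h p)

  ∨-introʳ : {ρ : Env n} {χ φ ψ : Formula n} → χ ≡ φ ∨ ψ → ⟦ ψ ⟧ ρ → ⟦ χ ⟧ ρ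
  ∨-introʳ {φ = φ} {ψ} refl q = proj₂ (⟦⟧-⇒ (¬′ φ) ψ) λ _ → q

  one-of : Fin n → List Sentence → Formula n
  one-of σ = foldr (λ τ χ → σ ≐ᵗ ⌜ τ ⌝ ∨ χ) ⊥ᶠ

  listed : (σ : Fin n) (ρ : Env n) (τs : List Sentence) {τ : Sentence} → τ ∈ τs → ρ σ ≈ᴹ code τ →
           ⟦ one-of σ τs ⟧ ρ
  listed σ ρ (τ ∷ τs) (here refl) e = ∨-introˡ {ρ = ρ} {φ = σ ≐ᵗ ⌜ τ ⌝} {ψ = one-of σ τs} refl
    (proj₂ (≐ᵗ-↔ σ ⌜ τ ⌝ ρ) (subst (ρ σ ≈ᴹ_) (sym (val-⌜⌝ τ ρ)) e))
  listed σ ρ (τ ∷ τs) (there i)   e =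
    ∨-introʳ {ρ = ρ} {φ = σ ≐ᵗ ⌜ τ ⌝} {ψ = one-of σ τs} refl (listed σ ρ τs i e)

  zfc-axiom : (ω F σ : Fin n) (ρ : Env n) {τ : Sentence} → τ ∈ finiteZFC → ρ σ ≈ᴹ code τ →
              ⟦ IsZFCAxiom ω F σ ⟧ ρ
  zfc-axiom ω F σ ρ i e = ∨-introˡ {ρ = ρ} {χ = IsZFCAxiom ω F σ} refl (listed σ ρ finiteZFC i e)

  module Decode {Y ρ γ ω Tm F x R : Carrier} where

    small-model′ :
      ⟦ 0F ≐ᵗ ｛ ⟨ # 0 , # 2 ⟩ ⸴ ⟨ # 0 , # 2 ⟩ ｝ ⟧ (ρ ∷ᵉ []ᵉ) →
      ⟦ IsSyntax 0F 1F 2F 3F 4F ⟧ (ρ ∷ᵉ γ ∷ᵉ ω ∷ᵉ Tm ∷ᵉ F ∷ᵉ []ᵉ) →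
      ⟦ IsMembershipStructure 0F 1F ⟧ (x ∷ᵉ Y ∷ᵉ []ᵉ) →
      ⟦ IsSatisfaction 0F 1F 2F 3F 4F 5F 6F 7F ⟧
        (ρ ∷ᵉ γ ∷ᵉ ω ∷ᵉ Tm ∷ᵉ F ∷ᵉ x ∷ᵉ Y ∷ᵉ R ∷ᵉ []ᵉ) →
      (∀ {τ k s} → τ ∈ finiteZFC → k ∈ᴹ ω → ⟪ k , code τ ⟫ ∈ᴹ F → Fun s k Y → ⟪ code τ , s ⟫ ∈ᴹ R) →
      SmallModel Y
    small-model′ ρ≐ (isω , (termClosed , _) , (formulaClosed , _)) (I , x≐ , I-↔)
                 (I′ , J , V , x≐′ , valuation , truth) axiom-true = record
      { isω = isω
      ; eq-formula  = λ {k} {i} {j} k∈ω i∈k j∈k →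
          proj₁ (∊ᵗ-↔ ⟨ v 0F , eqᶜ (v 1F) (v 2F) ⟩ 3F (k ∷ᵉ varᴹ i ∷ᵉ varᴹ j ∷ᵉ F ∷ᵉ []ᵉ))
            (proj₁ (formulaClosed k k∈ω) (varᴹ i) (varᴹ j)
              (proj₂ pair-in (variable-term k∈ω i∈k) , proj₂ pair-in (variable-term k∈ω j∈k)))
      ; mem-formula = λ {k} {i} {j} k∈ω i∈k j∈k →
          proj₁ (∊ᵗ-↔ ⟨ v 0F , relᶜ (v 1F) (v 2F) ⟩ 3F (k ∷ᵉ num 0 ∷ᵉ couple (varᴹ i) (varᴹ j) ∷ᵉ F ∷ᵉ []ᵉ))
            (proj₁ (proj₂ (formulaClosed k k∈ω)) (num 0) (num 2) (couple (varᴹ i) (varᴹ j))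
              (membership-symbol , variable-tuple k∈ω i∈k j∈k))
      ; bot-formula = λ {k} k∈ω →
          proj₁ (∊ᵗ-↔ ⟨ v 0F , botᶜ ⟩ 1F (k ∷ᵉ F ∷ᵉ []ᵉ)) (proj₁ (proj₂ (proj₂ (formulaClosed k k∈ω))))
      ; imp-formula = λ {k} {φ} {ψ} k∈ω p q →
          proj₁ (∊ᵗ-↔ ⟨ v 0F , impᶜ (v 1F) (v 2F) ⟩ 3F (k ∷ᵉ φ ∷ᵉ ψ ∷ᵉ F ∷ᵉ []ᵉ))
            (proj₁ (proj₂ (proj₂ (proj₂ (formulaClosed k k∈ω)))) φ ψ (proj₂ pair-in p , proj₂ pair-in q))
      ; all-formula = λ {k} {i} {φ} k∈ω i∈k p →
          proj₁ (∊ᵗ-↔ ⟨ v 0F , allᶜ (v 1F) (v 2F) ⟩ 3F (k ∷ᵉ i ∷ᵉ φ ∷ᵉ F ∷ᵉ []ᵉ))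
            (proj₂ (proj₂ (proj₂ (proj₂ (formulaClosed k k∈ω)))) i i∈k φ (proj₂ pair-in p))
      ; eq-true     = eq-true
      ; mem-true    = mem-true
      ; bot-true    = λ {k} {s} k∈ω isFun p →
          proj₁ (proj₂ (proj₂ (truth k k∈ω s (proj₂ fun-↔ isFun))))
            (proj₂ (∊ᵗ-↔ ⟨ botᶜ , v 0F ⟩ 1F (s ∷ᵉ R ∷ᵉ []ᵉ)) p)
      ; imp-true    = imp-true
      ; all-true    = all-true
      ; axiom-true  = axiom-true
      }
      where
      variable-term : ∀ {k i} → k ∈ᴹ ω → i ∈ᴹ k → ⟪ k , varᴹ i ⟫ ∈ᴹ Tm
      variable-term {k} {i} k∈ω i∈k =
        proj₁ (∊ᵗ-↔ ⟨ v 0F , varᶜ (v 1F) ⟩ 2F (k ∷ᵉ i ∷ᵉ Tm ∷ᵉ []ᵉ)) (proj₁ (termClosed k k∈ω) i i∈k)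

      membership-symbol : ⟦ ⟨ v 1F , v 2F ⟩ ∊ᵗ 0F ⟧ (ρ ∷ᵉ num 0 ∷ᵉ num 2 ∷ᵉ []ᵉ)
      membership-symbol = proj₂ pair-in (∈-respʳ (≈-sym
        (proj₁ (≐ᵗ-↔ 0F ｛ ⟨ # 0 , # 2 ⟩ ⸴ ⟨ # 0 , # 2 ⟩ ｝ (ρ ∷ᵉ []ᵉ)) ρ≐)) pairˡ)

      variable-tuple : ∀ {k i j} → k ∈ᴹ ω → i ∈ᴹ k → j ∈ᴹ k →
        ⟦ IsTermTuple 0F 1F 2F 3F ⟧ (Tm ∷ᵉ k ∷ᵉ couple (varᴹ i) (varᴹ j) ∷ᵉ num 2 ∷ᵉ []ᵉ)
      variable-tuple {k} {i} {j} k∈ω i∈k j∈k =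
        (pairᴹ (varᴹ i) (varᴹ j) , proj₂ fun-↔ (couple-fun pairˡ pairʳ)) ,
        λ l t p → proj₂ pair-in (couple-elim (proj₁ pair-in p)
          (λ _ e → ∈-respˡ (⟪⟫-cong (≈ᴹ-refl k) (≈-sym e)) (variable-term k∈ω i∈k))
          λ _ e → ∈-respˡ (⟪⟫-cong (≈ᴹ-refl k) (≈-sym e)) (variable-term k∈ω j∈k))

      -- `IsSatisfaction` quantifies over its own interpretation; both are read off the same `x`, so
      -- injectivity of pairs identifies them.
      I′≈I : I′ ≈ᴹ I
      I′≈I = proj₁ (⟪⟫-injective (proj₂ (⟪⟫-injective (≈-trans
        (≈-sym (proj₁ (≐ᵗ-↔ 0F ⟨ v 1F , ⟨ v 2F , v 3F ⟩ ⟩ (x ∷ᵉ Y ∷ᵉ I′ ∷ᵉ J ∷ᵉ []ᵉ)) x≐′))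
        (proj₁ (≐ᵗ-↔ 0F ⟨ v 1F , ⟨ v 2F , ∅ ⟩ ⟩ (x ∷ᵉ Y ∷ᵉ I ∷ᵉ []ᵉ)) x≐)))))

      variable-value : ∀ {k s i} → k ∈ᴹ ω → Fun s k Y → i ∈ᴹ k → ∀ d →
                       ⟪ ⟪ varᴹ i , s ⟫ , d ⟫ ∈ᴹ V ↔ ⟪ i , d ⟫ ∈ᴹ s
      variable-value {k} {s} {i} k∈ω isFun i∈k d =
        (λ p → proj₁ pair-in (proj₁ clause (proj₂ here′ p))) ,
        λ p → proj₁ here′ (proj₂ clause (proj₂ pair-in p))
        where
        here′ = ∊ᵗ-↔ ⟨ ⟨ varᶜ (v 0F) , v 1F ⟩ , v 2F ⟩ 3F (i ∷ᵉ s ∷ᵉ d ∷ᵉ V ∷ᵉ []ᵉ)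
        clause = proj₁ (valuation k k∈ω s (proj₂ fun-↔ isFun)) i i∈k d

      value-in : ∀ {t s d} → ⟦ ⟨ ⟨ v 0F , v 1F ⟩ , v 2F ⟩ ∊ᵗ 3F ⟧ (t ∷ᵉ s ∷ᵉ d ∷ᵉ V ∷ᵉ []ᵉ) ↔
                 ⟪ ⟪ t , s ⟫ , d ⟫ ∈ᴹ V
      value-in {t} {s} {d} = ∊ᵗ-↔ ⟨ ⟨ v 0F , v 1F ⟩ , v 2F ⟩ 3F (t ∷ᵉ s ∷ᵉ d ∷ᵉ V ∷ᵉ []ᵉ)

      eq-true : ∀ {k s i j} → k ∈ᴹ ω → Fun s k Y → i ∈ᴹ k → j ∈ᴹ k →
                ⟪ eqᴹ i j , s ⟫ ∈ᴹ R ↔ (Σ Carrier λ d → (⟪ i , d ⟫ ∈ᴹ s) × (⟪ j , d ⟫ ∈ᴹ s))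
      eq-true {k} {s} {i} {j} k∈ω isFun i∈k j∈k =
        (λ p → let d , q , r = proj₁ clause (proj₂ here′ p) in
          d , proj₁ (variable-value k∈ω isFun i∈k d) (proj₁ value-in q) ,
              proj₁ (variable-value k∈ω isFun j∈k d) (proj₁ value-in r)) ,
        λ (d , q , r) → proj₁ here′ (proj₂ clause
          (d , proj₂ value-in (proj₂ (variable-value k∈ω isFun i∈k d) q) ,
               proj₂ value-in (proj₂ (variable-value k∈ω isFun j∈k d) r)))
        where
        here′ = ∊ᵗ-↔ ⟨ eqᶜ (v 0F) (v 1F) , v 2F ⟩ 3F (varᴹ i ∷ᵉ varᴹ j ∷ᵉ s ∷ᵉ R ∷ᵉ []ᵉ)
        clause = proj₁ (truth k k∈ω s (proj₂ fun-↔ isFun)) (varᴹ i) (varᴹ j)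
          (proj₂ pair-in (variable-term k∈ω i∈k) , proj₂ pair-in (variable-term k∈ω j∈k))

      I-couple : ∀ {a} → ⟪ num 0 , a ⟫ ∈ᴹ I ↔
        (Σ Carrier λ b → (b ∈ᴹ Y) × Σ Carrier λ c → (c ∈ᴹ Y) × (b ∈ᴹ c) × (a ≈ᴹ couple b c))
      I-couple {a} =
        (λ p → let b , i , c , j , l , e = proj₁ (I-↔ _) p in
          b , i , c , j , l , proj₂ (⟪⟫-injective (proj₁ (shape b c) e))) ,
        λ (b , i , c , j , l , e) →
          proj₂ (I-↔ _) (b , i , c , j , l , proj₂ (shape b c) (⟪⟫-cong (≈ᴹ-refl _) e))
        where
        shape = λ b c → ≐ᵗ-↔ 0F ⟨ # 0 , ｛ ⟨ # 0 , v 1F ⟩ ⸴ ⟨ # 1 , v 2F ⟩ ｝ ⟩ (⟪ num 0 , a ⟫ ∷ᵉ b ∷ᵉ c ∷ᵉ []ᵉ)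

      mem-true : ∀ {k s i j} → k ∈ᴹ ω → Fun s k Y → i ∈ᴹ k → j ∈ᴹ k →
                 ⟪ memᴹ i j , s ⟫ ∈ᴹ R ↔
                 (Σ Carrier λ a → Σ Carrier λ b → (⟪ i , a ⟫ ∈ᴹ s) × (⟪ j , b ⟫ ∈ᴹ s) × (a ∈ᴹ b))
      mem-true {k} {s} {i} {j} k∈ω isFun i∈k j∈k =
        -- Membership in the interpretation shows that `a` is a couple of some `b` and `c` with
        -- `b ∈ᴹ c`; `values` then identifies these with the values of the two variables.
        (λ p → let a , _ , values , q = proj₁ clause (proj₂ here′ p)
                   b , _ , c , _ , b∈c , e = proj₁ I-couple (∈-respʳ I′≈I (proj₁ pair-in q))
                   value₀ = values (num 0) (varᴹ i) b
                     (proj₂ pair-in pairˡ , proj₂ pair-in (∈-respʳ (≈-sym e) pairˡ))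
                   value₁ = values (num 1) (varᴹ j) c
                     (proj₂ pair-in pairʳ , proj₂ pair-in (∈-respʳ (≈-sym e) pairʳ))
               in b , c , proj₁ (variable-value k∈ω isFun i∈k b) (proj₁ value-in value₀) ,
                          proj₁ (variable-value k∈ω isFun j∈k c) (proj₁ value-in value₁) , b∈c) ,
        λ (b , c , p , q , b∈c) → proj₁ here′ (proj₂ clause
          ( couple b c
          , proj₂ fun-↔ (couple-fun (proj₂ (fun-type isFun p)) (proj₂ (fun-type isFun q)))
          , (λ l t d (x , y) → proj₂ value-in (value-tuple p q (proj₁ pair-in x) (proj₁ pair-in y)))
          , proj₂ pair-in (∈-respʳ (≈-sym I′≈I) (proj₂ I-couple
              (b , proj₂ (fun-type isFun p) , c , proj₂ (fun-type isFun q) , b∈c , ≈ᴹ-refl _)))))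
        where
        u = couple (varᴹ i) (varᴹ j)
        here′ = ∊ᵗ-↔ ⟨ relᶜ (v 0F) (v 1F) , v 2F ⟩ 3F (num 0 ∷ᵉ u ∷ᵉ s ∷ᵉ R ∷ᵉ []ᵉ)
        clause = proj₁ (proj₂ (truth k k∈ω s (proj₂ fun-↔ isFun))) (num 0) (num 2) u
          (membership-symbol , variable-tuple k∈ω i∈k j∈k)
        value-tuple : ∀ {b c l t d} → ⟪ i , b ⟫ ∈ᴹ s → ⟪ j , c ⟫ ∈ᴹ s → ⟪ l , t ⟫ ∈ᴹ u →
                      ⟪ l , d ⟫ ∈ᴹ couple b c → ⟪ ⟪ t , s ⟫ , d ⟫ ∈ᴹ V
        value-tuple {b} {c} p q x y = couple-elim x
          (λ l≈0 t≈i → couple-elim y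
            (λ _ d≈b → ∈-respˡ (⟪⟫-cong (⟪⟫-cong (≈-sym t≈i) (≈ᴹ-refl s)) (≈-sym d≈b))
                         (proj₂ (variable-value k∈ω isFun i∈k b) p))
            λ l≈1 _ → exfalso (0≉1 (≈-trans (≈-sym l≈0) l≈1)))
          λ l≈1 t≈j → couple-elim y
            (λ l≈0 _ → exfalso (0≉1 (≈-trans (≈-sym l≈0) l≈1)))
            λ _ d≈c → ∈-respˡ (⟪⟫-cong (⟪⟫-cong (≈-sym t≈j) (≈ᴹ-refl s)) (≈-sym d≈c))
                        (proj₂ (variable-value k∈ω isFun j∈k c) q)

      imp-true : ∀ {k s φ ψ} → k ∈ᴹ ω → Fun s k Y → ⟪ k , φ ⟫ ∈ᴹ F → ⟪ k , ψ ⟫ ∈ᴹ F →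
                 ⟪ impᴹ φ ψ , s ⟫ ∈ᴹ R ↔ (⟪ φ , s ⟫ ∈ᴹ R → ⟪ ψ , s ⟫ ∈ᴹ R)
      imp-true {k} {s} {φ} {ψ} k∈ω isFun p q =
        (λ h r → proj₁ pair-in (proj₁ clause (proj₂ here′ h) (proj₂ pair-in r))) ,
        λ h → proj₁ here′ (proj₂ clause λ r → proj₂ pair-in (h (proj₁ pair-in r)))
        where
        here′ = ∊ᵗ-↔ ⟨ impᶜ (v 0F) (v 1F) , v 2F ⟩ 3F (φ ∷ᵉ ψ ∷ᵉ s ∷ᵉ R ∷ᵉ []ᵉ)
        clause = proj₁ (proj₂ (proj₂ (proj₂ (truth k k∈ω s (proj₂ fun-↔ isFun))))) φ ψ
          (proj₂ pair-in p , proj₂ pair-in q)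

      all-true : ∀ {k s i φ} → k ∈ᴹ ω → Fun s k Y → i ∈ᴹ k → ⟪ k , φ ⟫ ∈ᴹ F →
                 ⟪ allᴹ i φ , s ⟫ ∈ᴹ R ↔
                 (∀ s′ → Fun s′ k Y →
                  (∀ j d → (j ≈ᴹ i → ⊥̇) → (⟪ j , d ⟫ ∈ᴹ s′ ↔ ⟪ j , d ⟫ ∈ᴹ s)) → ⟪ φ , s′ ⟫ ∈ᴹ R)
      all-true {k} {s} {i} {φ} k∈ω isFun i∈k p =
        (λ h s′ isFun′ agree → proj₁ pair-in (proj₁ clause (proj₂ here′ h) s′
          (proj₂ fun-↔ isFun′ , λ j d j≉i →
            (λ q → proj₂ pair-in (proj₁ (agree j d j≉i) (proj₁ pair-in q))) ,
            λ q → proj₂ pair-in (proj₂ (agree j d j≉i) (proj₁ pair-in q))))) ,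
        λ h → proj₁ here′ (proj₂ clause λ s′ (isFun′ , agree) → proj₂ pair-in
          (h s′ (proj₁ fun-↔ isFun′) λ j d j≉i →
            (λ q → proj₁ pair-in (proj₁ (agree j d j≉i) (proj₂ pair-in q))) ,
            λ q → proj₁ pair-in (proj₂ (agree j d j≉i) (proj₂ pair-in q))))
        where
        here′ = ∊ᵗ-↔ ⟨ allᶜ (v 0F) (v 1F) , v 2F ⟩ 3F (i ∷ᵉ φ ∷ᵉ s ∷ᵉ R ∷ᵉ []ᵉ)
        clause = proj₂ (proj₂ (proj₂ (proj₂ (truth k k∈ω s (proj₂ fun-↔ isFun))))) i i∈k φ (proj₂ pair-in p)

module ZFCModels {T : Theory ℓ} (𝔐 : Model T) (bst : ∀ {τ} → BST τ → T ⊢ τ) where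

  open SetTheory 𝔐 bst
  open Functions 𝔐 bst
  open SmallModels 𝔐 bst

  -- Works on `_⊨_`, where formulas stay folded, so that `truth` evaluates only the pieces that are
  -- used.
  ∃-elim : ∀ {c} {C : Set c} {ρ : Env n} {φ : Formula (suc n)} →
           ρ ⊨ ∃′ φ → (∀ x → x ∷ᵉ ρ ⊨ φ → C) → C
  ∃-elim h k = let x , p = proj₁ ⊨-∃ h in k x p

  ∧-elim : ∀ {c} {C : Set c} {ρ : Env n} {φ ψ : Formula n} →
           ρ ⊨ φ ∧ ψ → (ρ ⊨ φ → ρ ⊨ ψ → C) → C
  ∧-elim h k = let p , q = proj₁ ⊨-∧ h in k p q

  specialize : {ρ : Env n} {φ ψ : Formula (suc n)} →
               ρ ⊨ ∀′ (φ ⇒ ψ) → ∀ x → x ∷ᵉ ρ ⊨ φ → x ∷ᵉ ρ ⊨ ψ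
  specialize h x = proj₁ ⊨-⇒ (⊨-∀ h x)

  -- ModelsZFC with a variable in place of IsZFCAxiom, whose unfolding is huge.
  ModelsOver : (∀ {m} → Fin m → Fin m → Fin m → Formula m) → Fin n → Formula n
  ModelsOver A y = ∃[ ρ ] ∃[ γ ] ∃[ ω ] ∃[ T ] ∃[ F ] ∃[ x ] ∃[ R ]
    ρ ↑ 6 ≐ᵗ ｛ ⟨ # 0 , # 2 ⟩ ⸴ ⟨ # 0 , # 2 ⟩ ｝ ∧
    γ ↑ 5 ≐ᵗ ∅ ∧
    IsSyntax (ρ ↑ 6) (γ ↑ 5) (ω ↑ 4) (T ↑ 3) (F ↑ 2) ∧
    IsMembershipStructure (x ↑ 1) (y ↑ 7) ∧
    IsSatisfaction (ρ ↑ 6) (γ ↑ 5) (ω ↑ 4) (T ↑ 3) (F ↑ 2) (x ↑ 1) (y ↑ 7) R ∧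
    (∀[ σ ] A (ω ↑ 5) (F ↑ 3) σ ⇒
      (∀[ k ∈ ω ↑ 5 ] ∀[ s ]
         ⟨ v (k ↑ 1) , v (σ ↑ 2) ⟩ ∊ᵗ F ↑ 5 ∧ s ∶ k ↑ 1 ⟶ y ↑ 10 ⇒
         ⟨ v (σ ↑ 2) , v s ⟩ ∊ᵗ R ↑ 3))

  Loc-over : (∀ {m} → Fin m → Fin m → Fin m → Formula m) → Sentence
  Loc-over A = ∀[ x ] ∃[ y ] x ↑ 1 ∊ y ∧ Transitive y ∧ ModelsOver A y

  loc-over : T ⊢ Loc-ZFC → T ⊢ Loc-over IsZFCAxiom
  loc-over d = d

  small-model : ∀ {X Y} (A : ∀ {m} → Fin m → Fin m → Fin m → Formula m) →
    (∀ {m} (ω F σ : Fin m) {ρ : Env m} {τ} → τ ∈ finiteZFC → ρ σ ≈ᴹ code τ → ρ ⊨ A ω F σ) →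
    Y ∷ᵉ X ∷ᵉ []ᵉ ⊨ ModelsOver A 0F → SmallModel Y
  small-model A A-axiom h =
    ∃-elim h λ ρ h → ∃-elim h λ γ h → ∃-elim h λ ω h → ∃-elim h λ Tm h →
    ∃-elim h λ F h → ∃-elim h λ x h → ∃-elim h λ R h →
    ∧-elim h λ ρ≐ h → ∧-elim h λ _ h → ∧-elim h λ syntax′ h → ∧-elim h λ membership h →
    ∧-elim h λ satisfaction axioms →
    Decode.small-model′ (proj₁ (truth _) ρ≐) (proj₁ (truth _) syntax′) (proj₁ (truth _) membership)
      (proj₁ (truth _) satisfaction) λ {τ} {k} {s} i k∈ω p isFun →
        let true-axiom = specialize axioms (code τ) (A-axiom _ _ zero i (≈ᴹ-refl _))
        in proj₁ pair-in (proj₁ (truth _) (specialize (specialize true-axiom k (proj₂ ⊨-∊ k∈ω)) s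
             (proj₂ ⊨-∧ (proj₂ (truth _) (proj₂ pair-in p) , proj₂ (truth _) (proj₂ fun-↔ isFun)))))

  TransitiveModel : Carrier → Set ℓ
  TransitiveModel x = Σ Carrier λ Y → (x ∈ᴹ Y) × (∀ z → z ∈ᴹ Y → ∀ w → w ∈ᴹ z → w ∈ᴹ Y) × SmallModel Y

  localize-over : (A : ∀ {m} → Fin m → Fin m → Fin m → Formula m) →
    (∀ {m} (ω F σ : Fin m) {ρ : Env m} {τ} → τ ∈ finiteZFC → ρ σ ≈ᴹ code τ → ρ ⊨ A ω F σ) →
    []ᵉ ⊨ Loc-over A → ∀ x → TransitiveModel x
  localize-over A A-axiom h x =
    ∃-elim (⊨-∀ h x) λ Y h → ∧-elim h λ x∈Y h → ∧-elim h λ trans 𝔖 →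
    Y , proj₁ ⊨-∊ x∈Y , proj₁ (truth (Transitive 0F) {Y ∷ᵉ x ∷ᵉ []ᵉ}) trans ,
    small-model {x} {Y} A A-axiom 𝔖

  zfc-axiom-⊨ : (ω F σ : Fin n) {ρ : Env n} {τ : Sentence} → τ ∈ finiteZFC → ρ σ ≈ᴹ code τ →
                ρ ⊨ IsZFCAxiom ω F σ
  zfc-axiom-⊨ ω F σ {ρ} i e = proj₂ (truth (IsZFCAxiom ω F σ) {ρ}) (zfc-axiom ω F σ ρ i e)

  localize : T ⊢ Loc-ZFC → ∀ x → TransitiveModel x
  localize loc = localize-over IsZFCAxiom zfc-axiom-⊨ (⊨-theorem (loc-over loc))

-- Relativization, Foundation and Choice

module LocalZFC {T : Theory ℓ} (𝔐 : Model T) (bst : ∀ {τ} → BST τ → T ⊢ τ) (loc : T ⊢ Loc-ZFC) where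

  open SetTheory 𝔐 bst
  open Functions 𝔐 bst
  open SmallModels 𝔐 bst
  open ZFCModels 𝔐 bst

  relativize : (Fin m → Fin n) → Fin n → Formula m → Formula n
  relativize r y ⊥ᶠ      = ⊥ᶠ
  relativize r y (i ≐ j) = r i ≐ r j
  relativize r y (i ∊ j) = r i ∊ r j
  relativize r y (φ ⇒ ψ) = relativize r y φ ⇒ relativize r y ψ
  relativize r y (∀′ φ)  = ∀′ (zero ∊ suc y ⇒ relativize (liftᶠ 1 r) (suc y) φ)

  -- Bound variables are named by their depth, so `φ` uses only names below its deepest scope. This
  -- matches the pairs of `F`, whose first entry bounds free and bound variables alike.
  width : Formula m → ℕ
  width {m} ⊥ᶠ      = m
  width {m} (_ ≐ _) = m
  width {m} (_ ∊ _) = m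
  width (φ ⇒ ψ)     = width φ ⊔ width ψ
  width (∀′ φ)      = width φ

  scope≤width : (φ : Formula m) → m ≤ width φ
  scope≤width ⊥ᶠ      = ≤-refl
  scope≤width (_ ≐ _) = ≤-refl
  scope≤width (_ ∊ _) = ≤-refl
  scope≤width (φ ⇒ ψ) = ≤-trans (scope≤width φ) (m≤m⊔n _ _)
  scope≤width (∀′ φ)  = ≤-trans (n≤1+n _) (scope≤width φ)

  position : Fin m → ℕ
  position i = toℕ (opposite i)

  module _ {Y : Carrier} (𝔖 : SmallModel Y) where

    open SmallModel 𝔖

    position∈ : ∀ {K} → m ≤ K → (i : Fin m) → num (position i) ∈ᴹ num K
    position∈ le i = num-< (≤-trans (toℕ<n (opposite i)) le)

    formula-code : (φ : Formula m) {K : ℕ} → width φ ≤ K → ⟪ num K , code φ ⟫ ∈ᴹ F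
    formula-code ⊥ᶠ      {K} le = bot-formula (num∈ω isω K)
    formula-code (i ≐ j) {K} le = eq-formula (num∈ω isω K) (position∈ le i) (position∈ le j)
    formula-code (i ∊ j) {K} le = mem-formula (num∈ω isω K) (position∈ le i) (position∈ le j)
    formula-code (φ ⇒ ψ) {K} le = imp-formula (num∈ω isω K)
      (formula-code φ (m⊔n≤o⇒m≤o _ _ le)) (formula-code ψ (m⊔n≤o⇒n≤o _ _ le))
    formula-code (∀′ φ)  {K} le = all-formula (num∈ω isω K)
      (num-< (≤-trans (scope≤width φ) le)) (formula-code φ le)

    Assigns : Carrier → Vector Carrier m → Set ℓ
    Assigns s a = ∀ i → ⟪ num (position i) , a i ⟫ ∈ᴹ s

    -- Levels survive a binder: `suc i` has the position that `i` had, and the new variable receives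
    -- position `m`.
    extend : ∀ {s s′ x} {a : Vector Carrier m} → Assigns s a → ⟪ num m , x ⟫ ∈ᴹ s′ →
             (∀ j d → (j ≈ᴹ num m → ⊥̇) → ⟪ j , d ⟫ ∈ᴹ s → ⟪ j , d ⟫ ∈ᴹ s′) →
             Assigns s′ (x ∷ᵉ a)
    extend {m} {s′ = s′} {x} as new old zero =
      subst (λ k → ⟪ num k , x ⟫ ∈ᴹ s′) (sym (toℕ-fromℕ m)) new
    extend {m} {s′ = s′} {a = a} as new old (suc i) =
      subst (λ k → ⟪ num k , a i ⟫ ∈ᴹ s′) (sym (toℕ-inject₁ (opposite i)))
        (old _ _ (num-distinct (toℕ<n (opposite i))) (as i))

    -- As `K` leaves room for the bound variables, assignments keep the domain `num K` throughout
    -- the induction. Under a quantifier, an element of `Y` becomes an assignment by updating `s` at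
    -- `m`, and an assignment `s′` becomes an element by evaluation at `m`.
    satisfies : (φ : Formula m) {K : ℕ} → width φ ≤ K → ∀ {s} → Fun s (num K) Y →
                {r : Fin m → Fin n} {y : Fin n} {ρ : Env n} → ρ y ≡ Y → Assigns s (ρ ∘ r) →
                ⟪ code φ , s ⟫ ∈ᴹ R ↔ ⟦ relativize r y φ ⟧ ρ
    satisfies ⊥ᶠ {K} le isFun eq as = bot-true (num∈ω isω K) isFun , exfalso
    satisfies (i ≐ j) {K} le {s} isFun {r} {ρ = ρ} eq as =
      (λ h → let d , p , q = proj₁ true h in
        ≈-trans (fun-unique isFun (as i) p) (fun-unique isFun q (as j))) ,
      λ e → proj₂ true (_ , as i , ∈-respˡ (⟪⟫-cong (≈ᴹ-refl _) (≈-sym e)) (as j))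
      where
      true = eq-true (num∈ω isω K) isFun (position∈ le i) (position∈ le j)
    satisfies (i ∊ j) {K} le isFun eq as =
      (λ h → let a , b , p , q , a∈b = proj₁ true h in
        ∈-respˡ (fun-unique isFun p (as i)) (∈-respʳ (fun-unique isFun q (as j)) a∈b)) ,
      λ a∈b → proj₂ true (_ , _ , as i , as j , a∈b)
      where
      true = mem-true (num∈ω isω K) isFun (position∈ le i) (position∈ le j)
    satisfies (φ ⇒ ψ) {K} le {s} isFun {r} {y} {ρ} eq as =
      (λ h → proj₂ (⟦⟧-⇒ (relativize r y φ) (relativize r y ψ)) λ p →
        proj₁ right (proj₁ true h (proj₂ left p))) ,
      λ h → proj₂ true λ p →
        proj₂ right (proj₁ (⟦⟧-⇒ (relativize r y φ) (relativize r y ψ)) h (proj₁ left p))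
      where
      left  = satisfies φ (m⊔n≤o⇒m≤o _ _ le) isFun {r} {y} {ρ} eq as
      right = satisfies ψ (m⊔n≤o⇒n≤o _ _ le) isFun {r} {y} {ρ} eq as
      true = imp-true (num∈ω isω K) isFun
        (formula-code φ (m⊔n≤o⇒m≤o _ _ le)) (formula-code ψ (m⊔n≤o⇒n≤o _ _ le))
    satisfies {m} {n} (∀′ φ) {K} le {s} isFun {r} {y} {ρ} refl as =
      (λ h x → proj₂ (⟦⟧-⇒ (zero ∊ suc y) φ′) (forward h x)) ,
      λ h → proj₂ true (backward λ x → proj₁ (⟦⟧-⇒ (zero ∊ suc y) φ′) (h x))
      where
      φ′ : Formula (suc n)
      φ′ = relativize (liftᶠ 1 r) (suc y) φ
      m∈K : num m ∈ᴹ num K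
      m∈K = num-< (≤-trans (scope≤width φ) le)
      true = all-true (num∈ω isω K) isFun m∈K (formula-code φ le)
      lifted : ∀ {s′ x} → Assigns s′ (x ∷ᵉ (ρ ∘ r)) → Assigns s′ ((x ∷ᵉ ρ) ∘ liftᶠ 1 r)
      lifted as zero    = as zero
      lifted as (suc i) = as (suc i)
      forward : ⟪ code (∀′ φ) , s ⟫ ∈ᴹ R → ∀ x → x ∈ᴹ Y → ⟦ φ′ ⟧ (x ∷ᵉ ρ)
      forward h x x∈Y = proj₁ (satisfies φ le isFun′ refl (lifted (extend as
          (proj₂ (U.update-at isFun m∈K x∈Y x) (≈ᴹ-refl x))
          λ j d j≉m → proj₂ (U.update-off isFun m∈K x∈Y j≉m d))))
        (proj₁ true h U.update isFun′ λ j d j≉m → U.update-off isFun m∈K x∈Y j≉m d)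
        where
        module U = Update s (num m) x Y
        isFun′ = U.update-fun isFun m∈K x∈Y
      backward : (∀ x → x ∈ᴹ Y → ⟦ φ′ ⟧ (x ∷ᵉ ρ)) → ∀ s′ → Fun s′ (num K) Y →
        (∀ j d → (j ≈ᴹ num m → ⊥̇) → (⟪ j , d ⟫ ∈ᴹ s′ ↔ ⟪ j , d ⟫ ∈ᴹ s)) → ⟪ code φ , s′ ⟫ ∈ᴹ R
      backward h s′ isFun′ agree = let x , p = fun-value isFun′ m∈K in
        proj₂ (satisfies φ le isFun′ refl (lifted (extend as p λ j d j≉m → proj₂ (agree j d j≉m))))
          (h x (proj₂ (fun-type isFun′ p)))

    relativized : {τ : Sentence} → τ ∈ finiteZFC → ∀ {x} → x ∈ᴹ Y →
                  ⟦ relativize (λ ()) 0F τ ⟧ (Y ∷ᵉ []ᵉ)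
    relativized {τ} i x∈Y = proj₁ (satisfies τ ≤-refl isFun refl λ ())
      (axiom-true i (num∈ω isω (width τ)) (formula-code τ ≤-refl) isFun)
      where
      -- Even a sentence is evaluated under an assignment of length `width τ`, because its bound
      -- variables need room; a constant function provides one.
      isFun = constant {A = num (width τ)} x∈Y

  -- All elements of `x` lie in `Y` by transitivity, so an element of `x` that is minimal in the
  -- sense of `Y` is minimal outright.
  foundation-holds : ⟦ foundation ⟧ []ᵉ
  foundation-holds x (y , y∈x) = from (localize loc x)
    where
    from : TransitiveModel x →
           Σ Carrier λ y → (y ∈ᴹ x) × ((Σ Carrier λ z → (z ∈ᴹ x) × (z ∈ᴹ y)) → ⊥̇)
    from (Y , x∈Y , transitive , 𝔖) =
      let w , _ , w∈x , minimal = relativized 𝔖 (there (here refl)) x∈Y x x∈Y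
                                (y , transitive x x∈Y y y∈x , y∈x)
      in w , w∈x , λ (z , z∈x , z∈w) → minimal (z , transitive x x∈Y z z∈x , z∈x , z∈w)

  -- Members of `A` and their elements lie in `Y`. So the hypotheses pass down to `Y`, and the trace
  -- of `c` on a member of `A` is the same in `Y` and outside.
  choice-holds : ⟦ choice ⟧ []ᵉ
  choice-holds A (inhabited , disjoint) = from (localize loc A)
    where
    from : TransitiveModel A →
           Σ Carrier λ c → ∀ x → x ∈ᴹ A → Σ Carrier λ z → ∀ u → ((u ∈ᴹ x) × (u ∈ᴹ c) ↔ u ≈ᴹ z)
    from (Y , A∈Y , transitive , 𝔖) =
      let c , _ , h = relativized 𝔖 (there (there (there (there (there (there (here refl))))))) A∈Y A A∈Y
            ( (λ x x∈Y x∈A → let z , z∈x = inhabited x x∈A in z , transitive x x∈Y z z∈x , z∈x)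
            , λ x _ x∈A y _ y∈A (z , _ , z∈x , z∈y) → disjoint x x∈A y y∈A (z , z∈x , z∈y))
      in c , λ x x∈A → let x∈Y = transitive A A∈Y x x∈A
                           z , z∈Y , k = h x x∈Y x∈A in
         z , λ u → (λ (u∈x , u∈c) → proj₁ (k u (transitive x x∈Y u u∈x)) (u∈x , u∈c)) ,
                   λ e → proj₂ (k u (∈-respˡ (≈-sym e) z∈Y)) e

-- From truth in all models back to derivations

module _ {T : Theory ℓ} (bst : ∀ {τ} → BST τ → T ⊢ τ) (loc : T ⊢ Loc-ZFC)
         (vop : ∀ {τ} → VP τ → T ⊢ τ) where

  module _ (𝔐 : Model T) where

    open SetTheory 𝔐 bst
    open Comprehension 𝔐 bst vop
    open LocalZFC 𝔐 bst loc

    zfc-holds : ∀ {τ} → ZFC τ → ⟦ τ ⟧ []ᵉ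
    zfc-holds (sep φ)  = separation-holds φ
    zfc-holds (repl φ) = replacement-holds φ
    zfc-holds (finite (here refl)) =
      theorem (bst (finite (there (here refl))))
    zfc-holds (finite (there (here refl))) = foundation-holds
    zfc-holds (finite (there (there (here refl)))) =
      theorem (bst (finite (there (there (here refl)))))
    zfc-holds (finite (there (there (there (here refl))))) =
      theorem (bst (finite (there (there (there (here refl))))))
    zfc-holds (finite (there (there (there (there (here refl)))))) = powersetᴹ
    zfc-holds (finite (there (there (there (there (there (here refl))))))) =
      ωᴹ , proj₁ ωᴹ-isOmega
    zfc-holds (finite (there (there (there (there (there (there (here refl)))))))) =
      choice-holds

  derive-zfc : ∀ {τ} → ZFC τ → T ⊢ τ
  derive-zfc {τ} z = completeness λ 𝔐 → proj₂ (Semantics.truth 𝔐 τ) (zfc-holds 𝔐 z)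

cut : {T : Theory ℓ₁} {T′ : Theory ℓ₂} → (∀ {τ} → T τ → T′ ⊢ τ) → T ⊑ T′
cut ax σ d = subst (_ ⊢_) (rename-id (λ ()) σ) (transport (λ t → weaken-closed (ax t)) id (λ ()) d)

axiom-derivable : {T : Theory ℓ} {τ : Sentence} → T τ → T ⊢ τ
axiom-derivable {τ = τ} t = subst (_ ⊢_) (rename-id (λ ()) τ) (axiom t)

theorem6p3 : ∀ {ℓ : Level} (T : Theory ℓ) → LZFC ⊑ T → T ⊢ V-P-H → ZFC ⊑ (T ∪ VP)
theorem6p3 T lzfc _ = cut (derive-zfc
  (λ b → extended (lzfc _ (axiom-derivable (inj₁ b))))
  (extended (lzfc _ (axiom-derivable (inj₂ refl))))
  (λ p → axiom-derivable (inj₂ p)))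
  where
  extended : ∀ {τ} → T ⊢ τ → T ∪ VP ⊢ τ
  extended = cut (λ t → axiom-derivable (inj₁ t)) _
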